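{- Let $n=3$ and let $a_1=\mathrm{id}$, $a_2=s_0$, $a_3=s_0s_1$, $a_4=s_0s_3$, $a_5=s_0s_1s_3$, $a_6=s_0s_1s_3s_2$ (these are the elements of $\mathcal{F}$). For each $a\in\mathcal{F}$ there exist unique real numbers $\mu_{J,a}$, $J\subseteq\{1,2,3\}$, such that for all $x,y,z\in\mathbb{Z}_{\ge0}$, $$|\mathcal{I}_a(x\varpi_1+y\varpi_2+z\varpi_3)|=\sum_{J\subseteq\{1,2,3\}}\mu_{J,a}V_J(x,y,z).$$ Explicitly, listing $(\mu_{\emptyset,a},\mu_{\{1\},a},\mu_{\{2\},a},\mu_{\{3\},a},\mu_{\{1,2\},a},\mu_{\{1,3\},a},\mu_{\{2,3\},a},\mu_{\{1,2,3\},a})$: $a_1$: $(24,\,22\sqrt2,\,28\sqrt2,\,22\sqrt2,\,16\sqrt3,\,36,\,16\sqrt3,\,12)$; $a_2$: $(48,\,40\sqrt2,\,52\sqrt2,\,40\sqrt2,\,24\sqrt3,\,60,\,24\sqrt3,\,12)$; $a_3$: $(72,\,52\sqrt2,\,70\sqrt2,\,58\sqrt2,\,24\sqrt3,\,72,\,32\sqrt3,\,12)$; $a_4$: $(72,\,58\sqrt2,\,70\sqrt2,\,52\sqrt2,\,32\sqrt3,\,72,\,24\sqrt3,\,12)$; $a_5$: $(120,\,82\sqrt2,\,100\sqrt2,\,82\sqrt2,\,32\sqrt3,\,96,\,32\sqrt3,\,12)$; $a_6$: $(192,\,112\sqrt2,\,148\sqrt2,\,112\sqrt2,\,40\sqrt3,\,108,\,40\sqrt3,\,12)$;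 where $V_\emptyset=1$, $V_{\{1\}}=\sqrt2x$, $V_{\{2\}}=\sqrt2y$, $V_{\{3\}}=\sqrt2z$, $V_{\{1,2\}}=\tfrac{\sqrt3}{2}x^2+2\sqrt3xy+\tfrac{\sqrt3}{2}y^2$, $V_{\{1,3\}}=2xz$, $V_{\{2,3\}}=\tfrac{\sqrt3}{2}y^2+2\sqrt3yz+\tfrac{\sqrt3}{2}z^2$, $V_{\{1,2,3\}}=\tfrac13x^3+2x^2y+4xy^2+\tfrac43y^3+3x^2z+12xyz+4y^2z+3xz^2+2yz^2+\tfrac13z^3$.
   Context: Type $A_3$ setting: $E=\{x\in\mathbb{R}^4:\sum x_i=0\}$ with standard inner product, $\Phi=\{\varepsilon_i-\varepsilon_j:i\ne j\}$, simple roots $\alpha_i=\varepsilon_i-\varepsilon_{i+1}$ ($i=1,2,3$), $\Phi^+=\{\varepsilon_i-\varepsilon_j:i<j\}$, highest root $\tilde\alpha=\varepsilon_1-\varepsilon_4$, fundamental weights $\varpi_i$ ($\langle\varpi_i,\alpha_j\rangle=\delta_{ij}$). $W_{\mathrm{aff}}$ is generated by the reflections in the hyperplanes $\{\langle x,\alpha\rangle=k\}$ ($\alpha\in\Phi,k\in\mathbb{Z}$), with Coxeter generators $s_i=$ reflection in $\{\langle x,\alpha_i\rangle=0\}$ ($i=1,2,3$) and $s_0=$ reflection in $\{\langle x,\tilde\alpha\rangle=-1\}$; $\le$ is the Bruhat order. $W_{\mathrm f}=\langle s_1,s_2,s_3\rangle$ with longest element $w_0$. $\mathcal{A}_{\mathrm{id}}=\{x:-1<\langle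 x,\alpha\rangle<0\ \forall\alpha\in\Phi^+\}$, $\mathcal{A}_w=w(\mathcal{A}_{\mathrm{id}})$. $\Pi^+=\{x:0\le\langle x,\alpha_i\rangle\le1\}$, $\Pi^-=w_0(\Pi^+)$, $\mathcal{F}=\{a:\mathcal{A}_a\subset\Pi^-\}$. For $\lambda$ a dominant weight and $a\in\mathcal{F}$, $\theta_a(\lambda)$ is the unique element with $\mathcal{A}_{\theta_a(\lambda)}=\mathcal{A}_{w_0a}+\lambda$ and $\mathcal{I}_a(\lambda)=\{w\in W_{\mathrm{aff}}:w\le\theta_a(\lambda)\}$. For $J\subseteq\{1,2,3\}$, $V_J(\lambda)$ is the Euclidean volume (in its affine span) of the face $\mathrm{Conv}(W_J\cdot\lambda)$ of the permutohedron $\mathrm{Conv}(W_{\mathrm f}\cdot\lambda)$, where $W_J=\langle s_j:j\in J\rangle$; the displayed polynomials give $V_J(x\varpi_1+y\varpi_2+z\varpi_3)$. -}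

module Defs where

open import Level using (0ℓ)
open import Data.Nat as ℕ using (ℕ; zero; suc)
open import Data.Integer as ℤ using (ℤ; +_; -[1+_])
open import Data.Rational.Base as ℚ using (ℚ; 0ℚ; 1ℚ)
open import Data.Fin as Fin using (Fin; zero; suc; #_)
open import Data.Vec as Vec using (Vec; []; _∷_; lookup; tabulate; allFin)
open import Data.List as List using (List; []; _∷_; _++_; reverse; length)
open import Data.List.Membership.Propositional using (_∈_)
open import Data.List.Relation.Unary.Unique.Propositional using (Unique)
import Data.Sum
open import Data.Bool using (Bool; true; false)
open import Data.Fin.Subset using (Subset)
open import Data.Product using (Σ; ∃; ∃-syntax; _×_; _,_)
open import Relation.Binary.PropositionalEquality using (_≡_)
open import Relation.Binary.Construct.Closure.ReflexiveTransitive using (Star)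
open import Relation.Nullary using (¬_)
open import Algebra.Bundles using (CommutativeRing)

_⟺_ : Set → Set → Set
A ⟺ B = (A → B) × (B → A)

-- Points of R^4 (we use rational points)

Pt : Set
Pt = Vec ℚ 4

_-ᵥ_ : Pt → Pt → Pt
x -ᵥ y = Vec.zipWith ℚ._-_ x y

pair : Pt → Fin 4 → Fin 4 → ℚ
pair x i j = lookup x i ℚ.- lookup x j

InE : Pt → Set
InE x = (lookup x (# 0) ℚ.+ lookup x (# 1) ℚ.+ lookup x (# 2) ℚ.+ lookup x (# 3)) ≡ 0ℚ

-- Affine maps of R^4 of the form  x ↦ (x_{perm i} + shift i)_i
-- (coordinate permutation followed by an integral translation).
-- W_aff is realised as the group of such maps generated by s_0,...,s_3.

record Aff : Set where
  constructor aff
  field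
    perm  : Vec (Fin 4) 4
    shift : Vec ℤ 4
open Aff public

apply : Aff → Pt → Pt
apply f x = tabulate λ i →
  lookup x (lookup (perm f) i) ℚ.+ (lookup (shift f) i ℚ./ 1)

_∘A_ : Aff → Aff → Aff
f ∘A g = aff (tabulate λ i → lookup (perm g) (lookup (perm f) i))
             (tabulate λ i → lookup (shift g) (lookup (perm f) i) ℤ.+ lookup (shift f) i)

idA : Aff
idA = aff (allFin 4) (Vec.replicate 4 (+ 0))

-- Coxeter generators.  Coordinates are indexed 0..3 (= ε_1..ε_4).
-- s_i (i = 1,2,3): reflection in <x, ε_i - ε_{i+1}> = 0, i.e. swap coordinates.
-- s_0: reflection in <x, ε_1 - ε_4> = -1:  x ↦ x - (<x,α̃> + 1) α̃,
--      i.e. swap coordinates 1 and 4 and add (-1, 0, 0, 1).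
gen : Fin 4 → Aff
gen zero                   = aff (# 3 ∷ # 1 ∷ # 2 ∷ # 0 ∷ []) (-[1+ 0 ] ∷ + 0 ∷ + 0 ∷ + 1 ∷ [])
gen (suc zero)             = aff (# 1 ∷ # 0 ∷ # 2 ∷ # 3 ∷ []) (Vec.replicate 4 (+ 0))
gen (suc (suc zero))       = aff (# 0 ∷ # 2 ∷ # 1 ∷ # 3 ∷ []) (Vec.replicate 4 (+ 0))
gen (suc (suc (suc zero))) = aff (# 0 ∷ # 1 ∷ # 3 ∷ # 2 ∷ []) (Vec.replicate 4 (+ 0))

Word : Set
Word = List (Fin 4)

eval : Word → Aff
eval []      = idA
eval (i ∷ w) = gen i ∘A eval w

InW : Aff → Set
InW f = ∃[ w ] eval w ≡ f

Len : Aff → ℕ → Set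
Len f n = (∃[ w ] (eval w ≡ f × length w ≡ n))
        × (∀ w → eval w ≡ f → n ℕ.≤ length w)

-- reflections of W_aff: conjugates v s_i v⁻¹ of the Coxeter generators
IsReflection : Aff → Set
IsReflection t = ∃[ v ] ∃[ i ] eval (v ++ (i ∷ reverse v)) ≡ t

BruhatStep : Aff → Aff → Set
BruhatStep u w = ∃[ t ] (IsReflection t × (u ∘A t) ≡ w
               × ∃[ m ] ∃[ n ] (Len u m × Len w n × m ℕ.< n))

_≤B_ : Aff → Aff → Set
u ≤B w = Star BruhatStep u w

InAid : Pt → Set
InAid x = InE x × (∀ (i j : Fin 4) → i Fin.< j →
            (ℚ.- 1ℚ ℚ.< pair x i j) × (pair x i j ℚ.< 0ℚ))

InAlc : Aff → Pt → Set
InAlc w x = ∃[ p ] (InAid p × apply w p ≡ x)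

InPiPlus : Pt → Set
InPiPlus x = InE x × (∀ (i : Fin 3) →
  (0ℚ ℚ.≤ pair x (Fin.inject₁ i) (suc i)) × (pair x (Fin.inject₁ i) (suc i) ℚ.≤ 1ℚ))

-- longest element of W_f = ⟨s₁,s₂,s₃⟩:  s₁ s₂ s₁ s₃ s₂ s₁
w₀ : Aff
w₀ = eval (# 1 ∷ # 2 ∷ # 1 ∷ # 3 ∷ # 2 ∷ # 1 ∷ [])

InPiMinus : Pt → Set
InPiMinus x = ∃[ y ] (InPiPlus y × apply w₀ y ≡ x)

InF : Aff → Set
InF a = InW a × (∀ x → InAlc a x → InPiMinus x)

aWord : Fin 6 → Word
aWord zero                               = []
aWord (suc zero)                         = # 0 ∷ []
aWord (suc (suc zero))                   = # 0 ∷ # 1 ∷ []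
aWord (suc (suc (suc zero)))             = # 0 ∷ # 3 ∷ []
aWord (suc (suc (suc (suc zero))))       = # 0 ∷ # 1 ∷ # 3 ∷ []
aWord (suc (suc (suc (suc (suc zero))))) = # 0 ∷ # 1 ∷ # 3 ∷ # 2 ∷ []

aElt : Fin 6 → Aff
aElt i = eval (aWord i)

aList : List Aff
aList = List.map aElt (List.allFin 6)

-- λ = x ϖ₁ + y ϖ₂ + z ϖ₃ with
-- ϖ₁ = (3,-1,-1,-1)/4, ϖ₂ = (1,1,-1,-1)/2, ϖ₃ = (1,1,1,-3)/4
weight : ℕ → ℕ → ℕ → Pt
weight x y z = tabulate λ i →
  (c₁ i ℚ.* (+ x ℚ./ 1)) ℚ.+ (c₂ i ℚ.* (+ y ℚ./ 1)) ℚ.+ (c₃ i ℚ.* (+ z ℚ./ 1))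
  where
  c₁ c₂ c₃ : Fin 4 → ℚ
  c₁ zero = + 3 ℚ./ 4
  c₁ _    = -[1+ 0 ] ℚ./ 4
  c₂ zero = + 1 ℚ./ 2
  c₂ (suc zero) = + 1 ℚ./ 2
  c₂ _    = -[1+ 0 ] ℚ./ 2
  c₃ (suc (suc (suc zero))) = -[1+ 2 ] ℚ./ 4
  c₃ _    = + 1 ℚ./ 4

IsTheta : Aff → Pt → Aff → Set
IsTheta a λ' θ = InW θ × (∀ x → InAlc θ x ⟺ InAlc (w₀ ∘A a) (x -ᵥ λ'))

Enumerates : List Aff → Aff → Set
Enumerates L θ = Unique L × (∀ w → (w ∈ L) ⟺ (InW w × w ≤B θ))

IsI : Aff → ℕ → ℕ → ℕ → List Aff → Set
IsI a x y z L = ∃[ θ ] (IsTheta a (weight x y z) θ × Enumerates L θ)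

-- Stand-in for ℝ: any commutative ring that is an integral domain of
-- characteristic zero, containing √2, √3, 1/2, 1/3 (ℝ is an instance).

litR : (R : CommutativeRing 0ℓ 0ℓ) → ℕ → CommutativeRing.Carrier R
litR R zero    = CommutativeRing.0# R
litR R (suc n) = CommutativeRing._+_ R (CommutativeRing.1# R) (litR R n)

record RealsLike : Set₁ where
  field
    R : CommutativeRing 0ℓ 0ℓ
  open CommutativeRing R public hiding (ring)
  field
    noZeroDivisors : ∀ a b → (a * b) ≈ 0# → (a ≈ 0#) Data.Sum.⊎ (b ≈ 0#)
    charZero : ∀ n → ¬ (litR R (suc n) ≈ 0#)
    √2 √3 half third : Carrier
    √2² : (√2 * √2) ≈ litR R 2
    √3² : (√3 * √3) ≈ litR R 3
    half-inv : (litR R 2 * half) ≈ 1#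
    third-inv : (litR R 3 * third) ≈ 1#

-- Subsets J ⊆ {1,2,3} as Subset 3 (position k ↔ index k+1),
-- the volume polynomials V_J, and the coefficient table μ_{J,a}.

allJ : List (Subset 3)
allJ = (false ∷ false ∷ false ∷ []) ∷ (true ∷ false ∷ false ∷ []) ∷
       (false ∷ true ∷ false ∷ []) ∷ (false ∷ false ∷ true ∷ []) ∷
       (true ∷ true ∷ false ∷ []) ∷ (true ∷ false ∷ true ∷ []) ∷
       (false ∷ true ∷ true ∷ []) ∷ (true ∷ true ∷ true ∷ []) ∷ []

module _ (F : RealsLike) where
  open RealsLike F

  private
    n̂ : ℕ → Carrier
    n̂ = litR R

  V : Subset 3 → ℕ → ℕ → ℕ → Carrier
  V (false ∷ false ∷ false ∷ []) x y z = 1#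
  V (true ∷ false ∷ false ∷ [])  x y z = √2 * n̂ x
  V (false ∷ true ∷ false ∷ [])  x y z = √2 * n̂ y
  V (false ∷ false ∷ true ∷ [])  x y z = √2 * n̂ z
  V (true ∷ true ∷ false ∷ [])   x y z =
    (√3 * half * n̂ x * n̂ x) + (n̂ 2 * √3 * n̂ x * n̂ y) + (√3 * half * n̂ y * n̂ y)
  V (true ∷ false ∷ true ∷ [])   x y z = n̂ 2 * n̂ x * n̂ z
  V (false ∷ true ∷ true ∷ [])   x y z =
    (√3 * half * n̂ y * n̂ y) + (n̂ 2 * √3 * n̂ y * n̂ z) + (√3 * half * n̂ z * n̂ z)
  V (true ∷ true ∷ true ∷ [])    x y z =
    (third * n̂ x * n̂ x * n̂ x) + (n̂ 2 * n̂ x * n̂ x * n̂ y) + (n̂ 4 * n̂ x * n̂ y * n̂ y)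
    + (n̂ 4 * third * n̂ y * n̂ y * n̂ y) + (n̂ 3 * n̂ x * n̂ x * n̂ z)
    + (n̂ 12 * n̂ x * n̂ y * n̂ z) + (n̂ 4 * n̂ y * n̂ y * n̂ z) + (n̂ 3 * n̂ x * n̂ z * n̂ z)
    + (n̂ 2 * n̂ y * n̂ z * n̂ z) + (third * n̂ z * n̂ z * n̂ z)

  ΣμV : (Subset 3 → Carrier) → ℕ → ℕ → ℕ → Carrier
  ΣμV μ x y z = List.foldr (λ J acc → (μ J * V J x y z) + acc) 0# allJ

  table : ℕ → ℕ → ℕ → ℕ → ℕ → ℕ → ℕ → ℕ → Subset 3 → Carrier
  table c₀ c₁ c₂ c₃ c₄ c₅ c₆ c₇ (false ∷ false ∷ false ∷ []) = n̂ c₀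
  table c₀ c₁ c₂ c₃ c₄ c₅ c₆ c₇ (true ∷ false ∷ false ∷ [])  = n̂ c₁ * √2
  table c₀ c₁ c₂ c₃ c₄ c₅ c₆ c₇ (false ∷ true ∷ false ∷ [])  = n̂ c₂ * √2
  table c₀ c₁ c₂ c₃ c₄ c₅ c₆ c₇ (false ∷ false ∷ true ∷ [])  = n̂ c₃ * √2
  table c₀ c₁ c₂ c₃ c₄ c₅ c₆ c₇ (true ∷ true ∷ false ∷ [])   = n̂ c₄ * √3
  table c₀ c₁ c₂ c₃ c₄ c₅ c₆ c₇ (true ∷ false ∷ true ∷ [])   = n̂ c₅
  table c₀ c₁ c₂ c₃ c₄ c₅ c₆ c₇ (false ∷ true ∷ true ∷ [])   = n̂ c₆ * √3
  table c₀ c₁ c₂ c₃ c₄ c₅ c₆ c₇ (true ∷ true ∷ true ∷ [])    = n̂ c₇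

  μ : Fin 6 → Subset 3 → Carrier
  μ zero                               = table 24  22  28  22 16  36 16 12
  μ (suc zero)                         = table 48  40  52  40 24  60 24 12
  μ (suc (suc zero))                   = table 72  52  70  58 24  72 32 12
  μ (suc (suc (suc zero)))             = table 72  58  70  52 32  72 24 12
  μ (suc (suc (suc (suc zero))))       = table 120 82 100  82 32  96 32 12
  μ (suc (suc (suc (suc (suc zero))))) = table 192 112 148 112 40 108 40 12

  CountFormula : Aff → (Subset 3 → Carrier) → Set
  CountFormula a ν = ∀ x y z (L : List Aff) → IsI a x y z L →
                     n̂ (length L) ≈ ΣμV ν x y z

{-# OPTIONS --safe #-}
module Submission where

-- A map f is recorded by the integers b f i = perm f i + 4 (shift f i), the
-- rescaled centre of its alcove.  A gallery from the fundamental alcove to the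
-- far side of a hyperplane crosses it, which gives the exchange property, hence
-- the lifting property, hence  I(θ s) = I(θ) ∪ I(θ) s  whenever θ s > θ.
--
-- The elements θ_a(λ) are maximal in their left cosets of W_f, so I(θ_a(λ)) is a
-- union of such cosets.  In suitable coordinates these are the points p ∈ ℤ⁴ of
-- a fixed coordinate sum, and right multiplication by s acts by a reflection.
-- The dominant alcoves are reached from the lowest one through walls, always by
-- an ascent θ ↦ θ s; along such a path I(θ) stays the set of integer points
-- p(S) ≤ f(S) of a base polytope, namely Conv(W_f λ) plus a fixed small polytope
-- depending on a.  That X ∪ s X is again of this form is an uncrossing argument:
-- if p violates the bound of X at S then p(S) + p(T) = p(S ∪ T) + p(S ∩ T) gives
-- the bounds of s X at every T.
--
-- Every coset has 24 elements.  The slices p₃ = c of the polytope are triangles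
-- with cut corners whose sizes are affine in c on three ranges of c, so summing
-- over c yields the cubic polynomial; its coefficients determine the μ_{J,a}
-- because 2 and 3, and therefore √2 and √3, are invertible.

-- Two obstacles shape the development. First, everything must hold for all x, y, z at once.
-- Inequalities between support functions are therefore inequalities between affine forms in x, y,
-- z, and they are tested coefficientwise; as x, y, z are natural numbers this is sound, and each
-- step of the path becomes one finite decision valid for every λ. Second, λ need not lie in the
-- root lattice, so translation by λ need not belong to W_aff. The coordinates of a coset therefore
-- carry an offset κ = -(x + 2y + 3z), and lowering κ by one rotates the four labels cyclically. The
-- path enters the box of λ + ϖ_k when the small polytope has become a translate of Conv(W_f ϖ_k):
-- its Minkowski sum with Conv(W_f λ) is then a translate of Conv(W_f (λ + ϖ_k)), and k rotations
-- absorb the translation.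

open import Defs
open import Data.Nat as ℕ using (ℕ; zero; suc)
import Data.Nat.Properties as ℕ
open import Data.Integer using (ℤ; +_; -[1+_]; _+_; _*_; _-_; -_; _≤_; _<_; +≤+; +<+; 0ℤ; 1ℤ; -1ℤ; _⊔_; ∣_∣)
open import Algebra.Bundles using (AbelianGroup)
import Algebra.Properties.Group as GroupProperties
import Data.Integer.Properties as ℤ
open import Data.Integer.Tactic.RingSolver using (solve-∀)
open import Data.Integer.Solver using (module +-*-Solver)
open +-*-Solver using (Polynomial; con; var; _:+_; _:*_; _:-_; ⟦_⟧; _≈N_; _≟N_; ⟦_⟧N-cong) renaming (normalise to normalForm; correct to normalForm-correct)
open import Data.Rational.Base as ℚ using (ℚ; 0ℚ; 1ℚ; mkℚ)
import Data.Rational.Properties as ℚ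
import Data.Rational.Solver as ℚ
open ℚ.+-*-Solver using (solve) renaming (con to conℚ; _:+_ to _⟨+⟩_; _:-_ to _⟨-⟩_; _:*_ to _⟨*⟩_; :-_ to ⟨-⟩_; _:=_ to _⟨=⟩_)
import Data.Nat.Coprimality as Coprime
open import Data.Fin as Fin using (Fin; zero; suc; #_; toℕ; inject₁)
import Data.Fin.Properties as Fin
open import Data.Vec as Vec using (Vec; []; _∷_; lookup; tabulate)
import Data.Vec.Properties as Vec
open import Data.Vec.Relation.Binary.Pointwise.Inductive as Pointwise using (Pointwise; []; _∷_)
open import Data.List as List using (List; []; _∷_; _++_; _∷ʳ_; reverse; length)
import Data.List.Properties as List
open import Data.List.Relation.Unary.All as All using (All; []; _∷_)
open import Data.List.Relation.Unary.Any using (here; there)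
open import Data.List.Relation.Unary.Unique.Propositional using (Unique)
import Data.List.Relation.Unary.Unique.Propositional.Properties as Unique
open import Data.List.Relation.Unary.Unique.DecPropositional.Properties using (deduplicate-!)
open import Data.List.Relation.Unary.AllPairs using ([]; _∷_)
open import Data.List.Membership.Propositional using (_∈_)
import Data.List.Membership.Propositional.Properties as ∈
import Data.List.Membership.DecPropositional as DecMembership
open import Data.List.Reverse using (Reverse; []; _∶_∶ʳ_; reverseView)
import Data.Bool.Properties as Bool
open import Data.Bool using (Bool; true; false; _∨_; _∧_)
open import Data.Fin.Subset using (Subset; ⊤; _∪_; _∩_) renaming (∣_∣ to card)
import Data.Fin.Subset.Properties as Subset
open import Data.Nat.DivMod using (_mod_; _/_)
import Data.Integer.DivMod as ℤ
open import Data.Maybe using (from-just)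
open import Data.Product using (∃-syntax; _×_; _,_; proj₁; proj₂)
open import Data.Sum using (_⊎_; inj₁; inj₂)
open import Data.Empty using (⊥; ⊥-elim)
open import Function using (_∘_)
open import Relation.Nullary using (¬_; Dec; yes; no; contradiction)
open import Relation.Nullary.Decidable using (map′; ¬?; _×-dec_; _⊎-dec_; _→-dec_; from-yes)
open import Relation.Binary using (tri<; tri≈; tri>)
open import Relation.Binary.PropositionalEquality using (_≡_; _≢_; refl; sym; trans; cong; cong₂; subst; subst₂; module ≡-Reasoning)
open import Relation.Binary.Construct.Closure.ReflexiveTransitive using (ε; _◅_; _◅◅_)

-- Linear arithmetic over ℤ: an inequality is certified by writing the
-- difference of its sides as a sum of differences known to be nonnegative.

total : List ℤ → ℤ
total []       = 0ℤ
total (u ∷ us) = u + total us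

total-nonneg : ∀ {us} → All (0ℤ ≤_) us → 0ℤ ≤ total us
total-nonneg []       = ℤ.≤-refl
total-nonneg (p ∷ ps) = ℤ.+-mono-≤ p (total-nonneg ps)

≤⇒0≤ : ∀ {a b} → a ≤ b → 0ℤ ≤ b - a
≤⇒0≤ = ℤ.i≤j⇒0≤j-i

<⇒0≤ : ∀ {a b} → a < b → 0ℤ ≤ b - (1ℤ + a)
<⇒0≤ a<b = ≤⇒0≤ (ℤ.i<j⇒suc[i]≤j a<b)

≡⇒0≤ : ∀ {a b} → a ≡ b → 0ℤ ≤ b - a
≡⇒0≤ a≡b = ≤⇒0≤ (ℤ.≤-reflexive a≡b)

≤-by : ∀ {us a b} → All (0ℤ ≤_) us → total us ≡ b - a → a ≤ b
≤-by ps e = ℤ.0≤i-j⇒j≤i (subst (0ℤ ≤_) e (total-nonneg ps))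

<-by : ∀ {us a b} → All (0ℤ ≤_) us → total us ≡ b - (1ℤ + a) → a < b
<-by ps e = ℤ.suc[i]≤j⇒i<j (≤-by ps e)

⊥-by : ∀ {us} → All (0ℤ ≤_) us → total us ≡ -1ℤ → ⊥
⊥-by {us} ps e with total us | total-nonneg ps
⊥-by ps refl | _ | ()

-- An affine map is encoded by four integers, the centre of its alcove up to
-- rescaling: positions are permuted from the left, values from the right.

b : Aff → Fin 4 → ℤ
b f i = + toℕ (lookup (perm f) i) + + 4 * lookup (shift f) i

euclid-< : ∀ (r r′ : Fin 4) {s s′} → s < s′ → + toℕ r + + 4 * s < + toℕ r′ + + 4 * s′
euclid-< r r′ {s} {s′} s<s′ =
  -- The four copies of `d` give 4 (s′ - s - 1); with 3 - r and r′ they make up the required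
  -- difference.
  <-by (d ∷ d ∷ d ∷ d ∷ ≤⇒0≤ (+≤+ (Fin.toℕ≤pred[n] r)) ∷ +≤+ (ℕ.z≤n {toℕ r′}) ∷ [])
       (identity (+ toℕ r) (+ toℕ r′) s s′)
  where
  d = <⇒0≤ s<s′
  identity : ∀ r r′ s s′ → (s′ - (1ℤ + s)) + ((s′ - (1ℤ + s)) + ((s′ - (1ℤ + s)) + ((s′ - (1ℤ + s)) + ((+ 3 - r) + (r′ + 0ℤ))))) ≡ (r′ + + 4 * s′) - (1ℤ + (r + + 4 * s))
  identity = solve-∀

euclid-unique : ∀ (r r′ : Fin 4) s s′ → + toℕ r + + 4 * s ≡ + toℕ r′ + + 4 * s′ → r ≡ r′ × s ≡ s′
euclid-unique r r′ s s′ e with ℤ.<-cmp s s′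
... | tri< s<s′ _ _ = ⊥-elim (ℤ.<-irrefl e (euclid-< r r′ s<s′))
... | tri> _ _ s′<s = ⊥-elim (ℤ.<-irrefl (sym e) (euclid-< r′ r s′<s))
... | tri≈ _ refl _ = Fin.toℕ-injective (ℤ.+-injective (GroupProperties.∙-cancelʳ (AbelianGroup.group ℤ.+-0-abelianGroup) (+ 4 * s) _ _ e)) , refl

lookup-injective : ∀ {A : Set} {n} {u v : Vec A n} → (∀ i → lookup u i ≡ lookup v i) → u ≡ v
lookup-injective {u = u} {v} e = trans (sym (Vec.tabulate∘lookup u)) (trans (Vec.tabulate-cong e) (Vec.tabulate∘lookup v))

b-injective : ∀ {f g} → (∀ i → b f i ≡ b g i) → f ≡ g
b-injective {f} {g} e = cong₂ aff (lookup-injective (λ i → proj₁ (eq i))) (lookup-injective (λ i → proj₂ (eq i)))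
  where
  eq : ∀ i → lookup (perm f) i ≡ lookup (perm g) i × lookup (shift f) i ≡ lookup (shift g) i
  eq i = euclid-unique _ _ (lookup (shift f) i) (lookup (shift g) i) (e i)

perm-∘ : ∀ f g i → lookup (perm (f ∘A g)) i ≡ lookup (perm g) (lookup (perm f) i)
perm-∘ f g i = Vec.lookup∘tabulate (λ i → lookup (perm g) (lookup (perm f) i)) i

shift-∘ : ∀ f g i → lookup (shift (f ∘A g)) i ≡ lookup (shift g) (lookup (perm f) i) + lookup (shift f) i
shift-∘ f g i = Vec.lookup∘tabulate (λ i → lookup (shift g) (lookup (perm f) i) + lookup (shift f) i) i

b-∘ : ∀ f g i → b (f ∘A g) i ≡ b g (lookup (perm f) i) + + 4 * lookup (shift f) i
b-∘ f g i = trans (cong₂ (λ r s → + toℕ r + + 4 * s) (perm-∘ f g i) (shift-∘ f g i))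
                  (identity (+ toℕ (lookup (perm g) (lookup (perm f) i))) (lookup (shift g) (lookup (perm f) i)) (lookup (shift f) i))
  where
  identity : ∀ r s t → r + + 4 * (s + t) ≡ (r + + 4 * s) + + 4 * t
  identity = solve-∀

∘A-assoc : ∀ f g h → (f ∘A g) ∘A h ≡ f ∘A (g ∘A h)
∘A-assoc f g h = b-injective λ i → let open ≡-Reasoning in begin
  b ((f ∘A g) ∘A h) i
    ≡⟨ b-∘ (f ∘A g) h i ⟩
  b h (lookup (perm (f ∘A g)) i) + + 4 * lookup (shift (f ∘A g)) i
    ≡⟨ cong₂ (λ r s → b h r + + 4 * s) (perm-∘ f g i) (shift-∘ f g i) ⟩
  b h (lookup (perm g) (lookup (perm f) i)) + + 4 * (lookup (shift g) (lookup (perm f) i) + lookup (shift f) i)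
    ≡⟨ identity (b h (lookup (perm g) (lookup (perm f) i))) (lookup (shift g) (lookup (perm f) i)) (lookup (shift f) i) ⟩
  (b h (lookup (perm g) (lookup (perm f) i)) + + 4 * lookup (shift g) (lookup (perm f) i)) + + 4 * lookup (shift f) i
    ≡⟨ cong (_+ + 4 * lookup (shift f) i) (b-∘ g h (lookup (perm f) i)) ⟨
  b (g ∘A h) (lookup (perm f) i) + + 4 * lookup (shift f) i
    ≡⟨ b-∘ f (g ∘A h) i ⟨
  b (f ∘A (g ∘A h)) i ∎
  where
  identity : ∀ r s t → r + + 4 * (s + t) ≡ (r + + 4 * s) + + 4 * t
  identity = solve-∀

∘A-identityʳ : ∀ f → f ∘A idA ≡ f
∘A-identityʳ f = b-injective λ i →
  trans (b-∘ f idA i)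
        (cong (_+ + 4 * lookup (shift f) i)
              (trans (cong₂ (λ r s → + toℕ r + + 4 * s) (Vec.lookup-allFin (lookup (perm f) i)) (Vec.lookup-replicate (lookup (perm f) i) 0ℤ))
                     (ℤ.+-identityʳ (+ toℕ (lookup (perm f) i)))))

∘A-identityˡ : ∀ f → idA ∘A f ≡ f
∘A-identityˡ f = b-injective λ i →
  trans (b-∘ idA f i)
        (trans (cong₂ (λ r s → b f r + + 4 * s) (Vec.lookup-allFin i) (Vec.lookup-replicate i 0ℤ)) (ℤ.+-identityʳ (b f i)))

eval-++ : ∀ v w → eval (v ++ w) ≡ eval v ∘A eval w
eval-++ []      w = sym (∘A-identityˡ (eval w))
eval-++ (i ∷ v) w = trans (cong (gen i ∘A_) (eval-++ v w)) (sym (∘A-assoc (gen i) (eval v) (eval w)))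

eval-∷ʳ : ∀ w s → eval (w ∷ʳ s) ≡ eval w ∘A gen s
eval-∷ʳ w s = trans (eval-++ w (s ∷ [])) (cong (eval w ∘A_) (∘A-identityʳ (gen s)))

gen-involutive : ∀ s → gen s ∘A gen s ≡ idA
gen-involutive zero                   = refl
gen-involutive (suc zero)             = refl
gen-involutive (suc (suc zero))       = refl
gen-involutive (suc (suc (suc zero))) = refl

∘gen-involutive : ∀ f s → (f ∘A gen s) ∘A gen s ≡ f
∘gen-involutive f s = trans (∘A-assoc f (gen s) (gen s)) (trans (cong (f ∘A_) (gen-involutive s)) (∘A-identityʳ f))

eval-inverseʳ : ∀ w → eval w ∘A eval (reverse w) ≡ idA
eval-inverseʳ []      = refl
eval-inverseʳ (i ∷ w) = let open ≡-Reasoning in begin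
  (gen i ∘A eval w) ∘A eval (reverse (i ∷ w))
    ≡⟨ cong (λ v → (gen i ∘A eval w) ∘A eval v) (List.unfold-reverse i w) ⟩
  (gen i ∘A eval w) ∘A eval (reverse w ∷ʳ i)
    ≡⟨ cong ((gen i ∘A eval w) ∘A_) (eval-∷ʳ (reverse w) i) ⟩
  (gen i ∘A eval w) ∘A (eval (reverse w) ∘A gen i)
    ≡⟨ ∘A-assoc (gen i ∘A eval w) (eval (reverse w)) (gen i) ⟨
  ((gen i ∘A eval w) ∘A eval (reverse w)) ∘A gen i
    ≡⟨ cong (_∘A gen i) (∘A-assoc (gen i) (eval w) (eval (reverse w))) ⟩
  (gen i ∘A (eval w ∘A eval (reverse w))) ∘A gen i
    ≡⟨ cong (λ f → (gen i ∘A f) ∘A gen i) (eval-inverseʳ w) ⟩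
  (gen i ∘A idA) ∘A gen i
    ≡⟨ cong (_∘A gen i) (∘A-identityʳ (gen i)) ⟩
  gen i ∘A gen i
    ≡⟨ gen-involutive i ⟩
  idA ∎

eval-inverseˡ : ∀ w → eval (reverse w) ∘A eval w ≡ idA
eval-inverseˡ w = subst (λ v → eval (reverse w) ∘A eval v ≡ idA) (List.reverse-involutive w) (eval-inverseʳ (reverse w))

InW-∘gen : ∀ {f} s → InW f → InW (f ∘A gen s)
InW-∘gen s (w , refl) = w ∷ʳ s , eval-∷ʳ w s

-- Elements of W_aff as permutations with shifts of total zero

sumF : (Fin 4 → ℤ) → ℤ
sumF p = p (# 0) + p (# 1) + p (# 2) + p (# 3)

-- Invariants preserved by every generator; they replace a word for f in the arguments about
-- hyperplanes. `position` is the inverse permutation: it finds the place of a residue.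
record Good (f : Aff) : Set where
  field
    position       : Fin 4 → Fin 4
    perm-position  : ∀ r → lookup (perm f) (position r) ≡ r
    perm-injective : ∀ {i j} → lookup (perm f) i ≡ lookup (perm f) j → i ≡ j
    shift-sum      : sumF (lookup (shift f)) ≡ 0ℤ

open Good public

idA-good : Good idA
idA-good = record
  { position       = λ r → r
  ; perm-position  = Vec.lookup-allFin
  ; perm-injective = λ {i} {j} e → trans (sym (Vec.lookup-allFin i)) (trans e (Vec.lookup-allFin j))
  ; shift-sum      = refl
  }

gen-perm-involutive : ∀ s i → lookup (perm (gen s)) (lookup (perm (gen s)) i) ≡ i
gen-perm-involutive s i = trans (sym (perm-∘ (gen s) (gen s) i))
  (trans (cong (λ f → lookup (perm f) i) (gen-involutive s)) (Vec.lookup-allFin i))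

gen∘-shift-sum : ∀ s f → sumF (lookup (shift (gen s ∘A f))) ≡ sumF (lookup (shift f))
gen∘-shift-sum s (aff _ (t₀ ∷ t₁ ∷ t₂ ∷ t₃ ∷ [])) with s
... | zero                   = swap₀₃ t₀ t₁ t₂ t₃
  where
  swap₀₃ : ∀ a b c d → (d + -1ℤ) + (b + 0ℤ) + (c + 0ℤ) + (a + 1ℤ) ≡ a + b + c + d
  swap₀₃ = solve-∀
... | suc zero               = swap₀₁ t₀ t₁ t₂ t₃
  where
  swap₀₁ : ∀ a b c d → (b + 0ℤ) + (a + 0ℤ) + (c + 0ℤ) + (d + 0ℤ) ≡ a + b + c + d
  swap₀₁ = solve-∀
... | suc (suc zero)         = swap₁₂ t₀ t₁ t₂ t₃
  where
  swap₁₂ : ∀ a b c d → (a + 0ℤ) + (c + 0ℤ) + (b + 0ℤ) + (d + 0ℤ) ≡ a + b + c + d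
  swap₁₂ = solve-∀
... | suc (suc (suc zero))   = swap₂₃ t₀ t₁ t₂ t₃
  where
  swap₂₃ : ∀ a b c d → (a + 0ℤ) + (b + 0ℤ) + (d + 0ℤ) + (c + 0ℤ) ≡ a + b + c + d
  swap₂₃ = solve-∀

gen∘-good : ∀ s {f} → Good f → Good (gen s ∘A f)
gen∘-good s {f} G = record
  { position       = λ r → π (position G r)
  ; perm-position  = λ r → trans (perm-∘ (gen s) f _) (trans (cong (lookup (perm f)) (gen-perm-involutive s _)) (perm-position G r))
  ; perm-injective = λ {i} {j} e →
      trans (sym (gen-perm-involutive s i))
            (trans (cong π (perm-injective G (trans (sym (perm-∘ (gen s) f i)) (trans e (perm-∘ (gen s) f j)))))
                   (gen-perm-involutive s j))
  ; shift-sum      = trans (gen∘-shift-sum s f) (shift-sum G)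
  }
  where π = lookup (perm (gen s))

eval-good : ∀ w → Good (eval w)
eval-good []      = idA-good
eval-good (s ∷ w) = gen∘-good s (eval-good w)

InW⇒Good : ∀ {f} → InW f → Good f
InW⇒Good (w , refl) = eval-good w

-- Reflections and the Bruhat order

prev : Fin 4 → Fin 4
prev zero    = # 3
prev (suc i) = inject₁ i

-- Right multiplication by s moves a value by an amount that depends only on its residue r: up by
-- one if r is the cyclic predecessor of s, down by one if r is s, and not at all otherwise.
Δ : Fin 4 → Fin 4 → ℤ
Δ s r = b (gen s) r - + toℕ r

b-∘gen : ∀ f s i → b (f ∘A gen s) i ≡ b f i + Δ s (lookup (perm f) i)
b-∘gen f s i = trans (b-∘ f (gen s) i)
  (identity (b (gen s) (lookup (perm f) i)) (+ toℕ (lookup (perm f) i)) (lookup (shift f) i))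
  where
  identity : ∀ c r t → c + + 4 * t ≡ (r + + 4 * t) + (c - r)
  identity = solve-∀

data WallCrossing (s r : Fin 4) : Set where
  up   : r ≡ prev s → Δ s r ≡ 1ℤ → WallCrossing s r
  down : r ≡ s → Δ s r ≡ -1ℤ → WallCrossing s r
  stay : r ≢ prev s → r ≢ s → Δ s r ≡ 0ℤ → WallCrossing s r

Δ-prev : ∀ s → Δ s (prev s) ≡ 1ℤ
Δ-prev = from-yes (Fin.all? λ s → Δ s (prev s) ℤ.≟ 1ℤ)

Δ-self : ∀ s → Δ s s ≡ -1ℤ
Δ-self = from-yes (Fin.all? λ s → Δ s s ℤ.≟ -1ℤ)

Δ-other : ∀ s r → r ≢ prev s → r ≢ s → Δ s r ≡ 0ℤ
Δ-other = from-yes (Fin.all? λ s → Fin.all? λ r → ¬? (r Fin.≟ prev s) →-dec (¬? (r Fin.≟ s) →-dec (Δ s r ℤ.≟ 0ℤ)))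

wallCrossing : ∀ s r → WallCrossing s r
wallCrossing s r with r Fin.≟ prev s | r Fin.≟ s
... | yes refl | _        = up refl (Δ-prev s)
... | no _     | yes refl = down refl (Δ-self s)
... | no r≢prev | no r≢s  = stay r≢prev r≢s (Δ-other s r r≢prev r≢s)

prev-≢ : ∀ s → prev s ≢ s
prev-≢ (suc i) e = ℕ.1+n≢n (trans (sym (cong toℕ e)) (Fin.toℕ-inject₁ i))

prev-carry : ∀ s → ∃[ c ] + toℕ (prev s) ≡ + toℕ s - 1ℤ + + 4 * c
prev-carry zero                   = 1ℤ , refl
prev-carry (suc zero)             = 0ℤ , refl
prev-carry (suc (suc zero))       = 0ℤ , refl
prev-carry (suc (suc (suc zero))) = 0ℤ , refl

-- Stands for the hyperplane ⟨x , ε_i - ε_j⟩ = k with i = `ri`, j = `rj`, k = `rk`.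
record Root : Set where
  constructor root
  field
    ri rj : Fin 4
    rk    : ℤ
    ri≢rj : ri ≢ rj

open Root public

swapFin : Fin 4 → Fin 4 → Fin 4 → Fin 4
swapFin i j m with m Fin.≟ i | m Fin.≟ j
... | yes _ | _     = j
... | no  _ | yes _ = i
... | no  _ | no  _ = m

swapShift : Fin 4 → Fin 4 → ℤ → Fin 4 → ℤ
swapShift i j k m with m Fin.≟ i | m Fin.≟ j
... | yes _ | _     = k
... | no  _ | yes _ = - k
... | no  _ | no  _ = 0ℤ

refl[_] : Root → Aff
refl[ root i j k _ ] = aff (tabulate (swapFin i j)) (tabulate (swapShift i j k))

b-refl : ∀ ρ f m → b (refl[ ρ ] ∘A f) m ≡ b f (swapFin (ri ρ) (rj ρ) m) + + 4 * swapShift (ri ρ) (rj ρ) (rk ρ) m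
b-refl ρ f m = trans (b-∘ refl[ ρ ] f m)
  (cong₂ (λ r t → b f r + + 4 * t) (Vec.lookup∘tabulate (swapFin (ri ρ) (rj ρ)) m)
                                    (Vec.lookup∘tabulate (swapShift (ri ρ) (rj ρ) (rk ρ)) m))

b-refl-i : ∀ ρ f → b (refl[ ρ ] ∘A f) (ri ρ) ≡ b f (rj ρ) + + 4 * rk ρ
b-refl-i ρ@(root i j k _) f = trans (b-refl ρ f i) eq
  where
  eq : b f (swapFin i j i) + + 4 * swapShift i j k i ≡ b f j + + 4 * k
  eq with i Fin.≟ i | i Fin.≟ j
  ... | yes _ | _ = refl
  ... | no n  | _ = contradiction refl n

b-refl-j : ∀ ρ f → b (refl[ ρ ] ∘A f) (rj ρ) ≡ b f (ri ρ) - + 4 * rk ρ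
b-refl-j ρ@(root i j k i≢j) f = trans (b-refl ρ f j) eq
  where
  eq : b f (swapFin i j j) + + 4 * swapShift i j k j ≡ b f i - + 4 * k
  eq with j Fin.≟ i | j Fin.≟ j
  ... | yes e | _     = contradiction (sym e) i≢j
  ... | no _  | yes _ = cong (λ c → b f i + c) (sym (ℤ.neg-distribʳ-* (+ 4) k))
  ... | no _  | no n  = contradiction refl n

b-refl-other : ∀ ρ f {m} → m ≢ ri ρ → m ≢ rj ρ → b (refl[ ρ ] ∘A f) m ≡ b f m
b-refl-other ρ@(root i j k _) f {m} m≢i m≢j = trans (b-refl ρ f m) eq
  where
  eq : b f (swapFin i j m) + + 4 * swapShift i j k m ≡ b f m
  eq with m Fin.≟ i | m Fin.≟ j
  ... | yes e | _     = contradiction e m≢i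
  ... | no _  | yes e = contradiction e m≢j
  ... | no _  | no _  = ℤ.+-identityʳ (b f m)

≡refl∘ : ∀ ρ f {g} → b g (ri ρ) ≡ b f (rj ρ) + + 4 * rk ρ → b g (rj ρ) ≡ b f (ri ρ) - + 4 * rk ρ →
         (∀ m → m ≢ ri ρ → m ≢ rj ρ → b g m ≡ b f m) → g ≡ refl[ ρ ] ∘A f
≡refl∘ ρ f {g} at-i at-j other = b-injective eq
  where
  eq : ∀ m → b g m ≡ b (refl[ ρ ] ∘A f) m
  eq m with m Fin.≟ ri ρ | m Fin.≟ rj ρ
  ... | yes refl | _        = trans at-i (sym (b-refl-i ρ f))
  ... | no _     | yes refl = trans at-j (sym (b-refl-j ρ f))
  ... | no m≢i   | no m≢j   = trans (other m m≢i m≢j) (sym (b-refl-other ρ f m≢i m≢j))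

-- Four times k - ⟨x , ε_i - ε_j⟩ at the centre x of the alcove of f, hence positive exactly when
-- this alcove lies on the side ⟨x , ε_i - ε_j⟩ < k.
α : Root → Aff → ℤ
α (root i j k _) f = + 4 * k + b f j - b f i

α-refl : ∀ ρ f → α ρ (refl[ ρ ] ∘A f) ≡ - α ρ f
α-refl ρ@(root i j k _) f = trans (cong₂ (λ u v → + 4 * k + u - v) (b-refl-j ρ f) (b-refl-i ρ f)) (identity k (b f i) (b f j))
  where
  identity : ∀ k u v → + 4 * k + (u - + 4 * k) - (v + + 4 * k) ≡ - (+ 4 * k + v - u)
  identity = solve-∀

refl-involutive : ∀ ρ f → refl[ ρ ] ∘A (refl[ ρ ] ∘A f) ≡ f
refl-involutive ρ f = sym (≡refl∘ ρ (refl[ ρ ] ∘A f)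
  (trans (identity₁ (b f (ri ρ)) (rk ρ)) (cong (_+ + 4 * rk ρ) (sym (b-refl-j ρ f))))
  (trans (identity₂ (b f (rj ρ)) (rk ρ)) (cong (_- + 4 * rk ρ) (sym (b-refl-i ρ f))))
  (λ m m≢i m≢j → sym (b-refl-other ρ f m≢i m≢j)))
  where
  identity₁ : ∀ c k → c ≡ (c - + 4 * k) + + 4 * k
  identity₁ = solve-∀
  identity₂ : ∀ c k → c ≡ (c + + 4 * k) - + 4 * k
  identity₂ = solve-∀

opposite : Root → Root
opposite (root i j k i≢j) = root j i (- k) (i≢j ∘ sym)

refl-opposite : ∀ ρ f → refl[ ρ ] ∘A f ≡ refl[ opposite ρ ] ∘A f
refl-opposite ρ f = ≡refl∘ (opposite ρ) f
  (trans (b-refl-j ρ f) (identity₁ (b f (ri ρ)) (rk ρ)))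
  (trans (b-refl-i ρ f) (identity₂ (b f (rj ρ)) (rk ρ)))
  (λ m m≢j m≢i → b-refl-other ρ f m≢i m≢j)
  where
  identity₁ : ∀ c k → c - + 4 * k ≡ c + + 4 * (- k)
  identity₁ = solve-∀
  identity₂ : ∀ c k → c + + 4 * k ≡ c - + 4 * (- k)
  identity₂ = solve-∀

α-opposite : ∀ ρ f → α (opposite ρ) f ≡ - α ρ f
α-opposite (root i j k _) f = identity k (b f i) (b f j)
  where
  identity : ∀ k u v → + 4 * (- k) + u - v ≡ - (+ 4 * k + v - u)
  identity = solve-∀

-- No centre of an alcove lies on a hyperplane: vanishing would make the values at i and j congruent
-- modulo 4, against injectivity of the permutation.
α≢0 : ∀ ρ {f} → Good f → α ρ f ≢ 0ℤ
α≢0 ρ@(root i j k i≢j) {f} G e = i≢j (sym (perm-injective G (proj₁ (euclid-unique _ _ (lookup (shift f) j) (lookup (shift f) i - k)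
  (trans (identity (+ toℕ (lookup (perm f) j)) (lookup (shift f) j) k (b f i))
         (trans (cong (λ a → b f i + a + + 4 * (- k)) e)
                (identity′ (+ toℕ (lookup (perm f) i)) (lookup (shift f) i) k)))))))
  where
  identity : ∀ r t k v → r + + 4 * t ≡ v + (+ 4 * k + (r + + 4 * t) - v) + + 4 * (- k)
  identity = solve-∀
  identity′ : ∀ r t k → (r + + 4 * t) + 0ℤ + + 4 * (- k) ≡ r + + 4 * (t - k)
  identity′ = solve-∀

α-cases : ∀ ρ {f} → Good f → 0ℤ < α ρ f ⊎ α ρ f < 0ℤ
α-cases ρ {f} G with ℤ.<-cmp 0ℤ (α ρ f)
... | tri< p _ _ = inj₁ p
... | tri≈ _ e _ = contradiction (sym e) (α≢0 ρ G)
... | tri> _ _ n = inj₂ n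

orient : ∀ ρ f → ∃[ ρ′ ] 0ℤ < α ρ′ idA × refl[ ρ ] ∘A f ≡ refl[ ρ′ ] ∘A f
orient ρ f with α-cases ρ idA-good
... | inj₁ p = ρ , p , refl
... | inj₂ n = opposite ρ , subst (0ℤ <_) (sym (α-opposite ρ idA)) (ℤ.neg-mono-< n) , refl-opposite ρ f

-- The wall separating the alcoves of f and f s is ⟨x , ε_i - ε_j⟩ = k, where
-- i and j are the positions of the two residues exchanged by s.
module Wall {g} (G : Good g) (s i j : Fin 4) (perm-i : lookup (perm g) i ≡ prev s) (perm-j : lookup (perm g) j ≡ s) where

  private
    c = proj₁ (prev-carry s)
    ti = lookup (shift g) i
    tj = lookup (shift g) j

    i≢j : i ≢ j
    i≢j refl = prev-≢ s (trans (sym perm-i) perm-j)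

    b-i : b g i ≡ (+ toℕ s - 1ℤ + + 4 * c) + + 4 * ti
    b-i = cong (λ r → r + + 4 * ti) (trans (cong (λ r → + toℕ r) perm-i) (proj₂ (prev-carry s)))

    b-j : b g j ≡ + toℕ s + + 4 * tj
    b-j = cong (λ r → + toℕ r + + 4 * tj) perm-j

  wallRoot : Root
  wallRoot = root i j (c + ti - tj) i≢j

  wall-gap : + 4 * rk wallRoot ≡ b g i - b g j + 1ℤ
  wall-gap = sym (trans (cong₂ (λ u v → u - v + 1ℤ) b-i b-j) (identity (+ toℕ s) c ti tj))
    where
    identity : ∀ s c t u → (s - 1ℤ + + 4 * c + + 4 * t) - (s + + 4 * u) + 1ℤ ≡ + 4 * (c + t - u)
    identity = solve-∀

  α-wall : α wallRoot g ≡ 1ℤ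
  α-wall = trans (cong (λ u → u + b g j - b g i) wall-gap) (identity (b g i) (b g j))
    where
    identity : ∀ u v → u - v + 1ℤ + v - u ≡ 1ℤ
    identity = solve-∀

  moves-i : b (g ∘A gen s) i ≡ b g i + 1ℤ
  moves-i = trans (b-∘gen g s i) (cong (λ d → b g i + d) (value (wallCrossing s (lookup (perm g) i))))
    where
    value : WallCrossing s (lookup (perm g) i) → Δ s (lookup (perm g) i) ≡ 1ℤ
    value (up _ e)     = e
    value (down e _)   = contradiction (trans (sym perm-i) e) (prev-≢ s)
    value (stay n _ _) = contradiction perm-i n

  moves-j : b (g ∘A gen s) j ≡ b g j - 1ℤ
  moves-j = trans (b-∘gen g s j) (cong (λ d → b g j + d) (value (wallCrossing s (lookup (perm g) j))))
    where
    value : WallCrossing s (lookup (perm g) j) → Δ s (lookup (perm g) j) ≡ -1ℤ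
    value (up e _)     = contradiction (trans (sym e) perm-j) (prev-≢ s)
    value (down _ e)   = e
    value (stay _ n _) = contradiction perm-j n

  moves-other : ∀ m → m ≢ i → m ≢ j → b (g ∘A gen s) m ≡ b g m
  moves-other m m≢i m≢j = trans (b-∘gen g s m)
    (trans (cong (λ d → b g m + d) (value (wallCrossing s (lookup (perm g) m)))) (ℤ.+-identityʳ (b g m)))
    where
    value : WallCrossing s (lookup (perm g) m) → Δ s (lookup (perm g) m) ≡ 0ℤ
    value (up e _)     = contradiction (perm-injective G (trans e (sym perm-i))) m≢i
    value (down e _)   = contradiction (perm-injective G (trans e (sym perm-j))) m≢j
    value (stay _ _ e) = e

  ∘gen≡refl∘ : g ∘A gen s ≡ refl[ wallRoot ] ∘A g
  ∘gen≡refl∘ = ≡refl∘ wallRoot g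
    (trans moves-i (trans (identity (b g i) (b g j)) (cong (λ u → b g j + u) (sym wall-gap))))
    (trans moves-j (trans (identity′ (b g i) (b g j)) (cong (λ u → b g i - u) (sym wall-gap))))
    moves-other
    where
    identity : ∀ u v → u + 1ℤ ≡ v + (u - v + 1ℤ)
    identity = solve-∀
    identity′ : ∀ u v → v - 1ℤ ≡ u - (u - v + 1ℤ)
    identity′ = solve-∀

no-crossing : ∀ {a d e} → 0ℤ < a → a + e - d < 0ℤ → 0ℤ ≤ e - d + 1ℤ → ⊥
no-crossing {a} {d} {e} pos neg p = ⊥-by (<⇒0≤ pos ∷ <⇒0≤ neg ∷ p ∷ []) (identity a d e)
  where
  identity : ∀ a d e → (a - (1ℤ + 0ℤ)) + ((0ℤ - (1ℤ + (a + e - d))) + ((e - d + 1ℤ) + 0ℤ)) ≡ -1ℤ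
  identity = solve-∀

tight-crossing : ∀ {a} → 0ℤ < a → a + -1ℤ - 1ℤ < 0ℤ → a ≡ 1ℤ
tight-crossing {a} pos neg = ℤ.≤-antisym (≤-by (<⇒0≤ neg ∷ []) (identity a)) (ℤ.i<j⇒suc[i]≤j pos)
  where
  identity : ∀ a → (0ℤ - (1ℤ + (a + -1ℤ - 1ℤ))) + 0ℤ ≡ 1ℤ - a
  identity = solve-∀

-- One letter changes `α` by Δj - Δi, which is at least -2. Passing from at least 1 to at most -1
-- requires exactly -2, so i and j carry the two residues exchanged by s, and `α` was 1 before. The
-- hyperplane is then the wall between the two alcoves.
crossing : ∀ ρ {f} → Good f → ∀ s → 0ℤ < α ρ f → α ρ (f ∘A gen s) < 0ℤ → f ∘A gen s ≡ refl[ ρ ] ∘A f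
crossing ρ@(root i j k i≢j) {f} G s before after =
  go (wallCrossing s (lookup (perm f) i)) (wallCrossing s (lookup (perm f) j))
  where
  Δi = Δ s (lookup (perm f) i)
  Δj = Δ s (lookup (perm f) j)

  change : α ρ (f ∘A gen s) ≡ α ρ f + Δj - Δi
  change = trans (cong₂ (λ u v → + 4 * k + u - v) (b-∘gen f s j) (b-∘gen f s i)) (identity (+ 4 * k) (b f i) (b f j) Δi Δj)
    where
    identity : ∀ k u v d e → k + (v + e) - (u + d) ≡ (k + v - u) + e - d
    identity = solve-∀

  impossible : ∀ {d e} → Δi ≡ d → Δj ≡ e → 0ℤ ≤ e - d + 1ℤ → ⊥
  impossible {d} {e} p q = no-crossing {α ρ f} {d} {e} before (subst (_< 0ℤ) (trans change (cong₂ (λ d e → α ρ f + e - d) p q)) after)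

  nonneg : ∀ {n} → 0ℤ ≤ + n
  nonneg = +≤+ ℕ.z≤n

  go : WallCrossing s (lookup (perm f) i) → WallCrossing s (lookup (perm f) j) → f ∘A gen s ≡ refl[ ρ ] ∘A f
  go (up p e)     (down q e′)   = subst (λ k → f ∘A gen s ≡ refl[ root i j k i≢j ] ∘A f) same-k same
    where
    open Wall G s i j p q

    α≡1 : α ρ f ≡ 1ℤ
    α≡1 = tight-crossing {α ρ f} before (subst (_< 0ℤ) (trans change (cong₂ (λ d e → α ρ f + e - d) e e′)) after)

    same-k : rk wallRoot ≡ k
    same-k = ℤ.*-cancelˡ-≡ (+ 4) (rk wallRoot) k (trans wall-gap (trans (cong (λ a → b f i - b f j + a) (sym α≡1)) (identity (+ 4 * k) (b f i) (b f j))))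
      where
      identity : ∀ k u v → u - v + (k + v - u) ≡ k
      identity = solve-∀

    same : f ∘A gen s ≡ refl[ root i j (rk wallRoot) i≢j ] ∘A f
    same = ≡refl∘ (root i j (rk wallRoot) i≢j) f (trans (cong (λ h → b h i) ∘gen≡refl∘) (b-refl-i wallRoot f))
      (trans (cong (λ h → b h j) ∘gen≡refl∘) (b-refl-j wallRoot f)) moves-other
  go (up _ e)     (up _ e′)     = ⊥-elim (impossible e e′ nonneg)
  go (up _ e)     (stay _ _ e′) = ⊥-elim (impossible e e′ nonneg)
  go (down _ e)   (up _ e′)     = ⊥-elim (impossible e e′ nonneg)
  go (down _ e)   (down _ e′)   = ⊥-elim (impossible e e′ nonneg)
  go (down _ e)   (stay _ _ e′) = ⊥-elim (impossible e e′ nonneg)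
  go (stay _ _ e) (up _ e′)     = ⊥-elim (impossible e e′ nonneg)
  go (stay _ _ e) (down _ e′)   = ⊥-elim (impossible e e′ nonneg)
  go (stay _ _ e) (stay _ _ e′) = ⊥-elim (impossible e e′ nonneg)

-- A gallery from the fundamental alcove to one on the far side of a hyperplane
-- crosses it; folding the gallery there deletes a letter.
exchange : ∀ ρ → 0ℤ < α ρ idA → ∀ {w} → Reverse w → α ρ (eval w) < 0ℤ →
           ∃[ v ] length v ℕ.< length w × eval v ≡ refl[ ρ ] ∘A eval w
exchange ρ pos []             neg = contradiction neg (ℤ.<-asym pos)
exchange ρ pos (w ∶ rw ∶ʳ s)  neg with α-cases ρ (eval-good w)
-- Here the last letter itself crosses the hyperplane, so it is the letter to delete.
... | inj₁ α>0 = w , subst (length w ℕ.<_) (sym (List.length-++-sucʳ w s [])) (ℕ.s≤s (ℕ.≤-reflexive (cong length (sym (List.++-identityʳ w))))) , eq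
  where
  eq : eval w ≡ refl[ ρ ] ∘A eval (w ∷ʳ s)
  eq = sym (trans (cong (refl[ ρ ] ∘A_) (trans (eval-∷ʳ w s) (crossing ρ (eval-good w) s α>0 (subst (λ f → α ρ f < 0ℤ) (eval-∷ʳ w s) neg))))
                  (refl-involutive ρ (eval w)))
... | inj₂ α<0 with exchange ρ pos rw α<0
... | v , v<w , e = v ∷ʳ s , subst₂ ℕ._<_ (sym (List.length-++ v)) (sym (List.length-++ w)) (ℕ.+-monoˡ-< 1 v<w) ,
  trans (eval-∷ʳ v s) (trans (cong (_∘A gen s) e) (trans (∘A-assoc refl[ ρ ] (eval w) (gen s)) (cong (refl[ ρ ] ∘A_) (sym (eval-∷ʳ w s)))))

-- Lengths, and Bruhat steps as reflections away from the fundamental alcove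

_≟A_ : (f g : Aff) → Dec (f ≡ g)
aff p s ≟A aff q t = map′ (λ (e , e′) → cong₂ aff e e′) (λ e → cong perm e , cong shift e)
  (Vec.≡-dec Fin._≟_ p q ×-dec Vec.≡-dec ℤ._≟_ s t)

wordOfLength? : ∀ n f → Dec (∃[ w ] eval w ≡ f × length w ≡ n)
wordOfLength? zero    f = map′ (λ e → [] , e , refl) (λ { ([] , e , _) → e }) (idA ≟A f)
wordOfLength? (suc n) f = map′
  (λ (s , w , e , l) → s ∷ w , trans (cong (gen s ∘A_) e) (gen∘-involutive s f) , cong suc l)
  (λ { (s ∷ w , e , l) → s , w , trans (sym (gen∘-involutive s (eval w))) (cong (gen s ∘A_) e) , ℕ.suc-injective l })
  (Fin.any? (λ s → wordOfLength? n (gen s ∘A f)))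
  where
  gen∘-involutive : ∀ s f → gen s ∘A (gen s ∘A f) ≡ f
  gen∘-involutive s f = trans (sym (∘A-assoc (gen s) (gen s) f)) (trans (cong (_∘A f) (gen-involutive s)) (∘A-identityˡ f))

-- The least length is found by trying 0, 1, 2, and so on. The search keeps the bound that no word
-- is shorter than k, and the given word, of length m + k, guarantees that it stops.
InW⇒Len : ∀ {f} → InW f → ∃[ n ] Len f n
InW⇒Len {f} (w , e) = search 0 (length w) (λ _ _ → ℕ.z≤n) (w , e , sym (ℕ.+-identityʳ (length w)))
  where
  search : ∀ k m → (∀ w → eval w ≡ f → k ℕ.≤ length w) → (∃[ w ] eval w ≡ f × length w ≡ m ℕ.+ k) → ∃[ n ] Len f n
  search k zero    bound found = k , found , bound
  search k (suc m) bound found with wordOfLength? k f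
  ... | yes found′ = k , found′ , bound
  ... | no none    = search (suc k) m
    (λ w e → ℕ.≤∧≢⇒< (bound w e) (λ l → none (w , e , sym l)))
    (subst (λ n → ∃[ w ] eval w ≡ f × length w ≡ n) (sym (ℕ.+-suc m k)) found)

-- A shortest word of the reflected element leads beyond the hyperplane; `exchange` deletes a letter
-- from it and leaves a word for f.
Len-refl : ∀ ρ → 0ℤ < α ρ idA → ∀ {f m n} → 0ℤ < α ρ f → Len f m → Len (refl[ ρ ] ∘A f) n → m ℕ.< n
Len-refl ρ pos {f} side (_ , min) ((w , e , refl) , _)
  with exchange ρ pos (reverseView w) (subst (_< 0ℤ) (sym (trans (cong (α ρ) e) (α-refl ρ f))) (ℤ.neg-mono-< side))
... | v , v<w , e′ = ℕ.≤-<-trans (min v (trans e′ (trans (cong (refl[ ρ ] ∘A_) e) (refl-involutive ρ f)))) v<w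

refl-bruhat : ∀ ρ {u w t} → 0ℤ < α ρ idA → InW u → InW w → IsReflection t → u ∘A t ≡ w → w ≡ refl[ ρ ] ∘A u →
              0ℤ < α ρ u → BruhatStep u w
refl-bruhat ρ pos Wu Ww t-refl e refl side = _ , t-refl , e , _ , _ , Lu , Lw , Len-refl ρ pos side Lu Lw
  where
  Lu = proj₂ (InW⇒Len Wu)
  Lw = proj₂ (InW⇒Len Ww)

gen-isReflection : ∀ s → IsReflection (gen s)
gen-isReflection s = [] , s , ∘A-identityʳ (gen s)

-- The quantity assumed positive is `α` of the wall at the identity: g and the fundamental alcove
-- lie on the same side of that wall, so s leads away from the fundamental alcove.
ascend : ∀ {g s i j} → InW g → lookup (perm g) i ≡ prev s → lookup (perm g) j ≡ s →
         0ℤ < b g i - b g j + 1ℤ + + toℕ j - + toℕ i → BruhatStep g (g ∘A gen s)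
ascend {g} {s} {i} {j} Wg pi pj lt =
  refl-bruhat wallRoot (subst (0ℤ <_) (sym eq) lt) Wg (InW-∘gen s Wg) (gen-isReflection s) refl ∘gen≡refl∘
    (subst (0ℤ <_) (sym α-wall) (+<+ (ℕ.s≤s ℕ.z≤n)))
  where
  open Wall (InW⇒Good Wg) s i j pi pj
  b-id : ∀ m → b idA m ≡ + toℕ m
  b-id m = trans (cong₂ (λ r s → + toℕ r + + 4 * s) (Vec.lookup-allFin m) (Vec.lookup-replicate m 0ℤ)) (ℤ.+-identityʳ (+ toℕ m))
  eq : α wallRoot idA ≡ b g i - b g j + 1ℤ + + toℕ j - + toℕ i
  eq = trans (cong₂ (λ u v → + 4 * rk wallRoot + u - v) (b-id j) (b-id i)) (cong (λ u → u + + toℕ j - + toℕ i) wall-gap)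

step-InW : ∀ {u w} → InW u → BruhatStep u w → InW w
step-InW (v , refl) (_ , (v′ , i , refl) , e , _) = v ++ (v′ ++ i ∷ reverse v′) , trans (eval-++ v _) e

∘gen-reflection : ∀ {g} → Good g → ∀ s → ∃[ ρ ] g ∘A gen s ≡ refl[ ρ ] ∘A g
∘gen-reflection G s = wallRoot , ∘gen≡refl∘
  where open Wall G s (position G (prev s)) (position G s) (perm-position G (prev s)) (perm-position G s)

-- With t = v s v⁻¹, the product u t is (u v) s v⁻¹. Crossing the wall of u v of type s is a
-- reflection from the left, and v⁻¹ then cancels v.
reflection-left : ∀ {u t} → InW u → IsReflection t → ∃[ ρ ] 0ℤ < α ρ idA × u ∘A t ≡ refl[ ρ ] ∘A u
reflection-left {u} (w , refl) (v , s , refl) =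
  let ρ , e = ∘gen-reflection (InW⇒Good (w ++ v , eval-++ w v)) s
      ρ′ , pos , e′ = orient ρ u
  in ρ′ , pos , trans (conjugated ρ e) e′
  where
  v⁻¹ = eval (reverse v)
  open ≡-Reasoning
  conjugated : ∀ ρ → (u ∘A eval v) ∘A gen s ≡ refl[ ρ ] ∘A (u ∘A eval v) → u ∘A eval (v ++ s ∷ reverse v) ≡ refl[ ρ ] ∘A u
  conjugated ρ e = begin
    u ∘A eval (v ++ s ∷ reverse v)           ≡⟨ cong (u ∘A_) (eval-++ v (s ∷ reverse v)) ⟩
    u ∘A (eval v ∘A (gen s ∘A v⁻¹))          ≡⟨ ∘A-assoc u (eval v) (gen s ∘A v⁻¹) ⟨
    (u ∘A eval v) ∘A (gen s ∘A v⁻¹)          ≡⟨ ∘A-assoc (u ∘A eval v) (gen s) v⁻¹ ⟨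
    ((u ∘A eval v) ∘A gen s) ∘A v⁻¹          ≡⟨ cong (_∘A v⁻¹) e ⟩
    (refl[ ρ ] ∘A (u ∘A eval v)) ∘A v⁻¹      ≡⟨ ∘A-assoc refl[ ρ ] (u ∘A eval v) v⁻¹ ⟩
    refl[ ρ ] ∘A ((u ∘A eval v) ∘A v⁻¹)      ≡⟨ cong (refl[ ρ ] ∘A_) (∘A-assoc u (eval v) v⁻¹) ⟩
    refl[ ρ ] ∘A (u ∘A (eval v ∘A v⁻¹))      ≡⟨ cong (λ f → refl[ ρ ] ∘A (u ∘A f)) (eval-inverseʳ v) ⟩
    refl[ ρ ] ∘A (u ∘A idA)                  ≡⟨ cong (refl[ ρ ] ∘A_) (∘A-identityʳ u) ⟩
    refl[ ρ ] ∘A u                           ∎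

-- Converse to `refl-bruhat`: if u were beyond the hyperplane, `Len-refl` applied to w would make u
-- the longer element.
step-side : ∀ {u w} → InW u → BruhatStep u w → ∃[ ρ ] 0ℤ < α ρ idA × 0ℤ < α ρ u × w ≡ refl[ ρ ] ∘A u
step-side {u} Wu (t , isRefl , refl , m , n , Lu , Lw , m<n) with reflection-left Wu isRefl
... | ρ , pos , e with α-cases ρ (InW⇒Good Wu)
... | inj₁ side = ρ , pos , side , e
... | inj₂ side = contradiction m<n (ℕ.<-asym (Len-refl ρ pos above Lw (subst (λ f → Len f m) back Lu)))
  where
  back : u ≡ refl[ ρ ] ∘A (u ∘A t)
  back = sym (trans (cong (refl[ ρ ] ∘A_) e) (refl-involutive ρ u))
  above : 0ℤ < α ρ (u ∘A t)
  above = subst (0ℤ <_) (sym (trans (cong (α ρ) e) (α-refl ρ u))) (ℤ.neg-mono-< side)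

-- The lifting property and lower intervals under an ascent

conjugate-isReflection : ∀ s {t} → IsReflection t → IsReflection (gen s ∘A (t ∘A gen s))
conjugate-isReflection s (v , i , refl) = s ∷ v , i ,
  cong (gen s ∘A_) (trans (cong eval eq) (eval-∷ʳ (v ++ i ∷ reverse v) s))
  where
  eq : v ++ i ∷ reverse (s ∷ v) ≡ (v ++ i ∷ reverse v) ∷ʳ s
  eq = trans (cong (λ r → v ++ i ∷ r) (List.unfold-reverse s v)) (sym (List.++-assoc v (i ∷ reverse v) (s ∷ [])))

-- The step from u to w reflects u away across a hyperplane. Either u s stays on the near side, and
-- the same reflection is a step from u s to w s, or s crosses that very hyperplane, and then u s is
-- w.
lifting : ∀ {u w} → InW u → BruhatStep u w → ∀ s → u ∘A gen s ≡ w ⊎ BruhatStep (u ∘A gen s) (w ∘A gen s)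
lifting {u} Wu step@(t , isRefl , refl , _) s with step-side Wu step
... | ρ , pos , side , e with α-cases ρ (InW⇒Good (InW-∘gen s Wu))
... | inj₂ side′ = inj₁ (trans (crossing ρ (InW⇒Good Wu) s side side′) (sym e))
... | inj₁ side′ = inj₂ (refl-bruhat ρ pos (InW-∘gen s Wu) (InW-∘gen s (step-InW Wu step))
    (conjugate-isReflection s isRefl) conj
    (trans (cong (_∘A gen s) e) (∘A-assoc refl[ ρ ] u (gen s))) side′)
  where
  conj : (u ∘A gen s) ∘A (gen s ∘A (t ∘A gen s)) ≡ (u ∘A t) ∘A gen s
  conj = let open ≡-Reasoning in begin
    (u ∘A gen s) ∘A (gen s ∘A (t ∘A gen s))  ≡⟨ ∘A-assoc (u ∘A gen s) (gen s) (t ∘A gen s) ⟨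
    ((u ∘A gen s) ∘A gen s) ∘A (t ∘A gen s)  ≡⟨ cong (_∘A (t ∘A gen s)) (∘gen-involutive u s) ⟩
    u ∘A (t ∘A gen s)                        ≡⟨ ∘A-assoc u t (gen s) ⟨
    (u ∘A t) ∘A gen s                        ∎

Below : Aff → Aff → Set
Below θ w = InW w × w ≤B θ

-- Here and in `lift-down` the chain from u to w is multiplied by s step by step; at a step where
-- `lifting` collapses, multiplication by s already reaches the next element of the chain.
lift-up : ∀ {u w} → InW u → u ≤B w → ∀ s → (u ∘A gen s) ≤B (w ∘A gen s) ⊎ (u ∘A gen s) ≤B w
lift-up Wu ε s = inj₁ ε
lift-up Wu (step ◅ rest) s with lifting Wu step s | lift-up (step-InW Wu step) rest s
... | inj₁ refl  | _           = inj₂ rest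
... | inj₂ step′ | inj₁ rest′  = inj₁ (step′ ◅ rest′)
... | inj₂ step′ | inj₂ rest′  = inj₂ (step′ ◅ rest′)

lift-down : ∀ {u w} → InW u → u ≤B w → ∀ s → u ≤B (w ∘A gen s) ⊎ (u ∘A gen s) ≤B (w ∘A gen s)
lift-down Wu ε s = inj₂ ε
lift-down {u} {w} Wu (step ◅ rest) s with lifting Wu step s | lift-down (step-InW Wu step) rest s
... | _          | inj₁ rest′ = inj₁ (step ◅ rest′)
... | inj₁ refl  | inj₂ rest′ = inj₁ (subst (_≤B (w ∘A gen s)) (∘gen-involutive u s) rest′)
... | inj₂ step′ | inj₂ rest′ = inj₂ (step′ ◅ rest′)

below-∘gen : ∀ {θ s} → BruhatStep θ (θ ∘A gen s) → ∀ w → Below (θ ∘A gen s) w ⟺ (Below θ w ⊎ Below θ (w ∘A gen s))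
below-∘gen {θ} {s} ascent w = down′ , up′
  where
  down′ : Below (θ ∘A gen s) w → Below θ w ⊎ Below θ (w ∘A gen s)
  down′ (Ww , w≤) with lift-down Ww w≤ s
  ... | inj₁ p = inj₁ (Ww , subst (w ≤B_) (∘gen-involutive θ s) p)
  ... | inj₂ p = inj₂ (InW-∘gen s Ww , subst ((w ∘A gen s) ≤B_) (∘gen-involutive θ s) p)
  up′ : Below θ w ⊎ Below θ (w ∘A gen s) → Below (θ ∘A gen s) w
  up′ (inj₁ (Ww , w≤))   = Ww , w≤ ◅◅ (ascent ◅ ε)
  up′ (inj₂ (Wws , ws≤)) = subst (Below (θ ∘A gen s)) (∘gen-involutive w s) (InW-∘gen s Wws , cases (lift-up Wws ws≤ s))
    where
    cases : _ → ((w ∘A gen s) ∘A gen s) ≤B (θ ∘A gen s)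
    cases (inj₁ p) = p
    cases (inj₂ p) = p ◅◅ (ascent ◅ ε)

below-id : ∀ w → Below idA w ⟺ (w ≡ idA)
below-id w = minimal , λ { refl → ([] , refl) , ε }
  where
  no-step : ∀ {u} → ¬ BruhatStep u idA
  no-step (_ , _ , _ , _ , n , _ , (_ , min) , m<n) = ℕ.n≮0 (ℕ.<-≤-trans m<n (min [] refl))
  top : ∀ {u} → u ≤B idA → u ≡ idA
  top ε = refl
  top (step ◅ rest) with top rest
  ... | refl = contradiction step no-step
  minimal : Below idA w → w ≡ idA
  minimal (_ , w≤) = top w≤

-- Lower intervals as sets of lattice points

bit : Bool → ℤ
bit true  = 1ℤ
bit false = 0ℤ

⟪_,_⟫ : ∀ {n} → Vec ℤ n → Subset n → ℤ
⟪ []    , []    ⟫ = 0ℤ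
⟪ x ∷ p , s ∷ S ⟫ = bit s * x + ⟪ p , S ⟫

modular : ∀ {n} (p : Vec ℤ n) S T → ⟪ p , S ⟫ + ⟪ p , T ⟫ ≡ ⟪ p , S ∪ T ⟫ + ⟪ p , S ∩ T ⟫
modular []      []      []      = refl
modular (x ∷ p) (s ∷ S) (t ∷ T) = let open ≡-Reasoning in begin
  (bit s * x + ⟪ p , S ⟫) + (bit t * x + ⟪ p , T ⟫)
    ≡⟨ rearrange (bit s) (bit t) x ⟪ p , S ⟫ ⟪ p , T ⟫ ⟩
  (bit s + bit t) * x + (⟪ p , S ⟫ + ⟪ p , T ⟫)
    ≡⟨ cong₂ (λ c u → c * x + u) (bits s t) (modular p S T) ⟩
  (bit (s ∨ t) + bit (s ∧ t)) * x + (⟪ p , S ∪ T ⟫ + ⟪ p , S ∩ T ⟫)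
    ≡⟨ rearrange (bit (s ∨ t)) (bit (s ∧ t)) x ⟪ p , S ∪ T ⟫ ⟪ p , S ∩ T ⟫ ⟨
  (bit (s ∨ t) * x + ⟪ p , S ∪ T ⟫) + (bit (s ∧ t) * x + ⟪ p , S ∩ T ⟫) ∎
  where
  rearrange : ∀ c d x u v → (c * x + u) + (d * x + v) ≡ (c + d) * x + (u + v)
  rearrange = solve-∀
  bits : ∀ s t → bit s + bit t ≡ bit (s ∨ t) + bit (s ∧ t)
  bits true  true  = refl
  bits true  false = refl
  bits false true  = refl
  bits false false = refl

-- p is an integer point of the base polytope of f.
record _∈BP_ {n} (p : Vec ℤ n) (f : Subset n → ℤ) : Set where
  constructor inBP
  field
    bounds : ∀ S → ⟪ p , S ⟫ ≤ f S
    full   : ⟪ p , ⊤ ⟫ ≡ f ⊤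

open _∈BP_ public

-- A point of BP f violating the bound g at S satisfies all bounds h, because
-- p(S) + p(T) = p(S ∪ T) + p(S ∩ T).
BP-union : ∀ {n} {f g h : Subset n → ℤ} →
           (∀ S T → f (S ∪ T) + f (S ∩ T) ≤ g S + h T + 1ℤ) → f ⊤ ≡ g ⊤ → f ⊤ ≡ h ⊤ →
           ∀ {p} → p ∈BP f → p ∈BP g ⊎ p ∈BP h
BP-union {f = f} {g} {h} cross f⊤≡g⊤ f⊤≡h⊤ {p} (inBP bd fl) with Subset.anySubset? (λ S → g S ℤ.<? ⟪ p , S ⟫)
... | no none        = inj₁ (inBP (λ S → ℤ.≮⇒≥ (λ lt → none (S , lt))) (trans fl f⊤≡g⊤))
... | yes (S , g<p)  = inj₂ (inBP
    (λ T → ≤-by (≤⇒0≤ (bd (S ∪ T)) ∷ ≤⇒0≤ (bd (S ∩ T)) ∷ ≤⇒0≤ (cross S T) ∷ <⇒0≤ g<p ∷ ≡⇒0≤ (modular p S T) ∷ [])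
                (identity (f (S ∪ T)) (f (S ∩ T)) (g S) (h T) ⟪ p , S ⟫ ⟪ p , T ⟫ ⟪ p , S ∪ T ⟫ ⟪ p , S ∩ T ⟫))
    (trans fl f⊤≡h⊤))
  where
  identity : ∀ fu fi gs ht ps pt pu pi →
    (fu - pu) + ((fi - pi) + ((gs + ht + 1ℤ - (fu + fi)) + ((ps - (1ℤ + gs)) + ((pu + pi - (ps + pt)) + 0ℤ)))) ≡ ht - pt
  identity = solve-∀

BP-mono : ∀ {n} {f g : Subset n → ℤ} → (∀ S → g S ≤ f S) → f ⊤ ≡ g ⊤ → ∀ {p} → p ∈BP g → p ∈BP f
BP-mono g≤f e (inBP bd fl) = inBP (λ S → ℤ.≤-trans (bd S) (g≤f S)) (trans fl (sym e))

BP-resp : ∀ {n} {f g : Subset n → ℤ} → (∀ S → g S ≡ f S) → ∀ {p} → p ∈BP g → p ∈BP f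
BP-resp e = BP-mono (λ S → ℤ.≤-reflexive (e S)) (sym (e ⊤))

∀Subset? : ∀ {n} {P : Subset n → Set} → (∀ S → Dec (P S)) → Dec (∀ S → P S)
∀Subset? {zero}  P? = map′ (λ p → λ { [] → p }) (λ p → p []) (P? [])
∀Subset? {suc n} P? = map′ (λ (p , q) → λ { (true ∷ S) → p S ; (false ∷ S) → q S })
                           (λ p → (λ S → p (true ∷ S)) , (λ S → p (false ∷ S)))
                           (∀Subset? (λ S → P? (true ∷ S)) ×-dec ∀Subset? (λ S → P? (false ∷ S)))

-- Affine forms in the coordinates of λ

Form : ℕ → Set
Form n = Vec ℤ n

-- An affine form in x, y, z is evaluated at (1, x, y, z), so its head is the constant term.
_at_ : ∀ {n} → Form n → Vec ℕ n → ℤ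
[]      at []      = 0ℤ
(c ∷ F) at (m ∷ v) = c * + m + F at v

_⊞_ : ∀ {n} → Form n → Form n → Form n
_⊞_ = Vec.zipWith _+_

infixl 6 _⊞_
infix  8 _at_
infix  4 _≼_ _≼?_

at-⊞ : ∀ {n} (F G : Form n) v → (F ⊞ G) at v ≡ F at v + G at v
at-⊞ []      []      []      = refl
at-⊞ (c ∷ F) (d ∷ G) (m ∷ v) = trans (cong (λ u → (c + d) * + m + u) (at-⊞ F G v)) (identity c d (+ m) (F at v) (G at v))
  where
  identity : ∀ c d m u v → (c + d) * m + (u + v) ≡ (c * m + u) + (d * m + v)
  identity = solve-∀

-- Sufficient for the inequality of values because the arguments are natural numbers, and decidable
-- without knowing the arguments.
_≼_ : ∀ {n} → Form n → Form n → Set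
_≼_ = Pointwise _≤_

_≼?_ : ∀ {n} (F G : Form n) → Dec (F ≼ G)
_≼?_ = Pointwise.decidable ℤ._≤?_

at-mono : ∀ {n} {F G : Form n} → F ≼ G → ∀ v → F at v ≤ G at v
at-mono []         []      = ℤ.≤-refl
at-mono (le ∷ les) (m ∷ v) = ℤ.+-mono-≤ (ℤ.*-monoʳ-≤-nonNeg (+ m) le) (at-mono les v)

injective⇒surjective : ∀ {n} (g : Fin n → Fin n) → (∀ {r r′} → g r ≡ g r′ → r ≡ r′) → ∀ i → ∃[ r ] g r ≡ i
injective⇒surjective {suc n} g inj i with Fin.any? (λ r → g r Fin.≟ i)
... | yes hit  = hit
... | no  miss = contradiction (Fin.injective⇒≤ {f = λ r → Fin.punchOut (avoid r)} (λ {r} {r′} e → inj (Fin.punchOut-injective (avoid r) (avoid r′) e))) ℕ.1+n≰n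
  where
  avoid : ∀ r → i ≢ g r
  avoid r e = miss (r , sym e)

-- Coordinates on the left cosets of ⟨s₁, s₂, s₃⟩: such a coset only remembers
-- the set of values b w i, and p r is read off from the value congruent to r + κ.
Chart : ℤ → Vec ℤ 4 → Aff → Set
Chart κ p w = ∀ r → ∃[ i ] b w i ≡ + 4 * lookup p r + (+ toℕ r + κ)

chart-surjective : ∀ κ p w → Chart κ p w → ∀ i → ∃[ r ] b w i ≡ + 4 * lookup p r + (+ toℕ r + κ)
chart-surjective κ p w ch i =
  let r , e = injective⇒surjective (proj₁ ∘ ch) injective i in r , trans (cong (b w) (sym e)) (proj₂ (ch r))
  where
  cancel : ∀ p r p′ r′ κ → + 4 * p + (r + κ) ≡ + 4 * p′ + (r′ + κ) → r + + 4 * p ≡ r′ + + 4 * p′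
  cancel p r p′ r′ κ e = trans (there′ p r κ) (trans (cong (_- κ) e) (sym (there′ p′ r′ κ)))
    where
    there′ : ∀ p r κ → r + + 4 * p ≡ + 4 * p + (r + κ) - κ
    there′ = solve-∀
  injective : ∀ {r r′} → proj₁ (ch r) ≡ proj₁ (ch r′) → r ≡ r′
  injective {r} {r′} e = proj₁ (euclid-unique r r′ (lookup p r) (lookup p r′)
    (cancel (lookup p r) (+ toℕ r) (lookup p r′) (+ toℕ r′) κ
      (trans (sym (proj₂ (ch r))) (trans (cong (b w) e) (proj₂ (ch r′))))))

-- At offset κ the label r has residue r + κ modulo 4, so the generator exchanging the labels r₀ - 1
-- and r₀ is the one congruent to r₀ + κ.
genAt : ℤ → Fin 4 → Fin 4
genAt κ r₀ = Fin.fromℕ< (ℤ.n%ℕd<d (κ + + toℕ r₀) 4)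

genAt-spec : ∀ κ r₀ → ∃[ q ] κ + + toℕ r₀ ≡ + toℕ (genAt κ r₀) + + 4 * q
genAt-spec κ r₀ = q , trans (ℤ.a≡a%ℕn+[a/ℕn]*n (κ + + toℕ r₀) 4)
  (cong₂ _+_ (cong +_ (sym (Fin.toℕ-fromℕ< (ℤ.n%ℕd<d (κ + + toℕ r₀) 4)))) (ℤ.*-comm q (+ 4)))
  where q = (κ + + toℕ r₀) ℤ./ℕ 4

-- The residue r + s - r₀ modulo 4. A 4 is added to stay within ℕ, and `rotated-carry` takes it off
-- again.
rotated : Fin 4 → Fin 4 → Fin 4 → Fin 4
rotated s r₀ r = (toℕ r ℕ.+ toℕ s ℕ.+ (4 ℕ.∸ toℕ r₀)) mod 4

rotated-carry : Fin 4 → Fin 4 → Fin 4 → ℤ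
rotated-carry s r₀ r = + ((toℕ r ℕ.+ toℕ s ℕ.+ (4 ℕ.∸ toℕ r₀)) / 4) - 1ℤ

rotated-spec : ∀ s r₀ r → + toℕ r + + toℕ s - + toℕ r₀ ≡ + toℕ (rotated s r₀ r) + + 4 * rotated-carry s r₀ r
rotated-spec = from-yes (Fin.all? λ s → Fin.all? λ r₀ → Fin.all? λ r →
  + toℕ r + + toℕ s - + toℕ r₀ ℤ.≟ + toℕ (rotated s r₀ r) + + 4 * rotated-carry s r₀ r)

Δ-rotated : ∀ s r₀ r → Δ s (rotated s r₀ r) ≡ Δ r₀ r
Δ-rotated = from-yes (Fin.all? λ s → Fin.all? λ r₀ → Fin.all? λ r → Δ s (rotated s r₀ r) ℤ.≟ Δ r₀ r)

rotated-prev : ∀ s r₀ → rotated s r₀ (prev r₀) ≡ prev s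
rotated-prev = from-yes (Fin.all? λ s → Fin.all? λ r₀ → rotated s r₀ (prev r₀) Fin.≟ prev s)

rotated-self : ∀ s r₀ → rotated s r₀ r₀ ≡ s
rotated-self = from-yes (Fin.all? λ s → Fin.all? λ r₀ → rotated s r₀ r₀ Fin.≟ s)

chart-perm : ∀ κ w i c r r₀ → b w i ≡ + 4 * c + (+ toℕ r + κ) → lookup (perm w) i ≡ rotated (genAt κ r₀) r₀ r
chart-perm κ w i c r r₀ e = proj₁ (euclid-unique _ _ (lookup (shift w) i) (carry + c + q) (trans e eq))
  where
  s     = genAt κ r₀
  q     = proj₁ (genAt-spec κ r₀)
  carry = rotated-carry s r₀ r
  identity₁ : ∀ c r κ r₀ → + 4 * c + (r + κ) ≡ + 4 * c + (r + ((κ + r₀) - r₀))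
  identity₁ = solve-∀
  identity₂ : ∀ c r s q r₀ → + 4 * c + (r + ((s + + 4 * q) - r₀)) ≡ (r + s - r₀) + + 4 * (c + q)
  identity₂ = solve-∀
  identity₃ : ∀ c q t k → (t + + 4 * k) + + 4 * (c + q) ≡ t + + 4 * (k + c + q)
  identity₃ = solve-∀
  eq : + 4 * c + (+ toℕ r + κ) ≡ + toℕ (rotated s r₀ r) + + 4 * (carry + c + q)
  eq = trans (identity₁ c (+ toℕ r) κ (+ toℕ r₀))
      (trans (cong (λ u → + 4 * c + (+ toℕ r + (u - + toℕ r₀))) (proj₂ (genAt-spec κ r₀)))
      (trans (identity₂ c (+ toℕ r) (+ toℕ s) q (+ toℕ r₀))
      (trans (cong (λ u → u + + 4 * (c + q)) (rotated-spec s r₀ r))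
             (identity₃ c q (+ toℕ (rotated s r₀ r)) carry))))

permGen : Fin 4 → Fin 4 → Fin 4
permGen r = lookup (perm (gen r))

shiftGen : Fin 4 → Fin 4 → ℤ
shiftGen r = lookup (shift (gen r))

-- Multiplication by `genAt κ r₀` acts on labels and coordinates as the fixed generator r₀ does, so
-- the polytopes can be studied independently of κ.
chart-∘gen : ∀ κ w i c r r₀ → b w i ≡ + 4 * c + (+ toℕ r + κ) →
             b (w ∘A gen (genAt κ r₀)) i ≡ + 4 * (c + shiftGen r₀ r) + (+ toℕ (permGen r₀ r) + κ)
chart-∘gen κ w i c r r₀ e = trans (b-∘gen w s i)
  (trans (cong₂ _+_ e (trans (cong (Δ s) (chart-perm κ w i c r r₀ e)) (Δ-rotated s r₀ r)))
         (identity c (+ toℕ r) κ (+ toℕ (permGen r₀ r)) (shiftGen r₀ r)))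
  where
  s = genAt κ r₀
  identity : ∀ c r κ r′ t → (+ 4 * c + (r + κ)) + ((r′ + + 4 * t) - r) ≡ + 4 * (c + t) + (r′ + κ)
  identity = solve-∀

-- Reflections acting on lattice points and on support functions

reflectP : Fin 4 → Vec ℤ 4 → Vec ℤ 4
reflectP r₀ p = tabulate λ r → lookup p (permGen r₀ r) + shiftGen r₀ (permGen r₀ r)

chart-reflect : ∀ κ p w r₀ → Chart κ p w → Chart κ (reflectP r₀ p) (w ∘A gen (genAt κ r₀))
chart-reflect κ p w r₀ ch r =
  let i , e = ch (permGen r₀ r) in
  i , trans (chart-∘gen κ w i (lookup p (permGen r₀ r)) (permGen r₀ r) r₀ e)
        (cong₂ (λ c r → + 4 * c + (+ toℕ r + κ))
               (sym (Vec.lookup∘tabulate (λ r → lookup p (permGen r₀ r) + shiftGen r₀ (permGen r₀ r)) r))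
               (gen-perm-involutive r₀ r))

permS : Fin 4 → Subset 4 → Subset 4
permS r₀ S = tabulate λ r → lookup S (permGen r₀ r)

permS-involutive : ∀ r₀ S → permS r₀ (permS r₀ S) ≡ S
permS-involutive r₀ S = lookup-injective λ r →
  trans (Vec.lookup∘tabulate (λ r → lookup (permS r₀ S) (permGen r₀ r)) r)
        (trans (Vec.lookup∘tabulate (λ r → lookup S (permGen r₀ r)) (permGen r₀ r)) (cong (lookup S) (gen-perm-involutive r₀ r)))

reflect-identity₀ : ∀ p₀ p₁ p₂ p₃ s₀ s₁ s₂ s₃ →
  s₀ * (p₃ + 1ℤ) + (s₁ * (p₁ + 0ℤ) + (s₂ * (p₂ + 0ℤ) + (s₃ * (p₀ + -1ℤ) + 0ℤ))) ≡
  (s₃ * p₀ + (s₁ * p₁ + (s₂ * p₂ + (s₀ * p₃ + 0ℤ)))) + (s₃ * -1ℤ + (s₁ * 0ℤ + (s₂ * 0ℤ + (s₀ * 1ℤ + 0ℤ))))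
reflect-identity₀ = solve-∀
reflect-identity₁ : ∀ p₀ p₁ p₂ p₃ s₀ s₁ s₂ s₃ →
  s₀ * (p₁ + 0ℤ) + (s₁ * (p₀ + 0ℤ) + (s₂ * (p₂ + 0ℤ) + (s₃ * (p₃ + 0ℤ) + 0ℤ))) ≡
  (s₁ * p₀ + (s₀ * p₁ + (s₂ * p₂ + (s₃ * p₃ + 0ℤ)))) + (s₁ * 0ℤ + (s₀ * 0ℤ + (s₂ * 0ℤ + (s₃ * 0ℤ + 0ℤ))))
reflect-identity₁ = solve-∀
reflect-identity₂ : ∀ p₀ p₁ p₂ p₃ s₀ s₁ s₂ s₃ →
  s₀ * (p₀ + 0ℤ) + (s₁ * (p₂ + 0ℤ) + (s₂ * (p₁ + 0ℤ) + (s₃ * (p₃ + 0ℤ) + 0ℤ))) ≡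
  (s₀ * p₀ + (s₂ * p₁ + (s₁ * p₂ + (s₃ * p₃ + 0ℤ)))) + (s₀ * 0ℤ + (s₂ * 0ℤ + (s₁ * 0ℤ + (s₃ * 0ℤ + 0ℤ))))
reflect-identity₂ = solve-∀
reflect-identity₃ : ∀ p₀ p₁ p₂ p₃ s₀ s₁ s₂ s₃ →
  s₀ * (p₀ + 0ℤ) + (s₁ * (p₁ + 0ℤ) + (s₂ * (p₃ + 0ℤ) + (s₃ * (p₂ + 0ℤ) + 0ℤ))) ≡
  (s₀ * p₀ + (s₁ * p₁ + (s₃ * p₂ + (s₂ * p₃ + 0ℤ)))) + (s₀ * 0ℤ + (s₁ * 0ℤ + (s₃ * 0ℤ + (s₂ * 0ℤ + 0ℤ))))
reflect-identity₃ = solve-∀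

⟪⟫-reflect : ∀ r₀ p S → ⟪ reflectP r₀ p , S ⟫ ≡ ⟪ p , permS r₀ S ⟫ + ⟪ shift (gen r₀) , permS r₀ S ⟫
⟪⟫-reflect zero (p₀ ∷ p₁ ∷ p₂ ∷ p₃ ∷ []) (s₀ ∷ s₁ ∷ s₂ ∷ s₃ ∷ []) =
  reflect-identity₀ p₀ p₁ p₂ p₃ (bit s₀) (bit s₁) (bit s₂) (bit s₃)
⟪⟫-reflect (suc zero) (p₀ ∷ p₁ ∷ p₂ ∷ p₃ ∷ []) (s₀ ∷ s₁ ∷ s₂ ∷ s₃ ∷ []) =
  reflect-identity₁ p₀ p₁ p₂ p₃ (bit s₀) (bit s₁) (bit s₂) (bit s₃)
⟪⟫-reflect (suc (suc zero)) (p₀ ∷ p₁ ∷ p₂ ∷ p₃ ∷ []) (s₀ ∷ s₁ ∷ s₂ ∷ s₃ ∷ []) =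
  reflect-identity₂ p₀ p₁ p₂ p₃ (bit s₀) (bit s₁) (bit s₂) (bit s₃)
⟪⟫-reflect (suc (suc (suc zero))) (p₀ ∷ p₁ ∷ p₂ ∷ p₃ ∷ []) (s₀ ∷ s₁ ∷ s₂ ∷ s₃ ∷ []) =
  reflect-identity₃ p₀ p₁ p₂ p₃ (bit s₀) (bit s₁) (bit s₂) (bit s₃)

constant : ∀ {n} → ℤ → Form (suc n)
constant {n} c = c ∷ Vec.replicate n 0ℤ

zero-at : ∀ {n} (v : Vec ℕ n) → Vec.replicate n 0ℤ at v ≡ 0ℤ
zero-at []      = refl
zero-at (m ∷ v) = trans (ℤ.+-identityˡ _) (zero-at v)

constant-at : ∀ {n} c (v : Vec ℕ n) → constant c at (1 ∷ v) ≡ c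
constant-at c v = trans (cong (λ u → c * 1ℤ + u) (zero-at v)) (trans (ℤ.+-identityʳ (c * 1ℤ)) (ℤ.*-identityʳ c))

Forms : Set
Forms = Subset 4 → Form 4

-- Solving `⟪⟫-reflect` for the bound at T: these are the bounds of the image of the polytope of F
-- under the reflection.
actF : Fin 4 → Forms → Forms
actF r₀ F T = F (permS r₀ T) ⊞ constant (- ⟪ shift (gen r₀) , T ⟫)

actF-at : ∀ r₀ F T v → actF r₀ F T at (1 ∷ v) ≡ F (permS r₀ T) at (1 ∷ v) - ⟪ shift (gen r₀) , T ⟫
actF-at r₀ F T v = trans (at-⊞ (F (permS r₀ T)) _ (1 ∷ v)) (cong (λ u → F (permS r₀ T) at (1 ∷ v) + u) (constant-at (- ⟪ shift (gen r₀) , T ⟫) v))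

Polytope : Forms → Vec ℕ 3 → Vec ℤ 4 → Set
Polytope F v p = p ∈BP (λ S → F S at (1 ∷ v))

permS-⊤ : ∀ r₀ → permS r₀ ⊤ ≡ ⊤
permS-⊤ = from-yes (Fin.all? λ r₀ → Vec.≡-dec Bool._≟_ (permS r₀ ⊤) ⊤)

reflect-polytope : ∀ r₀ F v p → Polytope (actF r₀ F) v p → Polytope F v (reflectP r₀ p)
reflect-polytope r₀ F v p (inBP bd fl) = inBP
  (λ S → subst₂ _≤_ (sym (⟪⟫-reflect r₀ p S)) (back S) (ℤ.+-monoˡ-≤ ⟪ shift (gen r₀) , permS r₀ S ⟫ (bd (permS r₀ S))))
  (trans (⟪⟫-reflect r₀ p ⊤) (trans (cong (λ u → u + ⟪ shift (gen r₀) , permS r₀ ⊤ ⟫) fl′) (back ⊤)))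
  where
  cancel : ∀ f c → (f - c) + c ≡ f
  cancel = solve-∀
  back : ∀ S → actF r₀ F (permS r₀ S) at (1 ∷ v) + ⟪ shift (gen r₀) , permS r₀ S ⟫ ≡ F S at (1 ∷ v)
  back S = trans (cong (_+ ⟪ shift (gen r₀) , permS r₀ S ⟫) (actF-at r₀ F (permS r₀ S) v))
    (trans (cancel (F (permS r₀ (permS r₀ S)) at (1 ∷ v)) ⟪ shift (gen r₀) , permS r₀ S ⟫)
           (cong (λ T → F T at (1 ∷ v)) (permS-involutive r₀ S)))
  fl′ : ⟪ p , permS r₀ ⊤ ⟫ ≡ actF r₀ F (permS r₀ ⊤) at (1 ∷ v)
  fl′ = subst (λ T → ⟪ p , T ⟫ ≡ actF r₀ F T at (1 ∷ v)) (sym (permS-⊤ r₀)) fl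

unreflect-polytope : ∀ r₀ F v p → Polytope F v (reflectP r₀ p) → Polytope (actF r₀ F) v p
unreflect-polytope r₀ F v p (inBP bd fl) = inBP
  (λ T → subst₂ _≤_ (sym (pairing T)) (sym (actF-at r₀ F T v)) (ℤ.+-monoˡ-≤ (- ⟪ shift (gen r₀) , T ⟫) (bd (permS r₀ T))))
  (trans (pairing ⊤) (trans (cong (_- ⟪ shift (gen r₀) , ⊤ ⟫) fl′) (sym (actF-at r₀ F ⊤ v))))
  where
  cancel : ∀ f c → f ≡ (f + c) - c
  cancel = solve-∀
  pairing : ∀ T → ⟪ p , T ⟫ ≡ ⟪ reflectP r₀ p , permS r₀ T ⟫ - ⟪ shift (gen r₀) , T ⟫
  pairing T = trans (cancel ⟪ p , T ⟫ ⟪ shift (gen r₀) , T ⟫) (cong (_- ⟪ shift (gen r₀) , T ⟫)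
    (sym (trans (⟪⟫-reflect r₀ p (permS r₀ T)) (cong (λ U → ⟪ p , U ⟫ + ⟪ shift (gen r₀) , U ⟫) (permS-involutive r₀ T)))))
  fl′ : ⟪ reflectP r₀ p , permS r₀ ⊤ ⟫ ≡ F (permS r₀ ⊤) at (1 ∷ v)
  fl′ = subst (λ T → ⟪ reflectP r₀ p , T ⟫ ≡ F T at (1 ∷ v)) (sym (permS-⊤ r₀)) fl

-- Lower intervals as polytopes, and their growth along an ascent

_≟F_ : ∀ {n} (F G : Form n) → Dec (F ≡ G)
_≟F_ = Vec.≡-dec ℤ._≟_

-- Certifies, for every λ, that the lattice points of F′ are those of F together with their
-- reflections: `below` and `below′` give one inclusion, `cross` the other through `BP-union`. The
-- added 1 is the gain from integrality, since a violated bound is exceeded by at least 1.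
record Covers (r₀ : Fin 4) (F F′ : Forms) : Set where
  constructor covers
  field
    below  : ∀ S → F S ≼ F′ S
    below′ : ∀ S → actF r₀ F S ≼ F′ S
    cross  : ∀ S T → F′ (S ∪ T) ⊞ F′ (S ∩ T) ≼ F S ⊞ actF r₀ F T ⊞ constant 1ℤ
    same   : F′ ⊤ ≡ F ⊤
    same′  : F′ ⊤ ≡ actF r₀ F ⊤

covers? : ∀ r₀ F F′ → Dec (Covers r₀ F F′)
covers? r₀ F F′ = map′ (λ (a , b , c , d , e) → covers a b c d e) (λ (covers a b c d e) → a , b , c , d , e)
  (∀Subset? (λ S → F S ≼? F′ S) ×-dec ∀Subset? (λ S → actF r₀ F S ≼? F′ S) ×-dec
   ∀Subset? (λ S → ∀Subset? λ T → F′ (S ∪ T) ⊞ F′ (S ∩ T) ≼? F S ⊞ actF r₀ F T ⊞ constant 1ℤ) ×-dec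
   (F′ ⊤ ≟F F ⊤) ×-dec (F′ ⊤ ≟F actF r₀ F ⊤))

reflect-involutive : ∀ r₀ p → reflectP r₀ (reflectP r₀ p) ≡ p
reflect-involutive r₀ p = lookup-injective λ r → let r′ = permGen r₀ r in
  trans (Vec.lookup∘tabulate (λ r → lookup (reflectP r₀ p) (permGen r₀ r) + shiftGen r₀ (permGen r₀ r)) r)
  (trans (cong (_+ shiftGen r₀ r′) (Vec.lookup∘tabulate (λ r → lookup p (permGen r₀ r) + shiftGen r₀ (permGen r₀ r)) r′))
  (trans (cong (λ i → lookup p i + shiftGen r₀ i + shiftGen r₀ r′) (gen-perm-involutive r₀ r))
  (trans (ℤ.+-assoc (lookup p r) (shiftGen r₀ r) (shiftGen r₀ r′))
  (trans (cong (λ u → lookup p r + u) (opposite-shifts r₀ r)) (ℤ.+-identityʳ (lookup p r))))))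
  where
  opposite-shifts : ∀ r₀ r → shiftGen r₀ r + shiftGen r₀ (permGen r₀ r) ≡ 0ℤ
  opposite-shifts = from-yes (Fin.all? λ r₀ → Fin.all? λ r → shiftGen r₀ r + shiftGen r₀ (permGen r₀ r) ℤ.≟ 0ℤ)

-- `τ i` is the label carried by θ at position i and `C i` its coordinate. Keeping `C` and F as
-- forms lets the same data describe θ and its interval for all λ.
record Interval (κ : ℤ) (v : Vec ℕ 3) (F : Forms) (τ : Fin 4 → Fin 4) (C : Fin 4 → Form 4) : Set where
  field
    θ       : Aff
    θ-InW   : InW θ
    b-θ     : ∀ i → b θ i ≡ + 4 * (C i at (1 ∷ v)) + (+ toℕ (τ i) + κ)
    below-θ : ∀ w → Below θ w ⟺ (∃[ p ] (Polytope F v p × Chart κ p w))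

open Interval public

stepC : Fin 4 → (Fin 4 → Fin 4) → (Fin 4 → Form 4) → Fin 4 → Form 4
stepC r₀ τ C i = C i ⊞ constant (shiftGen r₀ (τ i))

-- The quantity that `ascend` wants positive, as an affine form: the offset κ cancels in the
-- difference of two values.
gapForm : (Fin 4 → Fin 4) → (Fin 4 → Form 4) → Fin 4 → Fin 4 → Form 4
gapForm τ C i j = Vec.map (+ 4 *_) (C i) ⊞ Vec.map (-[1+ 3 ] *_) (C j) ⊞ constant (+ toℕ (τ i) - + toℕ (τ j) + 1ℤ + + toℕ j - + toℕ i)

scale-at : ∀ {n} c (F : Form n) v → Vec.map (c *_) F at v ≡ c * F at v
scale-at c []      []      = sym (ℤ.*-zeroʳ c)
scale-at c (d ∷ F) (m ∷ v) = trans (cong (λ u → c * d * + m + u) (scale-at c F v)) (identity c d (+ m) (F at v))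
  where
  identity : ∀ c d m u → c * d * m + c * u ≡ c * (d * m + u)
  identity = solve-∀

interval-step : ∀ {κ v F τ C} r₀ i j {F′} → τ i ≡ prev r₀ → τ j ≡ r₀ → constant 1ℤ ≼ gapForm τ C i j → Covers r₀ F F′ →
                Interval κ v F τ C → Interval κ v F′ (permGen r₀ ∘ τ) (stepC r₀ τ C)
interval-step {κ} {v} {F} {τ} {C} r₀ i j {F′} τi τj gap cov I = record
  { θ       = θ I ∘A gen s
  ; θ-InW   = InW-∘gen s (θ-InW I)
  ; b-θ     = λ m → trans (chart-∘gen κ (θ I) m (C m at (1 ∷ v)) (τ m) r₀ (b-θ I m))
                (cong (λ c → + 4 * c + (+ toℕ (permGen r₀ (τ m)) + κ))
                      (sym (trans (at-⊞ (C m) (constant (shiftGen r₀ (τ m))) (1 ∷ v))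
                                  (cong (λ u → C m at (1 ∷ v) + u) (constant-at (shiftGen r₀ (τ m)) v)))))
  ; below-θ = λ w → (λ le → into w (proj₁ (below-∘gen {θ I} {s} ascent w) le)) , (λ q → proj₂ (below-∘gen {θ I} {s} ascent w) (outof w q))
  }
  where
  open Covers cov
  s = genAt κ r₀

  positive : 0ℤ < b (θ I) i - b (θ I) j + 1ℤ + + toℕ j - + toℕ i
  positive = ℤ.suc[i]≤j⇒i<j (subst₂ _≤_ (constant-at 1ℤ v) eq (at-mono gap (1 ∷ v)))
    where
    identity : ∀ c d t u κ k l → + 4 * c + -[1+ 3 ] * d + (t - u + 1ℤ + k - l) ≡ (+ 4 * c + (t + κ)) - (+ 4 * d + (u + κ)) + 1ℤ + k - l
    identity = solve-∀
    k = + toℕ (τ i) - + toℕ (τ j) + 1ℤ + + toℕ j - + toℕ i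
    eq : gapForm τ C i j at (1 ∷ v) ≡ b (θ I) i - b (θ I) j + 1ℤ + + toℕ j - + toℕ i
    eq = trans (at-⊞ (Vec.map (+ 4 *_) (C i) ⊞ Vec.map (-[1+ 3 ] *_) (C j)) (constant k) (1 ∷ v))
        (trans (cong₂ _+_ (trans (at-⊞ (Vec.map (+ 4 *_) (C i)) (Vec.map (-[1+ 3 ] *_) (C j)) (1 ∷ v))
                                 (cong₂ _+_ (scale-at (+ 4) (C i) (1 ∷ v)) (scale-at -[1+ 3 ] (C j) (1 ∷ v))))
                          (constant-at k v))
        (trans (identity (C i at (1 ∷ v)) (C j at (1 ∷ v)) (+ toℕ (τ i)) (+ toℕ (τ j)) κ (+ toℕ j) (+ toℕ i))
               (cong₂ (λ u w → u - w + 1ℤ + + toℕ j - + toℕ i) (sym (b-θ I i)) (sym (b-θ I j)))))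

  ascent : BruhatStep (θ I) (θ I ∘A gen s)
  ascent = ascend {θ I} {s} {i} {j} (θ-InW I)
    (trans (chart-perm κ (θ I) i (C i at (1 ∷ v)) (τ i) r₀ (b-θ I i)) (trans (cong (rotated s r₀) τi) (rotated-prev s r₀)))
    (trans (chart-perm κ (θ I) j (C j at (1 ∷ v)) (τ j) r₀ (b-θ I j)) (trans (cong (rotated s r₀) τj) (rotated-self s r₀)))
    positive

  same-at : ∀ {G H : Form 4} → G ≡ H → G at (1 ∷ v) ≡ H at (1 ∷ v)
  same-at = cong (λ G → G at (1 ∷ v))

  into : ∀ w → Below (θ I) w ⊎ Below (θ I) (w ∘A gen s) → ∃[ p ] (Polytope F′ v p × Chart κ p w)
  into w (inj₁ le) = let p , P , ch = proj₁ (below-θ I w) le in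
    p , BP-mono (λ S → at-mono (below S) (1 ∷ v)) (same-at same) P , ch
  into w (inj₂ le) = let p , P , ch = proj₁ (below-θ I (w ∘A gen s)) le in
    reflectP r₀ p ,
    BP-mono (λ S → at-mono (below′ S) (1 ∷ v)) (same-at same′)
      (unreflect-polytope r₀ F v (reflectP r₀ p) (subst (Polytope F v) (sym (reflect-involutive r₀ p)) P)) ,
    subst (Chart κ (reflectP r₀ p)) (∘gen-involutive w s) (chart-reflect κ p (w ∘A gen s) r₀ ch)

  outof : ∀ w → ∃[ p ] (Polytope F′ v p × Chart κ p w) → Below (θ I) w ⊎ Below (θ I) (w ∘A gen s)
  outof w (p , P , ch) with BP-union {g = λ S → F S at (1 ∷ v)} {h = λ S → actF r₀ F S at (1 ∷ v)} cross-at (same-at same) (same-at same′) P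
    where
    cross-at : ∀ S T → F′ (S ∪ T) at (1 ∷ v) + F′ (S ∩ T) at (1 ∷ v) ≤ F S at (1 ∷ v) + actF r₀ F T at (1 ∷ v) + 1ℤ
    cross-at S T = subst₂ _≤_ (at-⊞ (F′ (S ∪ T)) (F′ (S ∩ T)) (1 ∷ v))
      (trans (at-⊞ (F S ⊞ actF r₀ F T) (constant 1ℤ) (1 ∷ v)) (cong₂ _+_ (at-⊞ (F S) (actF r₀ F T) (1 ∷ v)) (constant-at 1ℤ v)))
      (at-mono (cross S T) (1 ∷ v))
  ... | inj₁ P′ = inj₁ (proj₂ (below-θ I w) (p , P′ , ch))
  ... | inj₂ P′ = inj₂ (proj₂ (below-θ I (w ∘A gen s)) (reflectP r₀ p , reflect-polytope r₀ F v p P′ , chart-reflect κ p w r₀ ch))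

-- Rotation of the labels

rotP : Vec ℤ 4 → Vec ℤ 4
rotP (p₀ ∷ p₁ ∷ p₂ ∷ p₃ ∷ []) = p₃ + 1ℤ ∷ p₀ ∷ p₁ ∷ p₂ ∷ []

unrotP : Vec ℤ 4 → Vec ℤ 4
unrotP (p₀ ∷ p₁ ∷ p₂ ∷ p₃ ∷ []) = p₁ ∷ p₂ ∷ p₃ ∷ p₀ - 1ℤ ∷ []

rotF : Forms → Forms
rotF F (s₀ ∷ s₁ ∷ s₂ ∷ s₃ ∷ []) = F (s₁ ∷ s₂ ∷ s₃ ∷ s₀ ∷ []) ⊞ constant (bit s₀)

rotF-at : ∀ F s₀ s₁ s₂ s₃ v → rotF F (s₀ ∷ s₁ ∷ s₂ ∷ s₃ ∷ []) at (1 ∷ v) ≡ F (s₁ ∷ s₂ ∷ s₃ ∷ s₀ ∷ []) at (1 ∷ v) + bit s₀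
rotF-at F s₀ s₁ s₂ s₃ v = trans (at-⊞ F′ (constant (bit s₀)) (1 ∷ v)) (cong (λ u → F′ at (1 ∷ v) + u) (constant-at (bit s₀) v))
  where F′ = F (s₁ ∷ s₂ ∷ s₃ ∷ s₀ ∷ [])

rot-identity : ∀ p₀ p₁ p₂ p₃ s₀ s₁ s₂ s₃ →
  s₀ * (p₃ + 1ℤ) + (s₁ * p₀ + (s₂ * p₁ + (s₃ * p₂ + 0ℤ))) ≡ (s₁ * p₀ + (s₂ * p₁ + (s₃ * p₂ + (s₀ * p₃ + 0ℤ)))) + s₀
rot-identity = solve-∀

unrot-identity : ∀ p₀ p₁ p₂ p₃ s₀ s₁ s₂ s₃ →
  s₁ * p₁ + (s₂ * p₂ + (s₃ * p₃ + (s₀ * (p₀ - 1ℤ) + 0ℤ))) ≡ (s₀ * p₀ + (s₁ * p₁ + (s₂ * p₂ + (s₃ * p₃ + 0ℤ)))) - s₀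
unrot-identity = solve-∀

rot-polytope : ∀ F v p → Polytope F v p → Polytope (rotF F) v (rotP p)
rot-polytope F v (p₀ ∷ p₁ ∷ p₂ ∷ p₃ ∷ []) (inBP bd fl) = inBP
  (λ { (s₀ ∷ s₁ ∷ s₂ ∷ s₃ ∷ []) →
    subst₂ _≤_ (sym (rot-identity p₀ p₁ p₂ p₃ (bit s₀) (bit s₁) (bit s₂) (bit s₃))) (sym (rotF-at F s₀ s₁ s₂ s₃ v))
           (ℤ.+-monoˡ-≤ (bit s₀) (bd (s₁ ∷ s₂ ∷ s₃ ∷ s₀ ∷ []))) })
  (trans (rot-identity p₀ p₁ p₂ p₃ 1ℤ 1ℤ 1ℤ 1ℤ) (trans (cong (_+ 1ℤ) fl) (sym (rotF-at F true true true true v))))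

unrot-polytope : ∀ F v q → Polytope (rotF F) v q → Polytope F v (unrotP q)
unrot-polytope F v (p₀ ∷ p₁ ∷ p₂ ∷ p₃ ∷ []) (inBP bd fl) = inBP
  (λ { (s₁ ∷ s₂ ∷ s₃ ∷ s₀ ∷ []) →
    subst₂ _≤_ (sym (unrot-identity p₀ p₁ p₂ p₃ (bit s₀) (bit s₁) (bit s₂) (bit s₃))) (cancelled s₀ s₁ s₂ s₃)
           (ℤ.+-monoˡ-≤ (- bit s₀) (bd (s₀ ∷ s₁ ∷ s₂ ∷ s₃ ∷ []))) })
  (trans (unrot-identity p₀ p₁ p₂ p₃ 1ℤ 1ℤ 1ℤ 1ℤ) (trans (cong (_- 1ℤ) fl) (cancelled true true true true)))
  where
  cancel : ∀ f c → (f + c) - c ≡ f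
  cancel = solve-∀
  cancelled : ∀ s₀ s₁ s₂ s₃ → rotF F (s₀ ∷ s₁ ∷ s₂ ∷ s₃ ∷ []) at (1 ∷ v) - bit s₀ ≡ F (s₁ ∷ s₂ ∷ s₃ ∷ s₀ ∷ []) at (1 ∷ v)
  cancelled s₀ s₁ s₂ s₃ = trans (cong (_- bit s₀) (rotF-at F s₀ s₁ s₂ s₃ v)) (cancel (F (s₁ ∷ s₂ ∷ s₃ ∷ s₀ ∷ []) at (1 ∷ v)) (bit s₀))

next-identity : ∀ p r κ → + 4 * p + (r + κ) ≡ + 4 * p + ((1ℤ + r) + (κ - 1ℤ))
next-identity = solve-∀

wrap-identity : ∀ p κ → + 4 * p + (+ 3 + κ) ≡ + 4 * (p + 1ℤ) + (0ℤ + (κ - 1ℤ))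
wrap-identity = solve-∀

-- The values themselves do not change. Lowering the offset by one raises each label by one, and
-- label 3 wraps around to 0 while its coordinate grows by one.
chart-rot : ∀ κ p w → Chart κ p w → Chart (κ - 1ℤ) (rotP p) w
chart-rot κ (p₀ ∷ p₁ ∷ p₂ ∷ p₃ ∷ []) w ch zero                   = let i , e = ch (# 3) in i , trans e (wrap-identity p₃ κ)
chart-rot κ (p₀ ∷ p₁ ∷ p₂ ∷ p₃ ∷ []) w ch (suc zero)             = let i , e = ch (# 0) in i , trans e (next-identity p₀ (+ 0) κ)
chart-rot κ (p₀ ∷ p₁ ∷ p₂ ∷ p₃ ∷ []) w ch (suc (suc zero))       = let i , e = ch (# 1) in i , trans e (next-identity p₁ (+ 1) κ)
chart-rot κ (p₀ ∷ p₁ ∷ p₂ ∷ p₃ ∷ []) w ch (suc (suc (suc zero))) = let i , e = ch (# 2) in i , trans e (next-identity p₂ (+ 2) κ)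

unwrap-identity : ∀ p κ → + 4 * p + (0ℤ + (κ - 1ℤ)) ≡ + 4 * (p - 1ℤ) + (+ 3 + κ)
unwrap-identity = solve-∀

chart-unrot : ∀ κ p w → Chart (κ - 1ℤ) p w → Chart κ (unrotP p) w
chart-unrot κ (p₀ ∷ p₁ ∷ p₂ ∷ p₃ ∷ []) w ch zero                   = let i , e = ch (# 1) in i , trans e (sym (next-identity p₁ (+ 0) κ))
chart-unrot κ (p₀ ∷ p₁ ∷ p₂ ∷ p₃ ∷ []) w ch (suc zero)             = let i , e = ch (# 2) in i , trans e (sym (next-identity p₂ (+ 1) κ))
chart-unrot κ (p₀ ∷ p₁ ∷ p₂ ∷ p₃ ∷ []) w ch (suc (suc zero))       = let i , e = ch (# 3) in i , trans e (sym (next-identity p₃ (+ 2) κ))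
chart-unrot κ (p₀ ∷ p₁ ∷ p₂ ∷ p₃ ∷ []) w ch (suc (suc (suc zero))) = let i , e = ch (# 0) in i , trans e (unwrap-identity p₀ κ)

next : Fin 4 → Fin 4
next zero                   = # 1
next (suc zero)             = # 2
next (suc (suc zero))       = # 3
next (suc (suc (suc zero))) = # 0

next-carry : Fin 4 → ℤ
next-carry (suc (suc (suc zero))) = 1ℤ
next-carry _                      = 0ℤ

rotC : (Fin 4 → Fin 4) → (Fin 4 → Form 4) → Fin 4 → Form 4
rotC τ C i = C i ⊞ constant (next-carry (τ i))

interval-rot : ∀ {κ v F τ C} → Interval κ v F τ C → Interval (κ - 1ℤ) v (rotF F) (next ∘ τ) (rotC τ C)
interval-rot {κ} {v} {F} {τ} {C} I = record
  { θ       = θ I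
  ; θ-InW   = θ-InW I
  ; b-θ     = λ i → trans (b-θ I i) (trans (advance (C i at (1 ∷ v)) (τ i))
                (cong (λ c → + 4 * c + (+ toℕ (next (τ i)) + (κ - 1ℤ)))
                      (sym (trans (at-⊞ (C i) (constant (next-carry (τ i))) (1 ∷ v))
                                  (cong (λ u → C i at (1 ∷ v) + u) (constant-at (next-carry (τ i)) v))))))
  ; below-θ = λ w →
      (λ le → let p , P , ch = proj₁ (below-θ I w) le in rotP p , rot-polytope F v p P , chart-rot κ p w ch) ,
      (λ (q , Q , ch) → proj₂ (below-θ I w) (unrotP q , unrot-polytope F v q Q , chart-unrot κ q w ch))
  }
  where
  next-spec : ∀ r → + toℕ r + 1ℤ ≡ + toℕ (next r) + + 4 * next-carry r
  next-spec = from-yes (Fin.all? λ r → + toℕ r + 1ℤ ℤ.≟ + toℕ (next r) + + 4 * next-carry r)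
  before : ∀ c r κ → + 4 * c + (r + κ) ≡ + 4 * c + ((r + 1ℤ) + (κ - 1ℤ))
  before = solve-∀
  after : ∀ c r k κ → + 4 * c + ((r + + 4 * k) + κ) ≡ + 4 * (c + k) + (r + κ)
  after = solve-∀
  advance : ∀ c r → + 4 * c + (+ toℕ r + κ) ≡ + 4 * (c + next-carry r) + (+ toℕ (next r) + (κ - 1ℤ))
  advance c r = trans (before c (+ toℕ r) κ)
    (trans (cong (λ u → + 4 * c + (u + (κ - 1ℤ))) (next-spec r)) (after c (+ toℕ (next r)) (next-carry r) (κ - 1ℤ)))

interval-resp : ∀ {κ v F τ C κ′ v′ F′ τ′ C′} → κ ≡ κ′ → (∀ S → F S at (1 ∷ v) ≡ F′ S at (1 ∷ v′)) →
                (∀ i → τ i ≡ τ′ i) → (∀ i → C i at (1 ∷ v) ≡ C′ i at (1 ∷ v′)) →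
                Interval κ v F τ C → Interval κ′ v′ F′ τ′ C′
interval-resp {κ} refl eF eτ eC I = record
  { θ       = θ I
  ; θ-InW   = θ-InW I
  ; b-θ     = λ i → trans (b-θ I i) (cong₂ (λ c r → + 4 * c + (+ toℕ r + κ)) (eC i) (eτ i))
  ; below-θ = λ w →
      (λ le → let p , P , ch = proj₁ (below-θ I w) le in p , BP-resp eF P , ch) ,
      (λ (q , Q , ch) → proj₂ (below-θ I w) (q , BP-resp (sym ∘ eF) Q , ch))
  }

-- formOf D is the support function of Conv(W λ) + Conv(D ∪ {0}) on 0/1-vectors,
-- as a form in the coordinates of λ; the point 0 of D is the seed of the fold.
support : List (Vec ℤ 4) → Subset 4 → ℤ
support D S = List.foldr (λ d m → ⟪ d , S ⟫ ⊔ m) 0ℤ D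

-- Sum of the k largest coordinates of λ, in the integral normalisation (x + y + z, y + z, z, 0).
Λ : ℕ → Form 3
Λ 0 = 0ℤ ∷ 0ℤ  ∷ 0ℤ  ∷ []
Λ 1 = 1ℤ ∷ 1ℤ  ∷ 1ℤ  ∷ []
Λ 2 = 1ℤ ∷ + 2 ∷ + 2 ∷ []
Λ _ = 1ℤ ∷ + 2 ∷ + 3 ∷ []

formOf : List (Vec ℤ 4) → Forms
formOf D S = support D S ∷ Λ (card S)

-- The six alcoves of a box and the ways out of it

record Shape : Set where
  field
    points : List (Vec ℤ 4)
    resid  : Fin 4 → Fin 4
    coord  : Fin 4 → Form 4

open Shape public

-- The alcove of w₀ translated by λ: the labels are reversed as for w₀, and the coordinates are
-- those of λ in the normalisation of `Λ`.
shape₁ : Shape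
shape₁ = record
  { points = []
  ; resid  = Fin.opposite
  ; coord  = λ i → lookup ((0ℤ ∷ 1ℤ ∷ 1ℤ ∷ 1ℤ ∷ []) ∷ (0ℤ ∷ 0ℤ ∷ 1ℤ ∷ 1ℤ ∷ []) ∷ (0ℤ ∷ 0ℤ ∷ 0ℤ ∷ 1ℤ ∷ []) ∷ (0ℤ ∷ 0ℤ ∷ 0ℤ ∷ 0ℤ ∷ []) ∷ []) i
  }

-- The new point set D is prescribed, not computed; `Ascends` certifies that it is right.
stepShape : Fin 4 → List (Vec ℤ 4) → Shape → Shape
stepShape r D A = record { points = D ; resid = permGen r ∘ resid A ; coord = stepC r (resid A) (coord A) }

ShapeInterval : Shape → ℤ → Vec ℕ 3 → Set
ShapeInterval A κ v = Interval κ v (formOf (points A)) (resid A) (coord A)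

Ascends : Fin 4 → List (Vec ℤ 4) → Shape → Set
Ascends r D A = Covers r (formOf (points A)) (formOf D) ×
  ∃[ i ] ∃[ j ] (resid A i ≡ prev r × resid A j ≡ r × constant 1ℤ ≼ gapForm (resid A) (coord A) i j)

ascends? : ∀ r D A → Dec (Ascends r D A)
ascends? r D A = covers? r (formOf (points A)) (formOf D) ×-dec Fin.any? λ i → Fin.any? λ j →
  (resid A i Fin.≟ prev r) ×-dec (resid A j Fin.≟ r) ×-dec (constant 1ℤ ≼? gapForm (resid A) (coord A) i j)

shape-step : ∀ r D A → Ascends r D A → ∀ {κ v} → ShapeInterval A κ v → ShapeInterval (stepShape r D A) κ v
shape-step r D A (cov , i , j , at-i , at-j , gap) = interval-step r i j at-i at-j gap cov

e₀₁ e₀₂ e₀₃ e₁₂ e₁₃ e₂₁ e₂₃ e₀₁₂₃ : Vec ℤ 4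
e₀₁   = 1ℤ ∷ -1ℤ ∷ 0ℤ  ∷ 0ℤ  ∷ []
e₀₂   = 1ℤ ∷ 0ℤ  ∷ -1ℤ ∷ 0ℤ  ∷ []
e₀₃   = 1ℤ ∷ 0ℤ  ∷ 0ℤ  ∷ -1ℤ ∷ []
e₁₂   = 0ℤ ∷ 1ℤ  ∷ -1ℤ ∷ 0ℤ  ∷ []
e₁₃   = 0ℤ ∷ 1ℤ  ∷ 0ℤ  ∷ -1ℤ ∷ []
e₂₁   = 0ℤ ∷ -1ℤ ∷ 1ℤ  ∷ 0ℤ  ∷ []
e₂₃   = 0ℤ ∷ 0ℤ  ∷ 1ℤ  ∷ -1ℤ ∷ []
e₀₁₂₃ = 1ℤ ∷ 1ℤ  ∷ -1ℤ ∷ -1ℤ ∷ []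

shape₂ shape₃ shape₄ shape₅ shape₆ : Shape
shape₂ = stepShape (# 0) (e₀₃ ∷ []) shape₁
shape₃ = stepShape (# 1) (e₀₃ ∷ e₁₃ ∷ []) shape₂
shape₄ = stepShape (# 3) (e₀₃ ∷ e₀₂ ∷ []) shape₂
shape₅ = stepShape (# 3) (e₀₃ ∷ e₁₃ ∷ e₀₂ ∷ e₁₂ ∷ []) shape₃
shape₆ = stepShape (# 2) (e₀₃ ∷ e₁₃ ∷ e₀₂ ∷ e₁₂ ∷ e₂₃ ∷ e₀₁ ∷ e₂₁ ∷ []) shape₅

-- Together with 0 the points are all e_i - e_3 for `exit₁`, all e_i + e_j - e_2 - e_3 with i ≠ j
-- for `exit₂`, and all e_0 - e_i for `exit₃`: translates of the orbits of ϖ₁, ϖ₂, ϖ₃.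
exit₁ exit₂ exit₃ : Shape
exit₁ = stepShape (# 2) (e₀₃ ∷ e₁₃ ∷ e₂₃ ∷ []) shape₃
exit₂ = stepShape (# 0) (e₀₃ ∷ e₁₃ ∷ e₀₂ ∷ e₁₂ ∷ e₀₁₂₃ ∷ []) shape₅
exit₃ = stepShape (# 2) (e₀₃ ∷ e₀₂ ∷ e₀₁ ∷ []) shape₄

-- Forced by the sum of the four values: it is 0 + 1 + 2 + 3 = 6 for every element of W_aff, and 4
-- (x + 2y + 3z) + 6 + 4κ in a chart.
κ : Vec ℕ 3 → ℤ
κ (x ∷ y ∷ z ∷ []) = - (+ x + + 2 * + y + + 3 * + z)

raise : Fin 3 → Vec ℕ 3 → Vec ℕ 3
raise zero             (x ∷ y ∷ z ∷ []) = suc x ∷ y ∷ z ∷ []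
raise (suc zero)       (x ∷ y ∷ z ∷ []) = x ∷ suc y ∷ z ∷ []
raise (suc (suc zero)) (x ∷ y ∷ z ∷ []) = x ∷ y ∷ suc z ∷ []

-- The substitution of λ + ϖ_k for λ, carried out on coefficients so that the entry into the next
-- box is an equality of forms.
bump : Fin 3 → Form 4 → Form 4
bump k (c ∷ F) = c + lookup F k ∷ F

bump-at : ∀ k F v → bump k F at (1 ∷ v) ≡ F at (1 ∷ raise k v)
bump-at zero (c ∷ a ∷ b ∷ d ∷ []) (x ∷ y ∷ z ∷ []) = identity c a b d (+ x) (+ y) (+ z)
  where
  identity : ∀ c a b d x y z → (c + a) * 1ℤ + (a * x + (b * y + (d * z + 0ℤ))) ≡ c * 1ℤ + (a * (1ℤ + x) + (b * y + (d * z + 0ℤ)))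
  identity = solve-∀
bump-at (suc zero) (c ∷ a ∷ b ∷ d ∷ []) (x ∷ y ∷ z ∷ []) = identity c a b d (+ x) (+ y) (+ z)
  where
  identity : ∀ c a b d x y z → (c + b) * 1ℤ + (a * x + (b * y + (d * z + 0ℤ))) ≡ c * 1ℤ + (a * x + (b * (1ℤ + y) + (d * z + 0ℤ)))
  identity = solve-∀
bump-at (suc (suc zero)) (c ∷ a ∷ b ∷ d ∷ []) (x ∷ y ∷ z ∷ []) = identity c a b d (+ x) (+ y) (+ z)
  where
  identity : ∀ c a b d x y z → (c + d) * 1ℤ + (a * x + (b * y + (d * z + 0ℤ))) ≡ c * 1ℤ + (a * x + (b * y + (d * (1ℤ + z) + 0ℤ)))
  identity = solve-∀

_atWeight_ : Shape → Vec ℕ 3 → Set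
A atWeight v = ShapeInterval A (κ v) v

enter-box : ∀ k {F τ C} → (∀ S → F S ≡ bump k (formOf [] S)) → (∀ i → τ i ≡ resid shape₁ i) → (∀ i → C i ≡ bump k (coord shape₁ i)) →
            ∀ {κ′ v} → κ′ ≡ κ (raise k v) → Interval κ′ v F τ C → shape₁ atWeight raise k v
enter-box k eF eτ eC {v = v} eκ = interval-resp eκ
  (λ S → trans (cong (_at (1 ∷ v)) (eF S)) (bump-at k (formOf [] S) v))
  eτ
  (λ i → trans (cong (_at (1 ∷ v)) (eC i)) (bump-at k (coord shape₁ i) v))

-- Passing to λ + ϖ_k lowers κ by k, hence k rotations in the k-th of these modules. They also undo
-- the translation of the polytope, and `eF` confirms this on all sixteen subsets.
module Exit₁ where

  F : Forms
  F = rotF (formOf (points exit₁))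

  τ : Fin 4 → Fin 4
  τ = next ∘ resid exit₁

  C : Fin 4 → Form 4
  C = rotC (resid exit₁) (coord exit₁)

  eF : ∀ S → F S ≡ bump (# 0) (formOf [] S)
  eF = from-yes (∀Subset? λ S → F S ≟F bump (# 0) (formOf [] S))

  eτ : ∀ i → τ i ≡ resid shape₁ i
  eτ = from-yes (Fin.all? λ i → τ i Fin.≟ resid shape₁ i)

  eC : ∀ i → C i ≡ bump (# 0) (coord shape₁ i)
  eC = from-yes (Fin.all? λ i → C i ≟F bump (# 0) (coord shape₁ i))

  eκ : ∀ v → κ v - 1ℤ ≡ κ (raise (# 0) v)
  eκ (x ∷ y ∷ z ∷ []) = identity (+ x) (+ y) (+ z)
    where
    identity : ∀ x y z → - (x + + 2 * y + + 3 * z) - 1ℤ ≡ - ((1ℤ + x) + + 2 * y + + 3 * z)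
    identity = solve-∀

  rotated-interval : ∀ v → shape₃ atWeight v → Interval (κ v - 1ℤ) v F τ C
  rotated-interval v I = interval-rot (shape-step (# 2) (points exit₁) shape₃ (from-yes (ascends? (# 2) (points exit₁) shape₃)) I)

  enter : ∀ v → shape₃ atWeight v → shape₁ atWeight raise (# 0) v
  enter v I = enter-box (# 0) eF eτ eC (eκ v) (rotated-interval v I)

module Exit₂ where

  F : Forms
  F = rotF (rotF (formOf (points exit₂)))

  τ : Fin 4 → Fin 4
  τ = next ∘ next ∘ resid exit₂

  C : Fin 4 → Form 4
  C = rotC (next ∘ resid exit₂) (rotC (resid exit₂) (coord exit₂))

  eF : ∀ S → F S ≡ bump (# 1) (formOf [] S)
  eF = from-yes (∀Subset? λ S → F S ≟F bump (# 1) (formOf [] S))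

  eτ : ∀ i → τ i ≡ resid shape₁ i
  eτ = from-yes (Fin.all? λ i → τ i Fin.≟ resid shape₁ i)

  eC : ∀ i → C i ≡ bump (# 1) (coord shape₁ i)
  eC = from-yes (Fin.all? λ i → C i ≟F bump (# 1) (coord shape₁ i))

  eκ : ∀ v → κ v - 1ℤ - 1ℤ ≡ κ (raise (# 1) v)
  eκ (x ∷ y ∷ z ∷ []) = identity (+ x) (+ y) (+ z)
    where
    identity : ∀ x y z → - (x + + 2 * y + + 3 * z) - 1ℤ - 1ℤ ≡ - (x + + 2 * (1ℤ + y) + + 3 * z)
    identity = solve-∀

  rotated-interval : ∀ v → shape₅ atWeight v → Interval (κ v - 1ℤ - 1ℤ) v F τ C
  rotated-interval v I = interval-rot (interval-rot (shape-step (# 0) (points exit₂) shape₅ (from-yes (ascends? (# 0) (points exit₂) shape₅)) I))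

  enter : ∀ v → shape₅ atWeight v → shape₁ atWeight raise (# 1) v
  enter v I = enter-box (# 1) eF eτ eC (eκ v) (rotated-interval v I)

module Exit₃ where

  F : Forms
  F = rotF (rotF (rotF (formOf (points exit₃))))

  τ : Fin 4 → Fin 4
  τ = next ∘ next ∘ next ∘ resid exit₃

  C : Fin 4 → Form 4
  C = rotC (next ∘ next ∘ resid exit₃) (rotC (next ∘ resid exit₃) (rotC (resid exit₃) (coord exit₃)))

  eF : ∀ S → F S ≡ bump (# 2) (formOf [] S)
  eF = from-yes (∀Subset? λ S → F S ≟F bump (# 2) (formOf [] S))

  eτ : ∀ i → τ i ≡ resid shape₁ i
  eτ = from-yes (Fin.all? λ i → τ i Fin.≟ resid shape₁ i)

  eC : ∀ i → C i ≡ bump (# 2) (coord shape₁ i)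
  eC = from-yes (Fin.all? λ i → C i ≟F bump (# 2) (coord shape₁ i))

  eκ : ∀ v → κ v - 1ℤ - 1ℤ - 1ℤ ≡ κ (raise (# 2) v)
  eκ (x ∷ y ∷ z ∷ []) = identity (+ x) (+ y) (+ z)
    where
    identity : ∀ x y z → - (x + + 2 * y + + 3 * z) - 1ℤ - 1ℤ - 1ℤ ≡ - (x + + 2 * y + + 3 * (1ℤ + z))
    identity = solve-∀

  rotated-interval : ∀ v → shape₄ atWeight v → Interval (κ v - 1ℤ - 1ℤ - 1ℤ) v F τ C
  rotated-interval v I = interval-rot (interval-rot (interval-rot (shape-step (# 2) (points exit₃) shape₄ (from-yes (ascends? (# 2) (points exit₃) shape₄)) I)))

  enter : ∀ v → shape₄ atWeight v → shape₁ atWeight raise (# 2) v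
  enter v I = enter-box (# 2) eF eτ eC (eκ v) (rotated-interval v I)

interval₂ : ∀ v → shape₁ atWeight v → shape₂ atWeight v
interval₂ v = shape-step (# 0) (points shape₂) shape₁ (from-yes (ascends? (# 0) (points shape₂) shape₁))

interval₃ : ∀ v → shape₂ atWeight v → shape₃ atWeight v
interval₃ v = shape-step (# 1) (points shape₃) shape₂ (from-yes (ascends? (# 1) (points shape₃) shape₂))

interval₄ : ∀ v → shape₂ atWeight v → shape₄ atWeight v
interval₄ v = shape-step (# 3) (points shape₄) shape₂ (from-yes (ascends? (# 3) (points shape₄) shape₂))

interval₅ : ∀ v → shape₃ atWeight v → shape₅ atWeight v
interval₅ v = shape-step (# 3) (points shape₅) shape₃ (from-yes (ascends? (# 3) (points shape₅) shape₃))

interval₆ : ∀ v → shape₅ atWeight v → shape₆ atWeight v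
interval₆ v = shape-step (# 2) (points shape₆) shape₅ (from-yes (ascends? (# 2) (points shape₆) shape₅))

-- The base case: the interval below w₀ is W_f

Lists : Aff → List Aff → Set
Lists θ L = ∀ w → Below θ w ⟺ (w ∈ L)

-- Repetitions are allowed, because only membership in these lists matters.
grow : Fin 4 → List Aff → List Aff
grow s L = L ++ List.map (_∘A gen s) L

lists-∘gen : ∀ {θ L} s → BruhatStep θ (θ ∘A gen s) → Lists θ L → Lists (θ ∘A gen s) (grow s L)
lists-∘gen {θ} {L} s ascent lists w = into ∘ proj₁ (below-∘gen {θ} {s} ascent w) , proj₂ (below-∘gen {θ} {s} ascent w) ∘ outof ∘ ∈.∈-++⁻ L
  where
  into : Below θ w ⊎ Below θ (w ∘A gen s) → w ∈ grow s L
  into (inj₁ le) = ∈.∈-++⁺ˡ (proj₁ (lists w) le)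
  into (inj₂ le) = ∈.∈-++⁺ʳ L (subst (_∈ List.map (_∘A gen s) L) (∘gen-involutive w s) (∈.∈-map⁺ (_∘A gen s) (proj₁ (lists (w ∘A gen s)) le)))
  outof : w ∈ L ⊎ w ∈ List.map (_∘A gen s) L → Below θ w ⊎ Below θ (w ∘A gen s)
  outof (inj₁ mem) = inj₁ (proj₂ (lists w) mem)
  outof (inj₂ mem) = let u , u∈L , e = ∈.∈-map⁻ (_∘A gen s) mem in
    inj₂ (subst (Below θ) (sym (trans (cong (_∘A gen s) e) (∘gen-involutive u s))) (proj₂ (lists u) u∈L))

Climbs : Aff → Fin 4 → Set
Climbs θ s = ∃[ i ] ∃[ j ] (lookup (perm θ) i ≡ prev s × lookup (perm θ) j ≡ s × 0ℤ < b θ i - b θ j + 1ℤ + + toℕ j - + toℕ i)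

climbs? : ∀ θ s → Dec (Climbs θ s)
climbs? θ s = Fin.any? λ i → Fin.any? λ j →
  (lookup (perm θ) i Fin.≟ prev s) ×-dec (lookup (perm θ) j Fin.≟ s) ×-dec (0ℤ ℤ.<? b θ i - b θ j + 1ℤ + + toℕ j - + toℕ i)

climb : ∀ θ L s → Climbs θ s → InW θ × Lists θ L → InW (θ ∘A gen s) × Lists (θ ∘A gen s) (grow s L)
climb θ L s (i , j , pi , pj , lt) (Wθ , lists) =
  InW-∘gen s Wθ , lists-∘gen {θ} {L} s (ascend {θ} {s} {i} {j} Wθ pi pj lt) lists

finiteWeyl : List Aff
finiteWeyl = grow (# 1) (grow (# 2) (grow (# 3) (grow (# 1) (grow (# 2) (grow (# 1) (idA ∷ []))))))

-- Each letter of s₁ s₂ s₁ s₃ s₂ s₁ is an ascent, so the interval is built up from the identity in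
-- six doublings.
w₀-lists : InW w₀ × Lists w₀ finiteWeyl
w₀-lists = climb u₅ L₅ (# 1) (from-yes (climbs? u₅ (# 1))) c₅
  where
  u₁ = idA ∘A gen (# 1)
  u₂ = u₁ ∘A gen (# 2)
  u₃ = u₂ ∘A gen (# 1)
  u₄ = u₃ ∘A gen (# 3)
  u₅ = u₄ ∘A gen (# 2)
  L₀ = idA ∷ []
  L₁ = grow (# 1) L₀
  L₂ = grow (# 2) L₁
  L₃ = grow (# 1) L₂
  L₄ = grow (# 3) L₃
  L₅ = grow (# 2) L₄
  c₀ : InW idA × Lists idA L₀
  c₀ = ([] , refl) , λ w → (λ le → here (proj₁ (below-id w) le)) , λ { (here e) → proj₂ (below-id w) e }
  c₁ : InW u₁ × Lists u₁ L₁
  c₁ = climb idA L₀ (# 1) (from-yes (climbs? idA (# 1))) c₀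
  c₂ : InW u₂ × Lists u₂ L₂
  c₂ = climb u₁ L₁ (# 2) (from-yes (climbs? u₁ (# 2))) c₁
  c₃ : InW u₃ × Lists u₃ L₃
  c₃ = climb u₂ L₂ (# 1) (from-yes (climbs? u₂ (# 1))) c₂
  c₄ : InW u₄ × Lists u₄ L₄
  c₄ = climb u₃ L₃ (# 3) (from-yes (climbs? u₃ (# 3))) c₃
  c₅ : InW u₅ × Lists u₅ L₅
  c₅ = climb u₄ L₄ (# 2) (from-yes (climbs? u₄ (# 2))) c₄

origin : Vec ℤ 4
origin = Vec.replicate 4 0ℤ

-- Each coordinate is bounded above by the bound at its singleton and below by the one at the
-- complementary triple, since the total is 0.
polytope-origin : ∀ p → Polytope (formOf []) (0 ∷ 0 ∷ 0 ∷ []) p → p ≡ origin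
polytope-origin (a ∷ b ∷ c ∷ d ∷ []) P = vec-≡
  (ℤ.≤-antisym (≤-by (≤⇒0≤ (bounds P (true ∷ false ∷ false ∷ false ∷ [])) ∷ []) (upper₀ a b c d))
               (≤-by (≤⇒0≤ (bounds P (false ∷ true ∷ true ∷ true ∷ [])) ∷ ≡⇒0≤ (sym (full P)) ∷ []) (lower₀ a b c d)) ,
   ℤ.≤-antisym (≤-by (≤⇒0≤ (bounds P (false ∷ true ∷ false ∷ false ∷ [])) ∷ []) (upper₁ a b c d))
               (≤-by (≤⇒0≤ (bounds P (true ∷ false ∷ true ∷ true ∷ [])) ∷ ≡⇒0≤ (sym (full P)) ∷ []) (lower₁ a b c d)) ,
   ℤ.≤-antisym (≤-by (≤⇒0≤ (bounds P (false ∷ false ∷ true ∷ false ∷ [])) ∷ []) (upper₂ a b c d))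
               (≤-by (≤⇒0≤ (bounds P (true ∷ true ∷ false ∷ true ∷ [])) ∷ ≡⇒0≤ (sym (full P)) ∷ []) (lower₂ a b c d)) ,
   ℤ.≤-antisym (≤-by (≤⇒0≤ (bounds P (false ∷ false ∷ false ∷ true ∷ [])) ∷ []) (upper₃ a b c d))
               (≤-by (≤⇒0≤ (bounds P (true ∷ true ∷ true ∷ false ∷ [])) ∷ ≡⇒0≤ (sym (full P)) ∷ []) (lower₃ a b c d)))
  where
  vec-≡ : ∀ {a b c d} → a ≡ 0ℤ × b ≡ 0ℤ × c ≡ 0ℤ × d ≡ 0ℤ → a ∷ b ∷ c ∷ d ∷ [] ≡ origin
  vec-≡ (refl , refl , refl , refl) = refl
  upper₀ : ∀ a b c d → (0ℤ - (1ℤ * a + (0ℤ * b + (0ℤ * c + (0ℤ * d + 0ℤ))))) + 0ℤ ≡ 0ℤ - a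
  upper₀ = solve-∀
  lower₀ : ∀ a b c d → (0ℤ - (0ℤ * a + (1ℤ * b + (1ℤ * c + (1ℤ * d + 0ℤ))))) + (((1ℤ * a + (1ℤ * b + (1ℤ * c + (1ℤ * d + 0ℤ)))) - 0ℤ) + 0ℤ) ≡ a - 0ℤ
  lower₀ = solve-∀
  upper₁ : ∀ a b c d → (0ℤ - (0ℤ * a + (1ℤ * b + (0ℤ * c + (0ℤ * d + 0ℤ))))) + 0ℤ ≡ 0ℤ - b
  upper₁ = solve-∀
  lower₁ : ∀ a b c d → (0ℤ - (1ℤ * a + (0ℤ * b + (1ℤ * c + (1ℤ * d + 0ℤ))))) + (((1ℤ * a + (1ℤ * b + (1ℤ * c + (1ℤ * d + 0ℤ)))) - 0ℤ) + 0ℤ) ≡ b - 0ℤ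
  lower₁ = solve-∀
  upper₂ : ∀ a b c d → (0ℤ - (0ℤ * a + (0ℤ * b + (1ℤ * c + (0ℤ * d + 0ℤ))))) + 0ℤ ≡ 0ℤ - c
  upper₂ = solve-∀
  lower₂ : ∀ a b c d → (0ℤ - (1ℤ * a + (1ℤ * b + (0ℤ * c + (1ℤ * d + 0ℤ))))) + (((1ℤ * a + (1ℤ * b + (1ℤ * c + (1ℤ * d + 0ℤ)))) - 0ℤ) + 0ℤ) ≡ c - 0ℤ
  lower₂ = solve-∀
  upper₃ : ∀ a b c d → (0ℤ - (0ℤ * a + (0ℤ * b + (0ℤ * c + (1ℤ * d + 0ℤ))))) + 0ℤ ≡ 0ℤ - d
  upper₃ = solve-∀
  lower₃ : ∀ a b c d → (0ℤ - (1ℤ * a + (1ℤ * b + (1ℤ * c + (0ℤ * d + 0ℤ))))) + (((1ℤ * a + (1ℤ * b + (1ℤ * c + (1ℤ * d + 0ℤ)))) - 0ℤ) + 0ℤ) ≡ d - 0ℤ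
  lower₃ = solve-∀

open DecMembership _≟A_ using (_∈?_)

permutation-∈finiteWeyl : ∀ i₀ i₁ i₂ i₃ → let π = i₀ ∷ i₁ ∷ i₂ ∷ i₃ ∷ [] in
  (∀ r → ∃[ i ] lookup π i ≡ r) → aff π origin ∈ finiteWeyl
permutation-∈finiteWeyl = from-yes (Fin.all? λ i₀ → Fin.all? λ i₁ → Fin.all? λ i₂ → Fin.all? λ i₃ →
  let π = i₀ ∷ i₁ ∷ i₂ ∷ i₃ ∷ [] in (Fin.all? λ r → Fin.any? λ i → lookup π i Fin.≟ r) →-dec (aff π origin ∈? finiteWeyl))

finiteWeyl-chart : All (Chart 0ℤ origin) finiteWeyl
finiteWeyl-chart = from-yes (All.all? (λ w → Fin.all? λ r → Fin.any? λ i → b w i ℤ.≟ + 4 * lookup origin r + (+ toℕ r + 0ℤ)) finiteWeyl)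

chart-finiteWeyl : ∀ w → Chart 0ℤ origin w → w ∈ finiteWeyl
chart-finiteWeyl w@(aff π@(i₀ ∷ i₁ ∷ i₂ ∷ i₃ ∷ []) t) ch =
  subst (λ t → aff π t ∈ finiteWeyl) (sym t≡0) (permutation-∈finiteWeyl i₀ i₁ i₂ i₃ λ r → let i , e = ch r in i , proj₁ (coordinates i r e))
  where
  identity : ∀ r → + 4 * 0ℤ + (r + 0ℤ) ≡ r + + 4 * 0ℤ
  identity = solve-∀
  coordinates : ∀ i r → b w i ≡ + 4 * lookup origin r + (+ toℕ r + 0ℤ) → lookup π i ≡ r × lookup t i ≡ 0ℤ
  coordinates i r e = euclid-unique (lookup π i) r (lookup t i) 0ℤ
    (trans e (trans (cong (λ u → + 4 * u + (+ toℕ r + 0ℤ)) (Vec.lookup-replicate r 0ℤ)) (identity (+ toℕ r))))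
  t≡0 : t ≡ origin
  t≡0 = lookup-injective λ i → let r , e = chart-surjective 0ℤ origin w ch i in
    trans (proj₂ (coordinates i r e)) (sym (Vec.lookup-replicate i 0ℤ))

interval-base : shape₁ atWeight (0 ∷ 0 ∷ 0 ∷ [])
interval-base = record
  { θ       = w₀
  ; θ-InW   = proj₁ w₀-lists
  ; b-θ     = from-yes (Fin.all? λ i → b w₀ i ℤ.≟ + 4 * (coord shape₁ i at (1 ∷ 0 ∷ 0 ∷ 0 ∷ [])) + (+ toℕ (resid shape₁ i) + 0ℤ))
  ; below-θ = λ w →
      (λ le → origin , origin-inside , All.lookup finiteWeyl-chart (proj₁ (proj₂ w₀-lists w) le)) ,
      (λ (p , P , ch) → proj₂ (proj₂ w₀-lists w) (chart-finiteWeyl w (subst (λ p → Chart 0ℤ p w) (polytope-origin p P) ch)))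
  }
  where
  origin-inside : Polytope (formOf []) (0 ∷ 0 ∷ 0 ∷ []) origin
  origin-inside = inBP (from-yes (∀Subset? λ S → ⟪ origin , S ⟫ ℤ.≤? formOf [] S at (1 ∷ 0 ∷ 0 ∷ 0 ∷ []))) refl

abstract
  next-x : ∀ x y z → shape₁ atWeight (x ∷ y ∷ z ∷ []) → shape₁ atWeight (suc x ∷ y ∷ z ∷ [])
  next-x x y z I = Exit₁.enter (x ∷ y ∷ z ∷ []) (interval₃ (x ∷ y ∷ z ∷ []) (interval₂ (x ∷ y ∷ z ∷ []) I))

  next-y : ∀ x y z → shape₁ atWeight (x ∷ y ∷ z ∷ []) → shape₁ atWeight (x ∷ suc y ∷ z ∷ [])
  next-y x y z I = Exit₂.enter (x ∷ y ∷ z ∷ []) (interval₅ (x ∷ y ∷ z ∷ []) (interval₃ (x ∷ y ∷ z ∷ []) (interval₂ (x ∷ y ∷ z ∷ []) I)))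

  next-z : ∀ x y z → shape₁ atWeight (x ∷ y ∷ z ∷ []) → shape₁ atWeight (x ∷ y ∷ suc z ∷ [])
  next-z x y z I = Exit₃.enter (x ∷ y ∷ z ∷ []) (interval₄ (x ∷ y ∷ z ∷ []) (interval₂ (x ∷ y ∷ z ∷ []) I))

interval-z : ∀ z → shape₁ atWeight (0 ∷ 0 ∷ z ∷ [])
interval-z zero    = interval-base
interval-z (suc z) = next-z 0 0 z (interval-z z)

interval-yz : ∀ y z → shape₁ atWeight (0 ∷ y ∷ z ∷ [])
interval-yz zero    z = interval-z z
interval-yz (suc y) z = next-y 0 y z (interval-yz y z)

interval₁ : ∀ x y z → shape₁ atWeight (x ∷ y ∷ z ∷ [])
interval₁ zero    y z = interval-yz y z
interval₁ (suc x) y z = next-x x y z (interval₁ x y z)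

shape : Fin 6 → Shape
shape zero                               = shape₁
shape (suc zero)                         = shape₂
shape (suc (suc zero))                   = shape₃
shape (suc (suc (suc zero)))             = shape₄
shape (suc (suc (suc (suc zero))))       = shape₅
shape (suc (suc (suc (suc (suc zero))))) = shape₆

interval : ∀ a x y z → shape a atWeight (x ∷ y ∷ z ∷ [])
interval zero                               x y z = interval₁ x y z
interval (suc zero)                         x y z = interval₂ (x ∷ y ∷ z ∷ []) (interval₁ x y z)
interval (suc (suc zero))                   x y z = interval₃ (x ∷ y ∷ z ∷ []) (interval₂ (x ∷ y ∷ z ∷ []) (interval₁ x y z))
interval (suc (suc (suc zero)))             x y z = interval₄ (x ∷ y ∷ z ∷ []) (interval₂ (x ∷ y ∷ z ∷ []) (interval₁ x y z))
interval (suc (suc (suc (suc zero))))       x y z = interval₅ (x ∷ y ∷ z ∷ []) (interval₃ (x ∷ y ∷ z ∷ []) (interval₂ (x ∷ y ∷ z ∷ []) (interval₁ x y z)))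
interval (suc (suc (suc (suc (suc zero))))) x y z = interval₆ (x ∷ y ∷ z ∷ []) (interval₅ (x ∷ y ∷ z ∷ []) (interval₃ (x ∷ y ∷ z ∷ []) (interval₂ (x ∷ y ∷ z ∷ []) (interval₁ x y z))))

-- Counting the lattice points

HasCard : {A : Set} → (A → Set) → ℕ → Set
HasCard P n = ∃[ L ] (Unique L × (∀ x → (x ∈ L) ⟺ P x) × length L ≡ n)

Unique-⊆-length : ∀ {A : Set} {L L′ : List A} → Unique L → (∀ {x} → x ∈ L → x ∈ L′) → length L ℕ.≤ length L′
Unique-⊆-length []          sub = ℕ.z≤n
Unique-⊆-length {L = x ∷ L} (x∉ ∷ u) sub with ∈.∈-∃++ (sub (here refl))
... | ys , zs , refl = subst (suc (length L) ℕ.≤_) (sym (List.length-++-sucʳ ys x zs))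
    (ℕ.s≤s (Unique-⊆-length u (λ y∈L → remove (All.lookup x∉ y∈L) (∈.∈-++⁻ ys (sub (there y∈L))))))
  where
  remove : ∀ {y} → x ≢ y → y ∈ ys ⊎ y ∈ (x ∷ zs) → y ∈ (ys ++ zs)
  remove x≢y (inj₁ y∈)           = ∈.∈-++⁺ˡ y∈
  remove x≢y (inj₂ (here y≡x))   = contradiction (sym y≡x) x≢y
  remove x≢y (inj₂ (there y∈))   = ∈.∈-++⁺ʳ ys y∈

Unique-length : ∀ {A : Set} {P : A → Set} {L L′ : List A} → Unique L → Unique L′ →
                (∀ x → (x ∈ L) ⟺ P x) → (∀ x → (x ∈ L′) ⟺ P x) → length L ≡ length L′
Unique-length u u′ m m′ = ℕ.≤-antisym
  (Unique-⊆-length u (λ {x} x∈ → proj₂ (m′ x) (proj₁ (m x) x∈)))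
  (Unique-⊆-length u′ (λ {x} x∈ → proj₂ (m x) (proj₁ (m′ x) x∈)))

card-⇔ : ∀ {A : Set} {P Q : A → Set} {n} → (∀ x → P x ⟺ Q x) → HasCard P n → HasCard Q n
card-⇔ eq (L , u , mem , len) = L , u , (λ x → proj₁ (eq x) ∘ proj₁ (mem x) , proj₂ (mem x) ∘ proj₂ (eq x)) , len

card-image : ∀ {A B : Set} {P : A → Set} {n} (f : A → B) → (∀ {x y} → f x ≡ f y → x ≡ y) →
             HasCard P n → HasCard (λ y → ∃[ x ] (P x × y ≡ f x)) n
card-image f inj (L , u , mem , len) = List.map f L , Unique.map⁺ inj u ,
  (λ y → (λ y∈ → let x , x∈ , e = ∈.∈-map⁻ f y∈ in x , proj₁ (mem x) x∈ , e) ,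
         (λ { (x , Px , refl) → ∈.∈-map⁺ f (proj₂ (mem x) Px) })) ,
  trans (List.length-map f L) len

card-empty : ∀ {A : Set} {P : A → Set} → (∀ x → ¬ P x) → HasCard P 0
card-empty none = [] , [] , (λ x → (λ ()) , λ Px → contradiction Px (none x)) , refl

card-⊎ : ∀ {A : Set} {P Q : A → Set} {m n} → (∀ x → P x → Q x → ⊥) → HasCard P m → HasCard Q n → HasCard (λ x → P x ⊎ Q x) (m ℕ.+ n)
card-⊎ disjoint (L , u , mem , refl) (L′ , u′ , mem′ , refl) = L ++ L′ ,
  Unique.++⁺ u u′ (λ {x} (x∈ , x∈′) → disjoint x (proj₁ (mem x) x∈) (proj₁ (mem′ x) x∈′)) ,
  (λ x → (λ x∈ → Data.Sum.map (proj₁ (mem x)) (proj₁ (mem′ x)) (∈.∈-++⁻ L x∈)) ,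
         (λ { (inj₁ Px) → ∈.∈-++⁺ˡ (proj₂ (mem x) Px) ; (inj₂ Qx) → ∈.∈-++⁺ʳ L (proj₂ (mem′ x) Qx) })) ,
  List.length-++ L

card-segment : ∀ a n → HasCard (λ j → a ℕ.≤ j × j ℕ.< a ℕ.+ n) n
card-segment a n = List.applyUpTo (a ℕ.+_) n ,
  Unique.applyUpTo⁺₁ (a ℕ.+_) n (λ i<j _ e → ℕ.<⇒≢ i<j (ℕ.+-cancelˡ-≡ a _ _ e)) ,
  (λ j → (λ j∈ → let i , i<n , e = ∈.∈-applyUpTo⁻ (a ℕ.+_) j∈ in
            subst (λ j → a ℕ.≤ j × j ℕ.< a ℕ.+ n) (sym e) (ℕ.m≤m+n a i , ℕ.+-monoʳ-< a i<n)) ,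
         (λ (a≤j , j<) → subst (_∈ List.applyUpTo (a ℕ.+_) n) (ℕ.m+[n∸m]≡n a≤j)
            (∈.∈-applyUpTo⁺ (a ℕ.+_) (ℕ.+-cancelˡ-< a (j ℕ.∸ a) n (subst (ℕ._< a ℕ.+ n) (sym (ℕ.m+[n∸m]≡n a≤j)) j<))))) ,
  List.length-applyUpTo (a ℕ.+_) n

-- Sums of cardinalities, and the lattice points of a truncated triangle

sumTo : ℕ → (ℕ → ℤ) → ℤ
sumTo zero    e = 0ℤ
sumTo (suc n) e = e 0 + sumTo n (e ∘ suc)

-- The factor c keeps the formulas integral: the sizes of the slices are polynomials only after
-- doubling.
card-sum : ∀ {A : Set} c n (P : ℕ → A → Set) (e : ℕ → ℤ) → (∀ {i j} x → P i x → P j x → i ≡ j) →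
           (∀ i → i ℕ.< n → ∃[ m ] (HasCard (P i) m × c * + m ≡ e i)) →
           ∃[ m ] (HasCard (λ x → ∃[ i ] (i ℕ.< n × P i x)) m × c * + m ≡ sumTo n e)
card-sum c zero    P e disjoint cards = 0 , card-empty (λ { _ (_ , () , _) }) , ℤ.*-zeroʳ c
card-sum c (suc n) P e disjoint cards =
  let m , C , eq = cards 0 (ℕ.s≤s ℕ.z≤n)
      m′ , C′ , eq′ = card-sum c n (P ∘ suc) (e ∘ suc) (λ x p q → ℕ.suc-injective (disjoint x p q)) (λ i i<n → cards (suc i) (ℕ.s≤s i<n))
  in m ℕ.+ m′ , card-⇔ merge (card-⊎ (λ { x p (i , _ , q) → ℕ.0≢1+n (disjoint x p q) }) C C′) ,
     trans (ℤ.*-distribˡ-+ c (+ m) (+ m′)) (cong₂ _+_ eq eq′)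
  where
  merge : ∀ x → (P 0 x ⊎ ∃[ i ] (i ℕ.< n × P (suc i) x)) ⟺ (∃[ i ] (i ℕ.< suc n × P i x))
  merge x = (λ { (inj₁ p) → 0 , ℕ.s≤s ℕ.z≤n , p ; (inj₂ (i , i<n , p)) → suc i , ℕ.s≤s i<n , p }) ,
            (λ { (zero , _ , p) → inj₁ p ; (suc i , ℕ.s≤s i<n , p) → inj₂ (i , i<n , p) })

-- The triangle i, j ≥ 0, i + j ≤ n with its corners (n,0), (0,n), (0,0) cut off by o₀, o₁, o₂.
Hex : ℕ → ℕ → ℕ → ℕ → ℕ × ℕ → Set
Hex n o₀ o₁ o₂ (i , j) = i ℕ.+ o₀ ℕ.≤ n × j ℕ.+ o₁ ℕ.≤ n × i ℕ.+ j ℕ.≤ n × o₂ ℕ.≤ i ℕ.+ j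

-- With K = n + 1 the summand is twice the size of the row at i. As o₁ and o₂ are at most m, the
-- truncated differences run through full triangular numbers; the corner o₀ enters only through the
-- range m = n + 1 - o₀.
sum-trapezoid : ∀ m K o₁ o₂ → o₁ ℕ.≤ m → o₂ ℕ.≤ m →
  sumTo m (λ i → + 2 * (K - + i - + (o₁ ℕ.∸ i) - + (o₂ ℕ.∸ i))) ≡
  + 2 * K * + m - + m * (+ m - 1ℤ) - + o₁ * (+ o₁ + 1ℤ) - + o₂ * (+ o₂ + 1ℤ)
sum-trapezoid zero    K zero     zero     _          _          = base K
  where
  base : ∀ K → 0ℤ ≡ + 2 * K * 0ℤ - 0ℤ * (0ℤ - 1ℤ) - 0ℤ * (0ℤ + 1ℤ) - 0ℤ * (0ℤ + 1ℤ)
  base = solve-∀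
sum-trapezoid (suc m) K o₁       o₂       le₁        le₂        =
  trans (cong₂ _+_ (head K (+ o₁) (+ o₂)) (trans (tail m (λ i → K - + suc i - + (o₁ ℕ.∸ suc i) - + (o₂ ℕ.∸ suc i)) _ same)
                             (sum-trapezoid m (K - 1ℤ) (ℕ.pred o₁) (ℕ.pred o₂) (ℕ.pred-mono-≤ le₁) (ℕ.pred-mono-≤ le₂))))
        (trans (cong₂ (λ u v → + 2 * (K - + o₁ - + o₂) + (+ 2 * (K - 1ℤ) * + m - + m * (+ m - 1ℤ) - u - v)) (pred-triangle o₁) (pred-triangle o₂))
               (combine K (+ m) (+ o₁) (+ o₂)))
  where
  head : ∀ K a b → + 2 * (K - 0ℤ - a - b) ≡ + 2 * (K - a - b)
  head = solve-∀
  tail : ∀ m (f g : ℕ → ℤ) → (∀ i → f i ≡ g i) → sumTo m (λ i → + 2 * f i) ≡ sumTo m (λ i → + 2 * g i)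
  tail zero    f g e = refl
  tail (suc m) f g e = cong₂ (λ u v → + 2 * u + v) (e 0) (tail m (f ∘ suc) (g ∘ suc) (e ∘ suc))
  shift-K : ∀ K i a b → K - (1ℤ + i) - a - b ≡ (K - 1ℤ) - i - a - b
  shift-K = solve-∀
  pred-∸ : ∀ o i → o ℕ.∸ suc i ≡ ℕ.pred o ℕ.∸ i
  pred-∸ zero    zero    = refl
  pred-∸ zero    (suc i) = refl
  pred-∸ (suc o) i       = refl
  same : ∀ i → K - + suc i - + (o₁ ℕ.∸ suc i) - + (o₂ ℕ.∸ suc i) ≡ (K - 1ℤ) - + i - + (ℕ.pred o₁ ℕ.∸ i) - + (ℕ.pred o₂ ℕ.∸ i)
  same i = trans (shift-K K (+ i) (+ (o₁ ℕ.∸ suc i)) (+ (o₂ ℕ.∸ suc i)))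
                 (cong₂ (λ a b → (K - 1ℤ) - + i - + a - + b) (pred-∸ o₁ i) (pred-∸ o₂ i))
  lower : ∀ o → o * (o + 1ℤ) ≡ (1ℤ + o) * ((1ℤ + o) + 1ℤ) - + 2 * (1ℤ + o)
  lower = solve-∀
  pred-triangle : ∀ o → + ℕ.pred o * (+ ℕ.pred o + 1ℤ) ≡ + o * (+ o + 1ℤ) - + 2 * + o
  pred-triangle zero    = refl
  pred-triangle (suc o) = lower (+ o)
  combine : ∀ K m a b → + 2 * (K - a - b) + (+ 2 * (K - 1ℤ) * m - m * (m - 1ℤ) - (a * (a + 1ℤ) - + 2 * a) - (b * (b + 1ℤ) - + 2 * b)) ≡
                        + 2 * K * (1ℤ + m) - (1ℤ + m) * ((1ℤ + m) - 1ℤ) - a * (a + 1ℤ) - b * (b + 1ℤ)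
  combine = solve-∀

∸-max-≤ : ∀ i o {K} → i ℕ.≤ K → o ℕ.≤ K → i ℕ.+ (o ℕ.∸ i) ℕ.≤ K
∸-max-≤ zero    o       _          q = q
∸-max-≤ (suc i) zero    p          _ = ℕ.≤-trans (ℕ.≤-reflexive (ℕ.+-identityʳ (suc i))) p
∸-max-≤ (suc i) (suc o) (ℕ.s≤s p) (ℕ.s≤s q) = ℕ.s≤s (∸-max-≤ i o p q)

-- Makes the length of a row an honest difference. According to the position of i, the left side is
-- max(i, o₁), max(i, o₂) or o₁ + o₂ - i, each at most K.
row-≤ : ∀ i o₁ o₂ {K} → i ℕ.≤ K → o₁ ℕ.≤ K → o₂ ℕ.≤ K → o₁ ℕ.+ o₂ ℕ.≤ K → i ℕ.+ (o₁ ℕ.∸ i) ℕ.+ (o₂ ℕ.∸ i) ℕ.≤ K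
row-≤ zero    o₁       o₂       _ _ _ r = r
row-≤ (suc i) zero     o₂       p _ q _ = ℕ.≤-trans (ℕ.≤-reflexive (cong (ℕ._+ (o₂ ℕ.∸ suc i)) (ℕ.+-identityʳ (suc i)))) (∸-max-≤ (suc i) o₂ p q)
row-≤ (suc i) (suc o₁) zero     p q _ _ = ℕ.≤-trans (ℕ.≤-reflexive (ℕ.+-identityʳ (suc i ℕ.+ (o₁ ℕ.∸ i)))) (∸-max-≤ (suc i) (suc o₁) p q)
row-≤ (suc i) (suc o₁) (suc o₂) (ℕ.s≤s p) (ℕ.s≤s q) (ℕ.s≤s r) (ℕ.s≤s t) = ℕ.s≤s (row-≤ i o₁ o₂ p q r (ℕ.≤-trans (ℕ.+-monoʳ-≤ o₁ (ℕ.n≤1+n o₂)) t))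

hex-card : ∀ n o₀ o₁ o₂ → o₀ ℕ.+ o₁ ℕ.≤ n → o₀ ℕ.+ o₂ ℕ.≤ n → o₁ ℕ.+ o₂ ℕ.≤ n →
  ∃[ h ] (HasCard (Hex n o₀ o₁ o₂) h ×
          + 2 * + h ≡ (+ n + 1ℤ) * (+ n + + 2) - + o₀ * (+ o₀ + 1ℤ) - + o₁ * (+ o₁ + 1ℤ) - + o₂ * (+ o₂ + 1ℤ))
hex-card n o₀ o₁ o₂ le₀₁ le₀₂ le₁₂ =
  let h , C , eq = card-sum (+ 2) m Row e (λ { x (refl , _) (refl , _) → refl }) rows in
  h , card-⇔ merge C , trans eq (trans (sum-trapezoid m (+ suc n) o₁ o₂ o₁≤m o₂≤m) closed)
  where
  o₀≤n : o₀ ℕ.≤ n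
  o₀≤n = ℕ.m+n≤o⇒m≤o o₀ le₀₁
  m = suc n ℕ.∸ o₀
  m+o₀ : m ℕ.+ o₀ ≡ suc n
  m+o₀ = ℕ.m∸n+n≡m (ℕ.m≤n⇒m≤1+n o₀≤n)
  ≤m : ∀ {o} → o₀ ℕ.+ o ℕ.≤ n → o ℕ.≤ m
  ≤m {o} le = ℕ.m+n≤o⇒m≤o∸n o (ℕ.≤-trans (ℕ.≤-reflexive (ℕ.+-comm o o₀)) (ℕ.m≤n⇒m≤1+n le))
  o₁≤m = ≤m le₀₁
  o₂≤m = ≤m le₀₂
  e : ℕ → ℤ
  e i = + 2 * (+ suc n - + i - + (o₁ ℕ.∸ i) - + (o₂ ℕ.∸ i))
  Row : ℕ → ℕ × ℕ → Set
  Row i (i′ , j) = i′ ≡ i × Hex n o₀ o₁ o₂ (i′ , j)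
  <m⇒ : ∀ {i} → i ℕ.< m → i ℕ.+ o₀ ℕ.≤ n
  <m⇒ {i} i<m = ℕ.s≤s⁻¹ (ℕ.≤-trans (ℕ.+-monoˡ-≤ o₀ i<m) (ℕ.≤-reflexive m+o₀))
  ⇒<m : ∀ {i} → i ℕ.+ o₀ ℕ.≤ n → i ℕ.< m
  ⇒<m {i} le = ℕ.m+n≤o⇒m≤o∸n (suc i) (ℕ.s≤s le)
  merge : ∀ x → (∃[ i ] (i ℕ.< m × Row i x)) ⟺ Hex n o₀ o₁ o₂ x
  merge (i , j) = (λ { (_ , _ , refl , hex) → hex }) , (λ hex → i , ⇒<m (proj₁ hex) , refl , hex)
  closed′ : ∀ m o₀ a b N → N ≡ m + o₀ → + 2 * N * m - m * (m - 1ℤ) - a - b ≡ N * (N + 1ℤ) - o₀ * (o₀ + 1ℤ) - a - b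
  closed′ m o₀ a b N e = trans (cong (λ N → + 2 * N * m - m * (m - 1ℤ) - a - b) e)
    (trans (identity m o₀ a b) (cong (λ N → N * (N + 1ℤ) - o₀ * (o₀ + 1ℤ) - a - b) (sym e)))
    where
    identity : ∀ m o a b → + 2 * (m + o) * m - m * (m - 1ℤ) - a - b ≡ (m + o) * ((m + o) + 1ℤ) - o * (o + 1ℤ) - a - b
    identity = solve-∀
  next-n : ∀ n o a b → (1ℤ + n) * ((1ℤ + n) + 1ℤ) - o - a - b ≡ (n + 1ℤ) * (n + + 2) - o - a - b
  next-n = solve-∀
  closed : + 2 * + suc n * + m - + m * (+ m - 1ℤ) - + o₁ * (+ o₁ + 1ℤ) - + o₂ * (+ o₂ + 1ℤ) ≡
           (+ n + 1ℤ) * (+ n + + 2) - + o₀ * (+ o₀ + 1ℤ) - + o₁ * (+ o₁ + 1ℤ) - + o₂ * (+ o₂ + 1ℤ)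
  closed = trans (closed′ (+ m) (+ o₀) (+ o₁ * (+ o₁ + 1ℤ)) (+ o₂ * (+ o₂ + 1ℤ)) (+ suc n) (cong +_ (sym m+o₀)))
                 (next-n (+ n) (+ o₀ * (+ o₀ + 1ℤ)) (+ o₁ * (+ o₁ + 1ℤ)) (+ o₂ * (+ o₂ + 1ℤ)))
  rows : ∀ i → i ℕ.< m → ∃[ k ] (HasCard (Row i) k × + 2 * + k ≡ e i)
  rows i i<m = k , card-⇔ row (card-image (i ,_) (cong proj₂) (card-segment (o₂ ℕ.∸ i) k)) , cong (+ 2 *_) k≡
    where
    used = i ℕ.+ (o₁ ℕ.∸ i) ℕ.+ (o₂ ℕ.∸ i)
    k = suc n ℕ.∸ used
    i≤n : i ℕ.≤ n
    i≤n = ℕ.m+n≤o⇒m≤o i (<m⇒ i<m)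
    used≤ : used ℕ.≤ suc n
    used≤ = ℕ.m≤n⇒m≤1+n (row-≤ i o₁ o₂ i≤n (ℕ.m+n≤o⇒m≤o o₁ le₁₂) (ℕ.m+n≤o⇒n≤o o₁ le₁₂) le₁₂)
    k+used : k ℕ.+ used ≡ suc n
    k+used = ℕ.m∸n+n≡m used≤
    rearrange : ∀ k i a b → k ≡ (k + (i + a + b)) - i - a - b
    rearrange = solve-∀
    k≡ : + k ≡ + suc n - + i - + (o₁ ℕ.∸ i) - + (o₂ ℕ.∸ i)
    k≡ = trans (rearrange (+ k) (+ i) (+ (o₁ ℕ.∸ i)) (+ (o₂ ℕ.∸ i)))
               (cong (λ u → + u - + i - + (o₁ ℕ.∸ i) - + (o₂ ℕ.∸ i)) k+used)
    end : (o₂ ℕ.∸ i) ℕ.+ k ℕ.+ (i ℕ.+ (o₁ ℕ.∸ i)) ≡ suc n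
    end = trans (reorder (o₂ ℕ.∸ i) k (i ℕ.+ (o₁ ℕ.∸ i))) k+used
      where
      reorder : ∀ a k c → a ℕ.+ k ℕ.+ c ≡ k ℕ.+ (c ℕ.+ a)
      reorder a k c = trans (cong (ℕ._+ c) (ℕ.+-comm a k)) (trans (ℕ.+-assoc k a c) (cong (k ℕ.+_) (ℕ.+-comm a c)))
    row : ∀ x → (∃[ j ] (((o₂ ℕ.∸ i) ℕ.≤ j × j ℕ.< (o₂ ℕ.∸ i) ℕ.+ k) × x ≡ (i , j))) ⟺ Row i x
    row (i′ , j) = (λ { (_ , (lo , hi) , refl) → refl , <m⇒ i<m , fits lo hi }) ,
                   (λ { (refl , _ , j+o₁≤n , i+j≤n , o₂≤) → j , (ℕ.m≤n+o⇒m∸n≤o o₂ i o₂≤ , top j+o₁≤n i+j≤n) , refl })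
      where
      fits : (o₂ ℕ.∸ i) ℕ.≤ j → j ℕ.< (o₂ ℕ.∸ i) ℕ.+ k → j ℕ.+ o₁ ℕ.≤ n × i ℕ.+ j ℕ.≤ n × o₂ ℕ.≤ i ℕ.+ j
      fits lo hi =
        ℕ.≤-trans (ℕ.+-monoʳ-≤ j (ℕ.m≤n+m∸n o₁ i)) bound ,
        ℕ.≤-trans (ℕ.≤-reflexive (ℕ.+-comm i j)) (ℕ.≤-trans (ℕ.+-monoʳ-≤ j (ℕ.m≤m+n i (o₁ ℕ.∸ i))) bound) ,
        ℕ.≤-trans (ℕ.m≤n+m∸n o₂ i) (ℕ.+-monoʳ-≤ i lo)
        where
        bound : j ℕ.+ (i ℕ.+ (o₁ ℕ.∸ i)) ℕ.≤ n
        bound = ℕ.s≤s⁻¹ (ℕ.≤-trans (ℕ.+-monoˡ-≤ (i ℕ.+ (o₁ ℕ.∸ i)) hi) (ℕ.≤-reflexive end))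
      top : j ℕ.+ o₁ ℕ.≤ n → i ℕ.+ j ℕ.≤ n → j ℕ.< (o₂ ℕ.∸ i) ℕ.+ k
      top j+o₁≤n i+j≤n = ℕ.+-cancelʳ-≤ (i ℕ.+ (o₁ ℕ.∸ i)) (suc j) ((o₂ ℕ.∸ i) ℕ.+ k) (ℕ.≤-trans (ℕ.s≤s bound) (ℕ.≤-reflexive (sym end)))
        where
        bound : j ℕ.+ (i ℕ.+ (o₁ ℕ.∸ i)) ℕ.≤ n
        bound = subst (j ℕ.+ (i ℕ.+ (o₁ ℕ.∸ i)) ℕ.≤_) (ℕ.m+[n∸m]≡n j≤n) (ℕ.+-monoʳ-≤ j
          (∸-max-≤ i o₁ (ℕ.m+n≤o⇒m≤o∸n i i+j≤n) (ℕ.m+n≤o⇒m≤o∸n o₁ (subst (ℕ._≤ n) (ℕ.+-comm j o₁) j+o₁≤n))))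
          where
          j≤n : j ℕ.≤ n
          j≤n = ℕ.m+n≤o⇒m≤o j j+o₁≤n

-- The substitution i = p₀ - (s - g₁₂), j = p₁ - (s - g₀₂) turns the bounds on pairs into i, j ≥ 0
-- and i + j ≤ N, and the bound on the singleton r into the cut of size O_r.
module Triangle (g : Subset 3 → ℤ) where

  g₀ g₁ g₂ g₀₁ g₀₂ g₁₂ s N O₀ O₁ O₂ : ℤ
  g₀  = g (true ∷ false ∷ false ∷ [])
  g₁  = g (false ∷ true ∷ false ∷ [])
  g₂  = g (false ∷ false ∷ true ∷ [])
  g₀₁ = g (true ∷ true ∷ false ∷ [])
  g₀₂ = g (true ∷ false ∷ true ∷ [])
  g₁₂ = g (false ∷ true ∷ true ∷ [])
  s   = g (true ∷ true ∷ true ∷ [])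
  N   = g₁₂ + g₀₂ + g₀₁ - + 2 * s
  O₀  = g₀₂ + g₀₁ - s - g₀
  O₁  = g₁₂ + g₀₁ - s - g₁
  O₂  = g₁₂ + g₀₂ - s - g₂

  record Truncated : Set where
    constructor truncated
    field
      empty : 0ℤ ≤ g (false ∷ false ∷ false ∷ [])
      pos₀  : 0ℤ ≤ O₀
      pos₁  : 0ℤ ≤ O₁
      pos₂  : 0ℤ ≤ O₂
      sep₀₁ : O₀ + O₁ ≤ N
      sep₀₂ : O₀ + O₂ ≤ N
      sep₁₂ : O₁ + O₂ ≤ N

private
  inside-100 : ∀ g₀ g₁ g₂ g₀₁ g₀₂ g₁₂ s i j → ((g₁₂ + g₀₂ + g₀₁ - + 2 * s) - (i + (g₀₂ + g₀₁ - s - g₀))) + 0ℤ ≡ g₀ - (1ℤ * ((s - g₁₂) + i) + (0ℤ * ((s - g₀₂) + j) + (0ℤ * (s - ((s - g₁₂) + i) - ((s - g₀₂) + j)) + 0ℤ)))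
  inside-100 = solve-∀
  inside-010 : ∀ g₀ g₁ g₂ g₀₁ g₀₂ g₁₂ s i j → ((g₁₂ + g₀₂ + g₀₁ - + 2 * s) - (j + (g₁₂ + g₀₁ - s - g₁))) + 0ℤ ≡ g₁ - (0ℤ * ((s - g₁₂) + i) + (1ℤ * ((s - g₀₂) + j) + (0ℤ * (s - ((s - g₁₂) + i) - ((s - g₀₂) + j)) + 0ℤ)))
  inside-010 = solve-∀
  inside-001 : ∀ g₀ g₁ g₂ g₀₁ g₀₂ g₁₂ s i j → (i + j - (g₁₂ + g₀₂ - s - g₂)) + 0ℤ ≡ g₂ - (0ℤ * ((s - g₁₂) + i) + (0ℤ * ((s - g₀₂) + j) + (1ℤ * (s - ((s - g₁₂) + i) - ((s - g₀₂) + j)) + 0ℤ)))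
  inside-001 = solve-∀
  inside-110 : ∀ g₀ g₁ g₂ g₀₁ g₀₂ g₁₂ s i j → ((g₁₂ + g₀₂ + g₀₁ - + 2 * s) - (i + j)) + 0ℤ ≡ g₀₁ - (1ℤ * ((s - g₁₂) + i) + (1ℤ * ((s - g₀₂) + j) + (0ℤ * (s - ((s - g₁₂) + i) - ((s - g₀₂) + j)) + 0ℤ)))
  inside-110 = solve-∀
  inside-101 : ∀ g₀ g₁ g₂ g₀₁ g₀₂ g₁₂ s i j → (j - 0ℤ) + 0ℤ ≡ g₀₂ - (1ℤ * ((s - g₁₂) + i) + (0ℤ * ((s - g₀₂) + j) + (1ℤ * (s - ((s - g₁₂) + i) - ((s - g₀₂) + j)) + 0ℤ)))
  inside-101 = solve-∀
  inside-011 : ∀ g₀ g₁ g₂ g₀₁ g₀₂ g₁₂ s i j → (i - 0ℤ) + 0ℤ ≡ g₁₂ - (0ℤ * ((s - g₁₂) + i) + (1ℤ * ((s - g₀₂) + j) + (1ℤ * (s - ((s - g₁₂) + i) - ((s - g₀₂) + j)) + 0ℤ)))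
  inside-011 = solve-∀
  inside-full : ∀ g₀ g₁ g₂ g₀₁ g₀₂ g₁₂ s i j → (1ℤ * ((s - g₁₂) + i) + (1ℤ * ((s - g₀₂) + j) + (1ℤ * (s - ((s - g₁₂) + i) - ((s - g₀₂) + j)) + 0ℤ))) ≡ s
  inside-full = solve-∀
  outside-011 : ∀ g₀ g₁ g₂ g₀₁ g₀₂ g₁₂ s a b c → (g₁₂ - (0ℤ * a + (1ℤ * b + (1ℤ * c + 0ℤ)))) + (((1ℤ * a + (1ℤ * b + (1ℤ * c + 0ℤ))) - s) + 0ℤ) ≡ (a - (s - g₁₂)) - 0ℤ
  outside-011 = solve-∀
  outside-101 : ∀ g₀ g₁ g₂ g₀₁ g₀₂ g₁₂ s a b c → (g₀₂ - (1ℤ * a + (0ℤ * b + (1ℤ * c + 0ℤ)))) + (((1ℤ * a + (1ℤ * b + (1ℤ * c + 0ℤ))) - s) + 0ℤ) ≡ (b - (s - g₀₂)) - 0ℤ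
  outside-101 = solve-∀
  outside-100 : ∀ g₀ g₁ g₂ g₀₁ g₀₂ g₁₂ s a b c → (g₀ - (1ℤ * a + (0ℤ * b + (0ℤ * c + 0ℤ)))) + 0ℤ ≡ (g₁₂ + g₀₂ + g₀₁ - + 2 * s) - ((a - (s - g₁₂)) + (g₀₂ + g₀₁ - s - g₀))
  outside-100 = solve-∀
  outside-010 : ∀ g₀ g₁ g₂ g₀₁ g₀₂ g₁₂ s a b c → (g₁ - (0ℤ * a + (1ℤ * b + (0ℤ * c + 0ℤ)))) + 0ℤ ≡ (g₁₂ + g₀₂ + g₀₁ - + 2 * s) - ((b - (s - g₀₂)) + (g₁₂ + g₀₁ - s - g₁))
  outside-010 = solve-∀
  outside-110 : ∀ g₀ g₁ g₂ g₀₁ g₀₂ g₁₂ s a b c → (g₀₁ - (1ℤ * a + (1ℤ * b + (0ℤ * c + 0ℤ)))) + 0ℤ ≡ (g₁₂ + g₀₂ + g₀₁ - + 2 * s) - ((a - (s - g₁₂)) + (b - (s - g₀₂)))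
  outside-110 = solve-∀
  outside-001 : ∀ g₀ g₁ g₂ g₀₁ g₀₂ g₁₂ s a b c → (g₂ - (0ℤ * a + (0ℤ * b + (1ℤ * c + 0ℤ)))) + ((1ℤ * a + (1ℤ * b + (1ℤ * c + 0ℤ))) - s + 0ℤ) ≡ ((a - (s - g₁₂)) + (b - (s - g₀₂))) - (g₁₂ + g₀₂ - s - g₂)
  outside-001 = solve-∀

toNat : ∀ {u} → 0ℤ ≤ u → ∃[ n ] + n ≡ u
toNat {u} p = ∣ u ∣ , ℤ.0≤i⇒+∣i∣≡i p

-- The polygon is a triangle of size N with corners of sizes O₀, O₁, O₂ cut off.
triangle-card : ∀ (g : Subset 3 → ℤ) → let open Triangle g in Truncated →
  ∃[ h ] (HasCard (_∈BP g) h × + 2 * + h ≡ (N + 1ℤ) * (N + + 2) - O₀ * (O₀ + 1ℤ) - O₁ * (O₁ + 1ℤ) - O₂ * (O₂ + 1ℤ))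
triangle-card g T =
  let h , C , eq = hex-card n o₀ o₁ o₂ (nat-≤ e₀ e₁ sep₀₁) (nat-≤ e₀ e₂ sep₀₂) (nat-≤ e₁ e₂ sep₁₂) in
  h , card-⇔ shape⟺ (card-image φ φ-injective C) ,
  trans eq (value en e₀ e₁ e₂)
  where
  open Triangle g
  open Truncated T
  N≥0 : 0ℤ ≤ N
  N≥0 = ℤ.≤-trans (ℤ.+-mono-≤ pos₀ pos₁) sep₀₁
  n  = proj₁ (toNat N≥0)
  o₀ = proj₁ (toNat pos₀)
  o₁ = proj₁ (toNat pos₁)
  o₂ = proj₁ (toNat pos₂)
  en : + n ≡ N
  en = proj₂ (toNat N≥0)
  e₀ : + o₀ ≡ O₀
  e₀ = proj₂ (toNat pos₀)
  e₁ : + o₁ ≡ O₁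
  e₁ = proj₂ (toNat pos₁)
  e₂ : + o₂ ≡ O₂
  e₂ = proj₂ (toNat pos₂)
  nat-≤ : ∀ {a b A B} → + a ≡ A → + b ≡ B → A + B ≤ N → a ℕ.+ b ℕ.≤ n
  nat-≤ ea eb le = ℤ.drop‿+≤+ (subst₂ _≤_ (sym (cong₂ _+_ ea eb)) (sym en) le)
  value : ∀ {n o₀ o₁ o₂ N O₀ O₁ O₂} → n ≡ N → o₀ ≡ O₀ → o₁ ≡ O₁ → o₂ ≡ O₂ →
    (n + 1ℤ) * (n + + 2) - o₀ * (o₀ + 1ℤ) - o₁ * (o₁ + 1ℤ) - o₂ * (o₂ + 1ℤ) ≡ (N + 1ℤ) * (N + + 2) - O₀ * (O₀ + 1ℤ) - O₁ * (O₁ + 1ℤ) - O₂ * (O₂ + 1ℤ)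
  value refl refl refl refl = refl
  φ : ℕ × ℕ → Vec ℤ 3
  φ (i , j) = (s - g₁₂) + + i ∷ (s - g₀₂) + + j ∷ s - ((s - g₁₂) + + i) - ((s - g₀₂) + + j) ∷ []
  cancelˡ : ∀ c {i j} → c + + i ≡ c + + j → i ≡ j
  cancelˡ c e = ℤ.+-injective (GroupProperties.∙-cancelˡ (AbelianGroup.group ℤ.+-0-abelianGroup) c _ _ e)
  φ-injective : ∀ {x y} → φ x ≡ φ y → x ≡ y
  φ-injective e = cong₂ _,_ (cancelˡ (s - g₁₂) (cong (λ v → lookup v (# 0)) e)) (cancelˡ (s - g₀₂) (cong (λ v → lookup v (# 1)) e))
  into : ∀ i j → Hex n o₀ o₁ o₂ (i , j) → φ (i , j) ∈BP g
  into i j (i+o₀≤n , j+o₁≤n , i+j≤n , o₂≤i+j) = inBP inside (inside-full g₀ g₁ g₂ g₀₁ g₀₂ g₁₂ s (+ i) (+ j))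
    where
    h₀ : + i + O₀ ≤ N
    h₀ = subst₂ _≤_ (cong (λ o → + i + o) e₀) en (+≤+ i+o₀≤n)
    h₁ : + j + O₁ ≤ N
    h₁ = subst₂ _≤_ (cong (λ o → + j + o) e₁) en (+≤+ j+o₁≤n)
    h₀₁ : + i + + j ≤ N
    h₀₁ = subst (+ i + + j ≤_) en (+≤+ i+j≤n)
    h₂ : O₂ ≤ + i + + j
    h₂ = subst (_≤ + i + + j) e₂ (+≤+ o₂≤i+j)
    hi : 0ℤ ≤ + i
    hi = +≤+ ℕ.z≤n
    hj : 0ℤ ≤ + j
    hj = +≤+ ℕ.z≤n
    inside : ∀ S → ⟪ φ (i , j) , S ⟫ ≤ g S
    inside (false ∷ false ∷ false ∷ []) = empty
    inside (true ∷ true ∷ true ∷ []) = ℤ.≤-reflexive (inside-full g₀ g₁ g₂ g₀₁ g₀₂ g₁₂ s (+ i) (+ j))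
    inside (true ∷ false ∷ false ∷ []) = ≤-by (≤⇒0≤ h₀ ∷ []) (inside-100 g₀ g₁ g₂ g₀₁ g₀₂ g₁₂ s (+ i) (+ j))
    inside (false ∷ true ∷ false ∷ []) = ≤-by (≤⇒0≤ h₁ ∷ []) (inside-010 g₀ g₁ g₂ g₀₁ g₀₂ g₁₂ s (+ i) (+ j))
    inside (false ∷ false ∷ true ∷ []) = ≤-by (≤⇒0≤ h₂ ∷ []) (inside-001 g₀ g₁ g₂ g₀₁ g₀₂ g₁₂ s (+ i) (+ j))
    inside (true ∷ true ∷ false ∷ []) = ≤-by (≤⇒0≤ h₀₁ ∷ []) (inside-110 g₀ g₁ g₂ g₀₁ g₀₂ g₁₂ s (+ i) (+ j))
    inside (true ∷ false ∷ true ∷ []) = ≤-by (≤⇒0≤ hj ∷ []) (inside-101 g₀ g₁ g₂ g₀₁ g₀₂ g₁₂ s (+ i) (+ j))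
    inside (false ∷ true ∷ true ∷ []) = ≤-by (≤⇒0≤ hi ∷ []) (inside-011 g₀ g₁ g₂ g₀₁ g₀₂ g₁₂ s (+ i) (+ j))
  outof : ∀ p → p ∈BP g → ∃[ x ] (Hex n o₀ o₁ o₂ x × p ≡ φ x)
  outof (a ∷ b ∷ c ∷ []) (inBP bd fl) =
    (i , j) ,
    (ℤ.drop‿+≤+ (subst₂ _≤_ (sym (cong₂ _+_ ei e₀)) (sym en) (≤-by (≤⇒0≤ (bd (true ∷ false ∷ false ∷ [])) ∷ []) (outside-100 g₀ g₁ g₂ g₀₁ g₀₂ g₁₂ s a b c))) ,
     ℤ.drop‿+≤+ (subst₂ _≤_ (sym (cong₂ _+_ ej e₁)) (sym en) (≤-by (≤⇒0≤ (bd (false ∷ true ∷ false ∷ [])) ∷ []) (outside-010 g₀ g₁ g₂ g₀₁ g₀₂ g₁₂ s a b c))) ,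
     ℤ.drop‿+≤+ (subst₂ _≤_ (sym (cong₂ _+_ ei ej)) (sym en) (≤-by (≤⇒0≤ (bd (true ∷ true ∷ false ∷ [])) ∷ []) (outside-110 g₀ g₁ g₂ g₀₁ g₀₂ g₁₂ s a b c))) ,
     ℤ.drop‿+≤+ (subst₂ _≤_ (sym e₂) (sym (cong₂ _+_ ei ej)) (≤-by (≤⇒0≤ (bd (false ∷ false ∷ true ∷ [])) ∷ ≡⇒0≤ (sym fl) ∷ []) (outside-001 g₀ g₁ g₂ g₀₁ g₀₂ g₁₂ s a b c)))) ,
    point (sym ei) (sym ej) fl
    where
    i≥0 : 0ℤ ≤ a - (s - g₁₂)
    i≥0 = ≤-by (≤⇒0≤ (bd (false ∷ true ∷ true ∷ [])) ∷ ≡⇒0≤ (sym fl) ∷ []) (outside-011 g₀ g₁ g₂ g₀₁ g₀₂ g₁₂ s a b c)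
    j≥0 : 0ℤ ≤ b - (s - g₀₂)
    j≥0 = ≤-by (≤⇒0≤ (bd (true ∷ false ∷ true ∷ [])) ∷ ≡⇒0≤ (sym fl) ∷ []) (outside-101 g₀ g₁ g₂ g₀₁ g₀₂ g₁₂ s a b c)
    i = proj₁ (toNat i≥0)
    j = proj₁ (toNat j≥0)
    ei : + i ≡ a - (s - g₁₂)
    ei = proj₂ (toNat i≥0)
    ej : + j ≡ b - (s - g₀₂)
    ej = proj₂ (toNat j≥0)
    restore : ∀ a u → a ≡ u + (a - u)
    restore = solve-∀
    last : ∀ a b c → c ≡ (1ℤ * a + (1ℤ * b + (1ℤ * c + 0ℤ))) - a - b
    last = solve-∀
    vec₃ : ∀ {a b c a′ b′ c′ : ℤ} → a ≡ a′ → b ≡ b′ → c ≡ c′ → a ∷ b ∷ c ∷ [] ≡ a′ ∷ b′ ∷ c′ ∷ []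
    vec₃ refl refl refl = refl
    point : a - (s - g₁₂) ≡ + i → b - (s - g₀₂) ≡ + j → ⟪ a ∷ b ∷ c ∷ [] , ⊤ ⟫ ≡ s → a ∷ b ∷ c ∷ [] ≡ φ (i , j)
    point ea eb ef = vec₃ a≡ b≡ (trans (last a b c) (trans (cong (λ u → u - a - b) ef) (cong₂ (λ a b → s - a - b) a≡ b≡)))
      where
      a≡ : a ≡ (s - g₁₂) + + i
      a≡ = trans (restore a (s - g₁₂)) (cong (λ u → (s - g₁₂) + u) ea)
      b≡ : b ≡ (s - g₀₂) + + j
      b≡ = trans (restore b (s - g₀₂)) (cong (λ u → (s - g₀₂) + u) eb)
  shape⟺ : ∀ p → (∃[ x ] (Hex n o₀ o₁ o₂ x × p ≡ φ x)) ⟺ (p ∈BP g)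
  shape⟺ p = (λ { (x , hex , refl) → into (proj₁ x) (proj₂ x) hex }) , outof p

-- Slices of the polytope

evalC : Form 5 → Vec ℕ 3 → ℤ → ℤ
evalC (k ∷ L) v c = k * c + L at (1 ∷ v)

_⊟_ : ∀ {n} → Form n → Form n → Form n
A ⊟ B = A ⊞ Vec.map (-1ℤ *_) B

infixl 6 _⊟_

evalC-⊞ : ∀ A B v c → evalC (A ⊞ B) v c ≡ evalC A v c + evalC B v c
evalC-⊞ (k ∷ L) (k′ ∷ L′) v c = trans (cong (λ u → (k + k′) * c + u) (at-⊞ L L′ (1 ∷ v))) (identity k k′ c (L at (1 ∷ v)) (L′ at (1 ∷ v)))
  where
  identity : ∀ k k′ c u u′ → (k + k′) * c + (u + u′) ≡ (k * c + u) + (k′ * c + u′)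
  identity = solve-∀

evalC-scale : ∀ m A v c → evalC (Vec.map (m *_) A) v c ≡ m * evalC A v c
evalC-scale m (k ∷ L) v c = trans (cong (λ u → m * k * c + u) (scale-at m L (1 ∷ v))) (identity m k c (L at (1 ∷ v)))
  where
  identity : ∀ m k c u → m * k * c + m * u ≡ m * (k * c + u)
  identity = solve-∀

evalC-⊟ : ∀ A B v c → evalC (A ⊟ B) v c ≡ evalC A v c - evalC B v c
evalC-⊟ A B v c = trans (evalC-⊞ A (Vec.map (-1ℤ *_) B) v c)
  (cong (λ u → evalC A v c + u) (trans (evalC-scale -1ℤ B v c) (ℤ.-1*i≡-i (evalC B v c))))

record Regime : Set where
  field
    level : ℕ
    lo hi : Form 4

open Regime public

-- A form is affine in c, so on lo ≤ c ≤ hi it suffices to look at one end.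
NonNeg : Regime → Form 5 → Set
NonNeg reg (k ∷ L) = (0ℤ ≤ k × constant 0ℤ ≼ L ⊞ Vec.map (k *_) (lo reg)) ⊎ (k ≤ 0ℤ × constant 0ℤ ≼ L ⊞ Vec.map (k *_) (hi reg))

nonNeg? : ∀ reg A → Dec (NonNeg reg A)
nonNeg? reg (k ∷ L) = ((0ℤ ℤ.≤? k) ×-dec (constant 0ℤ ≼? L ⊞ Vec.map (k *_) (lo reg))) ⊎-dec
                      ((k ℤ.≤? 0ℤ) ×-dec (constant 0ℤ ≼? L ⊞ Vec.map (k *_) (hi reg)))

nonNeg-sound : ∀ reg A v c → lo reg at (1 ∷ v) ≤ c → c ≤ hi reg at (1 ∷ v) → NonNeg reg A → 0ℤ ≤ evalC A v c
nonNeg-sound reg (k ∷ L) v c lo≤c c≤hi ok = go ok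
  where
  end : ∀ E → constant 0ℤ ≼ L ⊞ Vec.map (k *_) E → 0ℤ ≤ L at (1 ∷ v) + k * E at (1 ∷ v)
  end E p = subst₂ _≤_ (constant-at 0ℤ v) (trans (at-⊞ L (Vec.map (k *_) E) (1 ∷ v)) (cong (λ u → L at (1 ∷ v) + u) (scale-at k E (1 ∷ v)))) (at-mono p (1 ∷ v))
  flip : ∀ {u} → u ≤ k * c → 0ℤ ≤ L at (1 ∷ v) + u → 0ℤ ≤ k * c + L at (1 ∷ v)
  flip le p = ℤ.≤-trans p (ℤ.≤-trans (ℤ.+-monoʳ-≤ (L at (1 ∷ v)) le) (ℤ.≤-reflexive (ℤ.+-comm (L at (1 ∷ v)) (k * c))))
  go : NonNeg reg (k ∷ L) → 0ℤ ≤ k * c + L at (1 ∷ v)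
  go (inj₁ (0≤k , p)) = flip (ℤ.*-monoˡ-≤-nonNeg k ⦃ Data.Integer.nonNegative 0≤k ⦄ lo≤c) (end (lo reg) p)
  go (inj₂ (k≤0 , p)) = flip (ℤ.*-monoˡ-≤-nonPos k ⦃ Data.Integer.nonPositive k≤0 ⦄ c≤hi) (end (hi reg) p)

-- The binding one of the bounds p(S) ≤ F S and p(S) + c ≤ F (S ∪ {3}) on the
-- slice p 3 = c depends only on the size of S.
sliceForm : ℕ → Forms → Subset 3 → Form 5
sliceForm l F S with card S ℕ.≤ᵇ l
... | true  = 0ℤ ∷ F (S Vec.∷ʳ false)
... | false = -1ℤ ∷ F (S Vec.∷ʳ true)

⟪⟫-∷ʳ : ∀ {n} (p : Vec ℤ n) c S t → ⟪ p Vec.∷ʳ c , S Vec.∷ʳ t ⟫ ≡ ⟪ p , S ⟫ + bit t * c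
⟪⟫-∷ʳ []      c []      t = trans (ℤ.+-identityʳ (bit t * c)) (sym (ℤ.+-identityˡ (bit t * c)))
⟪⟫-∷ʳ (x ∷ p) c (s ∷ S) t = trans (cong (λ u → bit s * x + u) (⟪⟫-∷ʳ p c S t)) (sym (ℤ.+-assoc (bit s * x) ⟪ p , S ⟫ (bit t * c)))

quadratic : ℤ → ℤ → ℤ → ℤ → ℤ
quadratic N O₀ O₁ O₂ = (N + 1ℤ) * (N + + 2) - O₀ * (O₀ + 1ℤ) - O₁ * (O₁ + 1ℤ) - O₂ * (O₂ + 1ℤ)

module Slice (reg : Regime) (F : Forms) where

  γ : Subset 3 → Form 5
  γ = sliceForm (level reg) F

  γ₀ γ₁ γ₂ γ₀₁ γ₀₂ γ₁₂ γₛ NF OF₀ OF₁ OF₂ : Form 5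
  γ₀  = γ (true ∷ false ∷ false ∷ [])
  γ₁  = γ (false ∷ true ∷ false ∷ [])
  γ₂  = γ (false ∷ false ∷ true ∷ [])
  γ₀₁ = γ (true ∷ true ∷ false ∷ [])
  γ₀₂ = γ (true ∷ false ∷ true ∷ [])
  γ₁₂ = γ (false ∷ true ∷ true ∷ [])
  γₛ  = γ (true ∷ true ∷ true ∷ [])
  NF  = γ₁₂ ⊞ γ₀₂ ⊞ γ₀₁ ⊟ Vec.map (+ 2 *_) γₛ
  OF₀ = γ₀₂ ⊞ γ₀₁ ⊟ γₛ ⊟ γ₀
  OF₁ = γ₁₂ ⊞ γ₀₁ ⊟ γₛ ⊟ γ₁
  OF₂ = γ₁₂ ⊞ γ₀₂ ⊟ γₛ ⊟ γ₂

  -- `binds₀` and `binds₁` put the selected bound below both candidates, of which it is one, so `γ`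
  -- describes the slice exactly. From `empty` on, the fields are the conditions of `Truncated`.
  record Valid : Set where
    constructor valid
    field
      top    : γ ⊤ ≡ -1ℤ ∷ F ⊤
      binds₀ : ∀ S → NonNeg reg ((0ℤ ∷ F (S Vec.∷ʳ false)) ⊟ γ S)
      binds₁ : ∀ S → NonNeg reg ((-1ℤ ∷ F (S Vec.∷ʳ true)) ⊟ γ S)
      empty  : NonNeg reg (γ (false ∷ false ∷ false ∷ []))
      pos₀   : NonNeg reg OF₀
      pos₁   : NonNeg reg OF₁
      pos₂   : NonNeg reg OF₂
      sep₀₁  : NonNeg reg (NF ⊟ (OF₀ ⊞ OF₁))
      sep₀₂  : NonNeg reg (NF ⊟ (OF₀ ⊞ OF₂))
      sep₁₂  : NonNeg reg (NF ⊟ (OF₁ ⊞ OF₂))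

  valid? : Dec Valid
  valid? = map′ (λ (a , b , c , d , e , f , g , h , i , j) → valid a b c d e f g h i j)
                (λ (valid a b c d e f g h i j) → a , b , c , d , e , f , g , h , i , j)
    ((γ ⊤ ≟F (-1ℤ ∷ F ⊤)) ×-dec
     ∀Subset? (λ S → nonNeg? reg ((0ℤ ∷ F (S Vec.∷ʳ false)) ⊟ γ S)) ×-dec
     ∀Subset? (λ S → nonNeg? reg ((-1ℤ ∷ F (S Vec.∷ʳ true)) ⊟ γ S)) ×-dec
     nonNeg? reg (γ (false ∷ false ∷ false ∷ [])) ×-dec
     nonNeg? reg OF₀ ×-dec nonNeg? reg OF₁ ×-dec nonNeg? reg OF₂ ×-dec
     nonNeg? reg (NF ⊟ (OF₀ ⊞ OF₁)) ×-dec nonNeg? reg (NF ⊟ (OF₀ ⊞ OF₂)) ×-dec nonNeg? reg (NF ⊟ (OF₁ ⊞ OF₂)))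

  module _ (ok : Valid) (v : Vec ℕ 3) (c : ℤ) (lo≤c : lo reg at (1 ∷ v) ≤ c) (c≤hi : c ≤ hi reg at (1 ∷ v)) where

    private
      module V = Valid ok

      g : Subset 3 → ℤ
      g S = evalC (γ S) v c

      open Triangle g using (N; O₀; O₁; O₂; Truncated; truncated)

      sound : ∀ {A} → NonNeg reg A → 0ℤ ≤ evalC A v c
      sound {A} = nonNeg-sound reg A v c lo≤c c≤hi

      N≡ : evalC NF v c ≡ N
      N≡ = trans (evalC-⊟ (γ₁₂ ⊞ γ₀₂ ⊞ γ₀₁) (Vec.map (+ 2 *_) γₛ) v c)
        (cong₂ _-_ (trans (evalC-⊞ (γ₁₂ ⊞ γ₀₂) γ₀₁ v c) (cong (_+ evalC γ₀₁ v c) (evalC-⊞ γ₁₂ γ₀₂ v c))) (evalC-scale (+ 2) γₛ v c))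

      O≡ : ∀ A B C D → evalC (A ⊞ B ⊟ C ⊟ D) v c ≡ evalC A v c + evalC B v c - evalC C v c - evalC D v c
      O≡ A B C D = trans (evalC-⊟ (A ⊞ B ⊟ C) D v c)
        (cong (_- evalC D v c) (trans (evalC-⊟ (A ⊞ B) C v c) (cong (_- evalC C v c) (evalC-⊞ A B v c))))

      O₀≡ : evalC OF₀ v c ≡ O₀
      O₀≡ = O≡ γ₀₂ γ₀₁ γₛ γ₀
      O₁≡ : evalC OF₁ v c ≡ O₁
      O₁≡ = O≡ γ₁₂ γ₀₁ γₛ γ₁
      O₂≡ : evalC OF₂ v c ≡ O₂
      O₂≡ = O≡ γ₁₂ γ₀₂ γₛ γ₂

      separated : ∀ A B {P Q} → evalC A v c ≡ P → evalC B v c ≡ Q → NonNeg reg (NF ⊟ (A ⊞ B)) → P + Q ≤ N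
      separated A B p q nn = ℤ.0≤i-j⇒j≤i (subst (0ℤ ≤_)
        (trans (evalC-⊟ NF (A ⊞ B) v c) (cong₂ _-_ N≡ (trans (evalC-⊞ A B v c) (cong₂ _+_ p q)))) (sound nn))

      trunc : Truncated
      trunc = truncated (sound V.empty)
        (subst (0ℤ ≤_) O₀≡ (sound V.pos₀)) (subst (0ℤ ≤_) O₁≡ (sound V.pos₁)) (subst (0ℤ ≤_) O₂≡ (sound V.pos₂))
        (separated OF₀ OF₁ O₀≡ O₁≡ V.sep₀₁) (separated OF₀ OF₂ O₀≡ O₂≡ V.sep₀₂) (separated OF₁ OF₂ O₁≡ O₂≡ V.sep₁₂)

      F₀ F₁ : Subset 3 → ℤ
      F₀ S = F (S Vec.∷ʳ false) at (1 ∷ v)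
      F₁ S = F (S Vec.∷ʳ true) at (1 ∷ v)

      g≤F₀ : ∀ S → g S ≤ F₀ S
      g≤F₀ S = ℤ.0≤i-j⇒j≤i (subst (0ℤ ≤_)
        (trans (evalC-⊟ (0ℤ ∷ F (S Vec.∷ʳ false)) (γ S) v c) (cong (_- g S) (drop c (F₀ S)))) (sound (V.binds₀ S)))
        where
        drop : ∀ c f → 0ℤ * c + f ≡ f
        drop = solve-∀

      g≤F₁ : ∀ S → g S ≤ F₁ S - c
      g≤F₁ S = ℤ.0≤i-j⇒j≤i (subst (0ℤ ≤_)
        (trans (evalC-⊟ (-1ℤ ∷ F (S Vec.∷ʳ true)) (γ S) v c) (cong (_- g S) (negate c (F₁ S)))) (sound (V.binds₁ S)))
        where
        negate : ∀ c f → -1ℤ * c + f ≡ f - c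
        negate = solve-∀

      g-⊤ : g ⊤ ≡ F ⊤ at (1 ∷ v) - c
      g-⊤ = trans (cong (λ A → evalC A v c) V.top) (negate c (F ⊤ at (1 ∷ v)))
        where
        negate : ∀ c f → -1ℤ * c + f ≡ f - c
        negate = solve-∀

      ≤g : ∀ u S → u ≤ F₀ S → u ≤ F₁ S - c → u ≤ g S
      ≤g u S le₀ le₁ with card S ℕ.≤ᵇ level reg
      ... | true  = subst (u ≤_) (pad c (F₀ S)) le₀
        where
        pad : ∀ c f → f ≡ 0ℤ * c + f
        pad = solve-∀
      ... | false = subst (u ≤_) (pad c (F₁ S)) le₁
        where
        pad : ∀ c f → f - c ≡ -1ℤ * c + f
        pad = solve-∀

      plus-0 : ∀ u c → u + 0ℤ * c ≡ u
      plus-0 = solve-∀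
      plus-1 : ∀ u c → u ≡ u + 1ℤ * c - c
      plus-1 = solve-∀

      slice⟺ : ∀ q → (∃[ p ] (p ∈BP g × q ≡ p Vec.∷ʳ c)) ⟺ (Polytope F v q × lookup q (# 3) ≡ c)
      slice⟺ q = into , outof q
        where
        into : (∃[ p ] (p ∈BP g × q ≡ p Vec.∷ʳ c)) → Polytope F v q × lookup q (# 3) ≡ c
        into (p@(_ ∷ _ ∷ _ ∷ []) , inBP bd fl , refl) = inBP bounds′ full′ , refl
          where
          with-c : ∀ u f → u ≤ f - c → u + 1ℤ * c ≤ f
          with-c u f le = ≤-by (≤⇒0≤ le ∷ []) (identity u f c)
            where
            identity : ∀ u f c → (f - c - u) + 0ℤ ≡ f - (u + 1ℤ * c)
            identity = solve-∀
          bounds′ : ∀ S → ⟪ p Vec.∷ʳ c , S ⟫ ≤ F S at (1 ∷ v)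
          bounds′ (s₀ ∷ s₁ ∷ s₂ ∷ false ∷ []) = let S = s₀ ∷ s₁ ∷ s₂ ∷ [] in
            ℤ.≤-trans (ℤ.≤-reflexive (trans (⟪⟫-∷ʳ p c S false) (plus-0 ⟪ p , S ⟫ c))) (ℤ.≤-trans (bd S) (g≤F₀ S))
          bounds′ (s₀ ∷ s₁ ∷ s₂ ∷ true ∷ []) = let S = s₀ ∷ s₁ ∷ s₂ ∷ [] in
            ℤ.≤-trans (ℤ.≤-reflexive (⟪⟫-∷ʳ p c S true)) (with-c ⟪ p , S ⟫ (F₁ S) (ℤ.≤-trans (bd S) (g≤F₁ S)))
          restore : ∀ f c → (f - c) + 1ℤ * c ≡ f
          restore = solve-∀
          full′ : ⟪ p Vec.∷ʳ c , ⊤ ⟫ ≡ F ⊤ at (1 ∷ v)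
          full′ = trans (⟪⟫-∷ʳ p c ⊤ true) (trans (cong (_+ 1ℤ * c) (trans fl g-⊤)) (restore (F ⊤ at (1 ∷ v)) c))
        outof : ∀ q → Polytope F v q × lookup q (# 3) ≡ c → ∃[ p ] (p ∈BP g × q ≡ p Vec.∷ʳ c)
        outof (p₀ ∷ p₁ ∷ p₂ ∷ .c ∷ []) (inBP bd fl , refl) = p , inBP bounds′ full′ , refl
          where
          p = p₀ ∷ p₁ ∷ p₂ ∷ []
          without-c : ∀ u f → u + 1ℤ * c ≤ f → u ≤ f - c
          without-c u f le = ≤-by (≤⇒0≤ le ∷ []) (identity u f c)
            where
            identity : ∀ u f c → (f - (u + 1ℤ * c)) + 0ℤ ≡ f - c - u
            identity = solve-∀
          bounds′ : ∀ S → ⟪ p , S ⟫ ≤ g S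
          bounds′ S = ≤g ⟪ p , S ⟫ S
            (ℤ.≤-trans (ℤ.≤-reflexive (sym (trans (⟪⟫-∷ʳ p c S false) (plus-0 ⟪ p , S ⟫ c)))) (bd (S Vec.∷ʳ false)))
            (without-c ⟪ p , S ⟫ (F₁ S) (ℤ.≤-trans (ℤ.≤-reflexive (sym (⟪⟫-∷ʳ p c S true))) (bd (S Vec.∷ʳ true))))
          full′ : ⟪ p , ⊤ ⟫ ≡ g ⊤
          full′ = trans (plus-1 ⟪ p , ⊤ ⟫ c) (trans (cong (_- c) (trans (sym (⟪⟫-∷ʳ p c ⊤ true)) fl)) (sym g-⊤))

    slice-card : ∃[ h ] (HasCard (λ q → Polytope F v q × lookup q (# 3) ≡ c) h ×
                         + 2 * + h ≡ quadratic (evalC NF v c) (evalC OF₀ v c) (evalC OF₁ v c) (evalC OF₂ v c))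
    slice-card = let h , C , eq = triangle-card g trunc in
      h , card-⇔ slice⟺ (card-image (Vec._∷ʳ c) (λ {p} {q} → Vec.∷ʳ-injectiveˡ p q) C) ,
      trans eq (sym (cong₂ (λ f O → f O) (cong₂ (λ f O → f O) (cong₂ quadratic N≡ O₀≡) O₁≡) O₂≡))

-- Summation over the slices

sumTo-cong : ∀ m {e e′ : ℕ → ℤ} → (∀ i → e i ≡ e′ i) → sumTo m e ≡ sumTo m e′
sumTo-cong zero    eq = refl
sumTo-cong (suc m) eq = cong₂ _+_ (eq 0) (sumTo-cong m (eq ∘ suc))

sum-quadratic : ∀ m a b c → + 6 * sumTo m (λ i → a + b * + i + c * (+ i * + i)) ≡
  + 6 * a * + m + + 3 * b * (+ m * (+ m - 1ℤ)) + c * (+ m * (+ m - 1ℤ) * (+ 2 * + m - 1ℤ))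
sum-quadratic zero    a b c = base a b c
  where
  base : ∀ a b c → 0ℤ ≡ + 6 * a * 0ℤ + + 3 * b * (0ℤ * (0ℤ - 1ℤ)) + c * (0ℤ * (0ℤ - 1ℤ) * (+ 2 * 0ℤ - 1ℤ))
  base = solve-∀
sum-quadratic (suc m) a b c = let open ≡-Reasoning in begin
  + 6 * ((a + b * 0ℤ + c * (0ℤ * 0ℤ)) + sumTo m (λ i → a + b * + suc i + c * (+ suc i * + suc i)))
    ≡⟨ cong (λ u → + 6 * ((a + b * 0ℤ + c * (0ℤ * 0ℤ)) + u)) (sumTo-cong m (λ i → shift-index a b c (+ i))) ⟩
  + 6 * ((a + b * 0ℤ + c * (0ℤ * 0ℤ)) + rest)
    ≡⟨ distribute a b c rest ⟩
  + 6 * a + + 6 * rest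
    ≡⟨ cong (λ u → + 6 * a + u) (sum-quadratic m (a + b + c) (b + + 2 * c) c) ⟩
  + 6 * a + (+ 6 * (a + b + c) * + m + + 3 * (b + + 2 * c) * (+ m * (+ m - 1ℤ)) + c * (+ m * (+ m - 1ℤ) * (+ 2 * + m - 1ℤ)))
    ≡⟨ collect a b c (+ m) ⟩
  + 6 * a * + suc m + + 3 * b * (+ suc m * (+ suc m - 1ℤ)) + c * (+ suc m * (+ suc m - 1ℤ) * (+ 2 * + suc m - 1ℤ)) ∎
  where
  rest = sumTo m (λ i → (a + b + c) + (b + + 2 * c) * + i + c * (+ i * + i))
  shift-index : ∀ a b c i → a + b * (1ℤ + i) + c * ((1ℤ + i) * (1ℤ + i)) ≡ (a + b + c) + (b + + 2 * c) * i + c * (i * i)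
  shift-index = solve-∀
  distribute : ∀ a b c r → + 6 * ((a + b * 0ℤ + c * (0ℤ * 0ℤ)) + r) ≡ + 6 * a + + 6 * r
  distribute = solve-∀
  collect : ∀ a b c m → + 6 * a + (+ 6 * (a + b + c) * m + + 3 * (b + + 2 * c) * (m * (m - 1ℤ)) + c * (m * (m - 1ℤ) * (+ 2 * m - 1ℤ))) ≡
    + 6 * a * (1ℤ + m) + + 3 * b * ((1ℤ + m) * ((1ℤ + m) - 1ℤ)) + c * ((1ℤ + m) * ((1ℤ + m) - 1ℤ) * (+ 2 * (1ℤ + m) - 1ℤ))
  collect = solve-∀

-- Six times the sum over i < m of `quadratic` at arguments affine in i, by the formulas for the
-- sums of i and of i²; primed arguments are slopes.
closed : ℤ → ℤ → ℤ → ℤ → ℤ → ℤ → ℤ → ℤ → ℤ → ℤ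
closed m n n′ a a′ b b′ c c′ =
  + 6 * quadratic n a b c * m
  + + 3 * (n′ * (+ 2 * n + + 3) - a′ * (+ 2 * a + 1ℤ) - b′ * (+ 2 * b + 1ℤ) - c′ * (+ 2 * c + 1ℤ)) * (m * (m - 1ℤ))
  + (n′ * n′ - a′ * a′ - b′ * b′ - c′ * c′) * (m * (m - 1ℤ) * (+ 2 * m - 1ℤ))

sum-closed : ∀ m n n′ a a′ b b′ c c′ →
  + 6 * sumTo m (λ i → quadratic (n + n′ * + i) (a + a′ * + i) (b + b′ * + i) (c + c′ * + i)) ≡ closed (+ m) n n′ a a′ b b′ c c′
sum-closed m n n′ a a′ b b′ c c′ = trans (cong (+ 6 *_) (sumTo-cong m (λ i → expand n n′ a a′ b b′ c c′ (+ i))))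
  (sum-quadratic m (quadratic n a b c) (n′ * (+ 2 * n + + 3) - a′ * (+ 2 * a + 1ℤ) - b′ * (+ 2 * b + 1ℤ) - c′ * (+ 2 * c + 1ℤ)) (n′ * n′ - a′ * a′ - b′ * b′ - c′ * c′))
  where
  expand : ∀ n n′ a a′ b b′ c c′ i →
    ((n + n′ * i) + 1ℤ) * ((n + n′ * i) + + 2) - (a + a′ * i) * ((a + a′ * i) + 1ℤ) - (b + b′ * i) * ((b + b′ * i) + 1ℤ) - (c + c′ * i) * ((c + c′ * i) + 1ℤ) ≡
    ((n + 1ℤ) * (n + + 2) - a * (a + 1ℤ) - b * (b + 1ℤ) - c * (c + 1ℤ))
    + (n′ * (+ 2 * n + + 3) - a′ * (+ 2 * a + 1ℤ) - b′ * (+ 2 * b + 1ℤ) - c′ * (+ 2 * c + 1ℤ)) * i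
    + (n′ * n′ - a′ * a′ - b′ * b′ - c′ * c′) * (i * i)
  expand = solve-∀

regimeTotal : Regime → Forms → Vec ℕ 3 → ℤ → ℤ
regimeTotal reg F v m = closed m (at-lo NF) (Vec.head NF) (at-lo OF₀) (Vec.head OF₀) (at-lo OF₁) (Vec.head OF₁) (at-lo OF₂) (Vec.head OF₂)
  where
  open Slice reg F
  at-lo : Form 5 → ℤ
  at-lo A = evalC A v (lo reg at (1 ∷ v))

Slab : Forms → Vec ℕ 3 → ℤ → ℕ → Vec ℤ 4 → Set
Slab F v l m q = ∃[ i ] (i ℕ.< m × Polytope F v q × lookup q (# 3) ≡ l + + i)

regime-card : ∀ reg F → Slice.Valid reg F → ∀ v m → lo reg at (1 ∷ v) + + m ≡ hi reg at (1 ∷ v) + 1ℤ →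
              ∃[ h ] (HasCard (Slab F v (lo reg at (1 ∷ v)) m) h × + 12 * + h ≡ regimeTotal reg F v (+ m))
regime-card reg F ok v m ends =
  let h , C , eq = card-sum (+ 2) m (λ i q → Polytope F v q × lookup q (# 3) ≡ l + + i) (λ i → e (l + + i)) disjoint slices in
  h , C , trans (ℤ.*-assoc (+ 6) (+ 2) (+ h)) (trans (cong (+ 6 *_) (trans eq (sumTo-cong m affine)))
    (sum-closed m (evalC NF v l) (Vec.head NF) (evalC OF₀ v l) (Vec.head OF₀) (evalC OF₁ v l) (Vec.head OF₁) (evalC OF₂ v l) (Vec.head OF₂)))
  where
  open Slice reg F
  l = lo reg at (1 ∷ v)
  e : ℤ → ℤ
  e c = quadratic (evalC NF v c) (evalC OF₀ v c) (evalC OF₁ v c) (evalC OF₂ v c)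
  cancelˡ : ∀ {i j} → l + + i ≡ l + + j → i ≡ j
  cancelˡ {i} {j} p = ℤ.+-injective (GroupProperties.∙-cancelˡ (AbelianGroup.group ℤ.+-0-abelianGroup) l (+ i) (+ j) p)
  disjoint : ∀ {i j} q → Polytope F v q × lookup q (# 3) ≡ l + + i → Polytope F v q × lookup q (# 3) ≡ l + + j → i ≡ j
  disjoint q (_ , p) (_ , p′) = cancelˡ (trans (sym p) p′)
  above : ∀ i → l ≤ l + + i
  above i = ≤-by (+≤+ (ℕ.z≤n {i}) ∷ []) (identity l (+ i))
    where
    identity : ∀ l i → i + 0ℤ ≡ l + i - l
    identity = solve-∀
  under : ∀ i → i ℕ.< m → l + + i ≤ hi reg at (1 ∷ v)
  under i i<m = ≤-by (≤⇒0≤ (+≤+ i<m) ∷ ≡⇒0≤ ends ∷ []) (identity l (+ i) (+ m) (hi reg at (1 ∷ v)))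
    where
    identity : ∀ l i m h → (m - (1ℤ + i)) + ((h + 1ℤ - (l + m)) + 0ℤ) ≡ h - (l + i)
    identity = solve-∀
  slices : ∀ i → i ℕ.< m → ∃[ h ] (HasCard (λ q → Polytope F v q × lookup q (# 3) ≡ l + + i) h × + 2 * + h ≡ e (l + + i))
  slices i i<m = slice-card ok v (l + + i) (above i) (under i i<m)
  evalC-affine : ∀ A i → evalC A v (l + + i) ≡ evalC A v l + Vec.head A * + i
  evalC-affine (k ∷ L) i = identity k l (+ i) (L at (1 ∷ v))
    where
    identity : ∀ k l i u → k * (l + i) + u ≡ (k * l + u) + k * i
    identity = solve-∀
  affine : ∀ i → e (l + + i) ≡ quadratic (evalC NF v l + Vec.head NF * + i) (evalC OF₀ v l + Vec.head OF₀ * + i)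
                                         (evalC OF₁ v l + Vec.head OF₁ * + i) (evalC OF₂ v l + Vec.head OF₂ * + i)
  affine i = cong₂ (λ f O → f O) (cong₂ (λ f O → f O) (cong₂ quadratic (evalC-affine NF i) (evalC-affine OF₀ i)) (evalC-affine OF₁ i)) (evalC-affine OF₂ i)

-- Adding the last index to a set of size k raises `Λ` by the (k+1)-st coordinate of λ, and
-- comparing this with c decides which bound is binding. Hence the ranges c < z, z ≤ c < y + z and c
-- ≥ y + z. The first begins at -η, the least value of the last coordinate.
regimeA : ℕ → Regime
regimeA η = record { level = 2 ; lo = constant (- + η) ; hi = -1ℤ ∷ 0ℤ ∷ 0ℤ ∷ 1ℤ ∷ [] }

regimeB regimeC : Regime
regimeB = record { level = 1 ; lo = 0ℤ ∷ 0ℤ ∷ 0ℤ ∷ 1ℤ ∷ [] ; hi = -1ℤ ∷ 0ℤ ∷ 1ℤ ∷ 1ℤ ∷ [] }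
regimeC = record { level = 0 ; lo = 0ℤ ∷ 0ℤ ∷ 1ℤ ∷ 1ℤ ∷ [] ; hi = 0ℤ ∷ 1ℤ ∷ 1ℤ ∷ 1ℤ ∷ [] }

-- `upper` and `lower` ensure that the three ranges exhaust the polytope: they bound the last
-- coordinate by x + y + z from above and by -η from below.
record Sliceable (η : ℕ) (F : Forms) : Set where
  constructor sliceable
  field
    validA : Slice.Valid (regimeA η) F
    validB : Slice.Valid regimeB F
    validC : Slice.Valid regimeC F
    upper  : F (false ∷ false ∷ false ∷ true ∷ []) ≡ hi regimeC
    lower  : F (true ∷ true ∷ true ∷ false ∷ []) ≡ F ⊤ ⊞ constant (+ η)

sliceable? : ∀ η F → Dec (Sliceable η F)
sliceable? η F = map′ (λ (a , b , c , d , e) → sliceable a b c d e) (λ (sliceable a b c d e) → a , b , c , d , e)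
  (Slice.valid? (regimeA η) F ×-dec Slice.valid? regimeB F ×-dec Slice.valid? regimeC F ×-dec
   (F (false ∷ false ∷ false ∷ true ∷ []) ≟F hi regimeC) ×-dec (F (true ∷ true ∷ true ∷ false ∷ []) ≟F (F ⊤ ⊞ constant (+ η))))


lo-A : ∀ η v → lo (regimeA η) at (1 ∷ v) ≡ - + η
lo-A η v = constant-at (- + η) v

totalCount : ℕ → Forms → Vec ℕ 3 → ℤ
totalCount η F v@(x ∷ y ∷ z ∷ []) =
  regimeTotal (regimeA η) F v (+ (z ℕ.+ η)) + (regimeTotal regimeB F v (+ y) + regimeTotal regimeC F v (+ suc x))

in-slab : ∀ {F v q} l m → Polytope F v q → l ≤ lookup q (# 3) → lookup q (# 3) < l + + m → Slab F v l m q
in-slab {q = q} l m P l≤ <end = i , ℤ.drop‿+<+ (subst (_< + m) (sym ei) (<-by (<⇒0≤ <end ∷ []) (identity (lookup q (# 3)) l (+ m)))) , P ,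
  trans (restore (lookup q (# 3)) l) (cong (λ u → l + u) (sym ei))
  where
  i = proj₁ (toNat (≤⇒0≤ l≤))
  ei : + i ≡ lookup q (# 3) - l
  ei = proj₂ (toNat (≤⇒0≤ l≤))
  identity : ∀ c l m → (l + m - (1ℤ + c)) + 0ℤ ≡ m - (1ℤ + (c - l))
  identity = solve-∀
  restore : ∀ c l → c ≡ l + (c - l)
  restore = solve-∀

slab-lower : ∀ {F v q l m} → Slab F v l m q → l ≤ lookup q (# 3)
slab-lower {q = q} {l} (i , _ , _ , e) = ≤-by (+≤+ (ℕ.z≤n {i}) ∷ ≡⇒0≤ (sym e) ∷ []) (identity l (+ i) (lookup q (# 3)))
  where
  identity : ∀ l i c → i + ((c - (l + i)) + 0ℤ) ≡ c - l
  identity = solve-∀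

slab-upper : ∀ {F v q l m} → Slab F v l m q → lookup q (# 3) < l + + m
slab-upper {q = q} {l} {m} (i , i<m , _ , e) = <-by (≤⇒0≤ (+≤+ i<m) ∷ ≡⇒0≤ e ∷ []) (identity l (+ i) (+ m) (lookup q (# 3)))
  where
  identity : ∀ l i m c → (m - (1ℤ + i)) + ((l + i - c) + 0ℤ) ≡ l + m - (1ℤ + c)
  identity = solve-∀

polytope-card : ∀ {η F} → Sliceable η F → ∀ x y z → let v = x ∷ y ∷ z ∷ [] in
                ∃[ h ] (HasCard (Polytope F v) h × + 12 * + h ≡ totalCount η F v)
polytope-card {η} {F} ok x y z =
  let hA , CA , eA = regime-card (regimeA η) F validA v (z ℕ.+ η) (endsA (+ x) (+ y) (+ z) (+ η))
      hB , CB , eB = regime-card regimeB F validB v y (endsB (+ x) (+ y) (+ z))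
      -- The last range contains both of its ends, hence x + 1 slices.
      hC , CC , eC = regime-card regimeC F validC v (suc x) (endsC (+ x) (+ y) (+ z))
  in hA ℕ.+ (hB ℕ.+ hC) , card-⇔ cover (card-⊎ disjointA CA (card-⊎ disjointB CB CC)) ,
     trans (distribute (+ hA) (+ hB) (+ hC)) (cong₂ _+_ eA (cong₂ _+_ eB eC))
  where
  open Sliceable ok
  v = x ∷ y ∷ z ∷ []
  lA = lo (regimeA η) at (1 ∷ v)
  lB = lo regimeB at (1 ∷ v)
  lC = lo regimeC at (1 ∷ v)

  distribute : ∀ a b c → + 12 * (a + (b + c)) ≡ + 12 * a + (+ 12 * b + + 12 * c)
  distribute = solve-∀
  endsA : ∀ x y z η → (- η * 1ℤ + (0ℤ * x + (0ℤ * y + (0ℤ * z + 0ℤ)))) + (z + η) ≡ (-1ℤ * 1ℤ + (0ℤ * x + (0ℤ * y + (1ℤ * z + 0ℤ)))) + 1ℤ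
  endsA = solve-∀
  endsB : ∀ x y z → (0ℤ * 1ℤ + (0ℤ * x + (0ℤ * y + (1ℤ * z + 0ℤ)))) + y ≡ (-1ℤ * 1ℤ + (0ℤ * x + (1ℤ * y + (1ℤ * z + 0ℤ)))) + 1ℤ
  endsB = solve-∀
  endsC : ∀ x y z → (0ℤ * 1ℤ + (0ℤ * x + (1ℤ * y + (1ℤ * z + 0ℤ)))) + (1ℤ + x) ≡ (0ℤ * 1ℤ + (1ℤ * x + (1ℤ * y + (1ℤ * z + 0ℤ)))) + 1ℤ
  endsC = solve-∀
  meetA : ∀ x y z η → (- η * 1ℤ + (0ℤ * x + (0ℤ * y + (0ℤ * z + 0ℤ)))) + (z + η) ≡ 0ℤ * 1ℤ + (0ℤ * x + (0ℤ * y + (1ℤ * z + 0ℤ)))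
  meetA = solve-∀
  meetB : ∀ x y z → (0ℤ * 1ℤ + (0ℤ * x + (0ℤ * y + (1ℤ * z + 0ℤ)))) + y ≡ 0ℤ * 1ℤ + (0ℤ * x + (1ℤ * y + (1ℤ * z + 0ℤ)))
  meetB = solve-∀
  A→B : lA + + (z ℕ.+ η) ≡ lB
  A→B = meetA (+ x) (+ y) (+ z) (+ η)
  B→C : lB + + y ≡ lC
  B→C = meetB (+ x) (+ y) (+ z)
  lB≤lC : lB ≤ lC
  lB≤lC = ℤ.≤-trans (ℤ.i≤i+j lB (+ y)) (ℤ.≤-reflexive B→C)

  disjointB : ∀ q → Slab F v lB y q → Slab F v lC (suc x) q → ⊥
  disjointB q sB sC = ℤ.<-irrefl refl (ℤ.<-≤-trans (subst (lookup q (# 3) <_) B→C (slab-upper {F} {v} {q} {lB} {y} sB)) (slab-lower {F} {v} {q} {lC} {suc x} sC))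
  disjointA : ∀ q → Slab F v lA (z ℕ.+ η) q → Slab F v lB y q ⊎ Slab F v lC (suc x) q → ⊥
  disjointA q sA other = ℤ.<-irrefl refl (ℤ.<-≤-trans (subst (lookup q (# 3) <_) A→B (slab-upper {F} {v} {q} {lA} {z ℕ.+ η} sA)) (after other))
    where
    after : Slab F v lB y q ⊎ Slab F v lC (suc x) q → lB ≤ lookup q (# 3)
    after (inj₁ sB) = slab-lower {F} {v} {q} {lB} {y} sB
    after (inj₂ sC) = ℤ.≤-trans lB≤lC (slab-lower {F} {v} {q} {lC} {suc x} sC)

  cover : ∀ q → (Slab F v lA (z ℕ.+ η) q ⊎ (Slab F v lB y q ⊎ Slab F v lC (suc x) q)) ⟺ Polytope F v q
  cover q = (λ { (inj₁ (_ , _ , P , _)) → P ; (inj₂ (inj₁ (_ , _ , P , _))) → P ; (inj₂ (inj₂ (_ , _ , P , _))) → P }) , split q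
    where
    split : ∀ q → Polytope F v q → Slab F v lA (z ℕ.+ η) q ⊎ (Slab F v lB y q ⊎ Slab F v lC (suc x) q)
    split q@(a ∷ b ∷ c ∷ d ∷ []) P with d ℤ.<? lB | d ℤ.<? lC
    ... | yes d<lB | _        = inj₁ (in-slab {F} {v} {q} lA (z ℕ.+ η) P lA≤d (subst (d <_) (sym A→B) d<lB))
      where
      identity : ∀ a b c d f e → (f + e - (1ℤ * a + (1ℤ * b + (1ℤ * c + (0ℤ * d + 0ℤ))))) + (((1ℤ * a + (1ℤ * b + (1ℤ * c + (1ℤ * d + 0ℤ)))) - f) + 0ℤ) ≡ d - (- e)
      identity = solve-∀
      lower-at : F (true ∷ true ∷ true ∷ false ∷ []) at (1 ∷ v) ≡ F ⊤ at (1 ∷ v) + + η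
      lower-at = trans (cong (_at (1 ∷ v)) lower) (trans (at-⊞ (F ⊤) (constant (+ η)) (1 ∷ v)) (cong (λ u → F ⊤ at (1 ∷ v) + u) (constant-at (+ η) v)))
      lA≤d : lA ≤ d
      lA≤d = ℤ.≤-trans (ℤ.≤-reflexive (lo-A η v))
        (≤-by (≤⇒0≤ (subst (⟪ q , true ∷ true ∷ true ∷ false ∷ [] ⟫ ≤_) lower-at (bounds P (true ∷ true ∷ true ∷ false ∷ []))) ∷ ≡⇒0≤ (sym (full P)) ∷ [])
              (identity a b c d (F ⊤ at (1 ∷ v)) (+ η)))
    ... | no d≮lB  | yes d<lC = inj₂ (inj₁ (in-slab {F} {v} {q} lB y P (ℤ.≮⇒≥ d≮lB) (subst (d <_) (sym B→C) d<lC)))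
    ... | no _     | no d≮lC  = inj₂ (inj₂ (in-slab {F} {v} {q} lC (suc x) P (ℤ.≮⇒≥ d≮lC) d<end))
      where
      identity : ∀ a b c d h u → (h - (0ℤ * a + (0ℤ * b + (0ℤ * c + (1ℤ * d + 0ℤ))))) + ((u - (h + 1ℤ)) + 0ℤ) ≡ u - (1ℤ + d)
      identity = solve-∀
      d<end : d < lC + + suc x
      d<end = <-by (≤⇒0≤ (subst (λ G → ⟪ q , false ∷ false ∷ false ∷ true ∷ [] ⟫ ≤ G at (1 ∷ v)) upper (bounds P (false ∷ false ∷ false ∷ true ∷ []))) ∷ ≡⇒0≤ (sym (endsC (+ x) (+ y) (+ z))) ∷ [])
        (identity a b c d (hi regimeC at (1 ∷ v)) (lC + + suc x))

-- The count as a polynomial in x, y, z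

formP : Form 4 → Polynomial 3
formP (c ∷ a ∷ b ∷ d ∷ []) = con c :* con 1ℤ :+ (con a :* var (# 0) :+ (con b :* var (# 1) :+ (con d :* var (# 2) :+ con 0ℤ)))

evalCP : Form 5 → Form 4 → Polynomial 3
evalCP (k ∷ L) l = con k :* formP l :+ formP L

quadraticP : ∀ {n} → Polynomial n → Polynomial n → Polynomial n → Polynomial n → Polynomial n
quadraticP N O₀ O₁ O₂ = (N :+ con 1ℤ) :* (N :+ con (+ 2)) :- O₀ :* (O₀ :+ con 1ℤ) :- O₁ :* (O₁ :+ con 1ℤ) :- O₂ :* (O₂ :+ con 1ℤ)

closedP : ∀ {k} (m n n′ a a′ b b′ c c′ : Polynomial k) → Polynomial k
closedP m n n′ a a′ b b′ c c′ =
  con (+ 6) :* quadraticP n a b c :* m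
  :+ con (+ 3) :* (n′ :* (con (+ 2) :* n :+ con (+ 3)) :- a′ :* (con (+ 2) :* a :+ con 1ℤ) :- b′ :* (con (+ 2) :* b :+ con 1ℤ) :- c′ :* (con (+ 2) :* c :+ con 1ℤ)) :* (m :* (m :- con 1ℤ))
  :+ (n′ :* n′ :- a′ :* a′ :- b′ :* b′ :- c′ :* c′) :* (m :* (m :- con 1ℤ) :* (con (+ 2) :* m :- con 1ℤ))

regimeTotalP : Regime → Forms → Polynomial 3 → Polynomial 3
regimeTotalP reg F m = closedP m (evalCP NF (lo reg)) (con (Vec.head NF)) (evalCP OF₀ (lo reg)) (con (Vec.head OF₀))
                                 (evalCP OF₁ (lo reg)) (con (Vec.head OF₁)) (evalCP OF₂ (lo reg)) (con (Vec.head OF₂))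
  where open Slice reg F

formP-correct : ∀ F x y z → ⟦ formP F ⟧ (+ x ∷ + y ∷ + z ∷ []) ≡ F at (1 ∷ x ∷ y ∷ z ∷ [])
formP-correct (c ∷ a ∷ b ∷ d ∷ []) x y z = refl

evalCP-correct : ∀ A l x y z → ⟦ evalCP A l ⟧ (+ x ∷ + y ∷ + z ∷ []) ≡ evalC A (x ∷ y ∷ z ∷ []) (l at (1 ∷ x ∷ y ∷ z ∷ []))
evalCP-correct (k ∷ L) l x y z = cong₂ (λ u w → k * u + w) (formP-correct l x y z) (formP-correct L x y z)

regimeTotalP-correct : ∀ reg F m x y z {m′} → ⟦ m ⟧ (+ x ∷ + y ∷ + z ∷ []) ≡ m′ →
  ⟦ regimeTotalP reg F m ⟧ (+ x ∷ + y ∷ + z ∷ []) ≡ regimeTotal reg F (x ∷ y ∷ z ∷ []) m′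
regimeTotalP-correct reg F m x y z em = go (Vec.head NF) (Vec.head OF₀) (Vec.head OF₁) (Vec.head OF₂) em (correct NF) (correct OF₀) (correct OF₁) (correct OF₂)
  where
  open Slice reg F
  correct : ∀ A → ⟦ evalCP A (lo reg) ⟧ (+ x ∷ + y ∷ + z ∷ []) ≡ evalC A (x ∷ y ∷ z ∷ []) (lo reg at (1 ∷ x ∷ y ∷ z ∷ []))
  correct A = evalCP-correct A (lo reg) x y z
  go : ∀ n′ a′ b′ c′ {m m′ n n″ a a″ b b″ c c″} → m ≡ m′ → n ≡ n″ → a ≡ a″ → b ≡ b″ → c ≡ c″ →
       closed m n n′ a a′ b b′ c c′ ≡ closed m′ n″ n′ a″ a′ b″ b′ c″ c′
  go _ _ _ _ refl refl refl refl refl = refl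

totalCountP : ℕ → Forms → Polynomial 3
totalCountP η F = regimeTotalP (regimeA η) F (var (# 2) :+ con (+ η)) :+ (regimeTotalP regimeB F (var (# 1)) :+ regimeTotalP regimeC F (con 1ℤ :+ var (# 0)))

totalCountP-correct : ∀ η F x y z → ⟦ totalCountP η F ⟧ (+ x ∷ + y ∷ + z ∷ []) ≡ totalCount η F (x ∷ y ∷ z ∷ [])
totalCountP-correct η F x y z = cong₂ _+_ (regimeTotalP-correct (regimeA η) F (var (# 2) :+ con (+ η)) x y z refl)
  (cong₂ _+_ (regimeTotalP-correct regimeB F (var (# 1)) x y z refl) (regimeTotalP-correct regimeC F (con 1ℤ :+ var (# 0)) x y z refl))

-- One syntax with three readings: in ℕ for lengths of lists, as an integer polynomial for the
-- comparison with the lattice count, and in the coefficient ring for the comparison with the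
-- volumes.
data Expr : Set where
  X       : Fin 3 → Expr
  K       : ℕ → Expr
  _⊕_ _⊗_ : Expr → Expr → Expr

infixl 6 _⊕_
infixl 7 _⊗_

evalℕ : Expr → Vec ℕ 3 → ℕ
evalℕ (X i)   v = lookup v i
evalℕ (K n)   v = n
evalℕ (e ⊕ f) v = evalℕ e v ℕ.+ evalℕ f v
evalℕ (e ⊗ f) v = evalℕ e v ℕ.* evalℕ f v

exprP : Expr → Polynomial 3
exprP (X i)   = var i
exprP (K n)   = con (+ n)
exprP (e ⊕ f) = exprP e :+ exprP f
exprP (e ⊗ f) = exprP e :* exprP f

exprP-correct : ∀ e v → ⟦ exprP e ⟧ (Vec.map +_ v) ≡ + evalℕ e v
exprP-correct (X i)   v = Vec.lookup-map i +_ v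
exprP-correct (K n)   v = refl
exprP-correct (e ⊕ f) v = cong₂ _+_ (exprP-correct e v) (exprP-correct f v)
exprP-correct (e ⊗ f) v = trans (cong₂ _*_ (exprP-correct e v) (exprP-correct f v)) (sym (ℤ.pos-* (evalℕ e v) (evalℕ f v)))

x̂ ŷ ẑ : Expr
x̂ = X (# 0)
ŷ = X (# 1)
ẑ = X (# 2)

-- The coefficients are those of the table; the ones of V_{1,2} and V_{2,3} are
-- halved, and that of V_{1,2,3}, always 12, is spread over the cubic part.
countExpr : (c₀ c₁ c₂ c₃ d₄ c₅ d₆ : ℕ) → Expr
countExpr c₀ c₁ c₂ c₃ d₄ c₅ d₆ =
  K c₀ ⊕ K 2 ⊗ (K c₁ ⊗ x̂ ⊕ K c₂ ⊗ ŷ ⊕ K c₃ ⊗ ẑ)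
  ⊕ K 3 ⊗ K d₄ ⊗ (x̂ ⊗ x̂ ⊕ K 4 ⊗ x̂ ⊗ ŷ ⊕ ŷ ⊗ ŷ)
  ⊕ K 2 ⊗ K c₅ ⊗ x̂ ⊗ ẑ
  ⊕ K 3 ⊗ K d₆ ⊗ (ŷ ⊗ ŷ ⊕ K 4 ⊗ ŷ ⊗ ẑ ⊕ ẑ ⊗ ẑ)
  ⊕ K 4 ⊗ (x̂ ⊗ x̂ ⊗ x̂ ⊕ K 6 ⊗ x̂ ⊗ x̂ ⊗ ŷ ⊕ K 12 ⊗ x̂ ⊗ ŷ ⊗ ŷ ⊕ K 4 ⊗ ŷ ⊗ ŷ ⊗ ŷ ⊕ K 9 ⊗ x̂ ⊗ x̂ ⊗ ẑ
           ⊕ K 36 ⊗ x̂ ⊗ ŷ ⊗ ẑ ⊕ K 12 ⊗ ŷ ⊗ ŷ ⊗ ẑ ⊕ K 9 ⊗ x̂ ⊗ ẑ ⊗ ẑ ⊕ K 6 ⊗ ŷ ⊗ ẑ ⊗ ẑ ⊕ ẑ ⊗ ẑ ⊗ ẑ)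

countOf : Fin 6 → Expr
countOf zero                               = countExpr 24  22  28  22  8  36  8
countOf (suc zero)                         = countExpr 48  40  52  40  12 60  12
countOf (suc (suc zero))                   = countExpr 72  52  70  58  12 72  16
countOf (suc (suc (suc zero)))             = countExpr 72  58  70  52  16 72  12
countOf (suc (suc (suc (suc zero))))       = countExpr 120 82  100 82  16 96  16
countOf (suc (suc (suc (suc (suc zero))))) = countExpr 192 112 148 112 20 108 20

-- From cosets to elements

fromB : (Fin 4 → ℤ) → Aff
fromB β = aff (tabulate λ i → Fin.fromℕ< (ℤ.n%ℕd<d (β i) 4)) (tabulate λ i → β i ℤ./ℕ 4)

b-fromB : ∀ β i → b (fromB β) i ≡ β i
b-fromB β i = trans
  (cong₂ (λ r t → + toℕ r + + 4 * t) (Vec.lookup∘tabulate (λ i → Fin.fromℕ< (ℤ.n%ℕd<d (β i) 4)) i) (Vec.lookup∘tabulate (λ i → β i ℤ./ℕ 4) i))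
  (trans (cong₂ _+_ (cong +_ (Fin.toℕ-fromℕ< (ℤ.n%ℕd<d (β i) 4))) (ℤ.*-comm (+ 4) (β i ℤ./ℕ 4)))
         (sym (ℤ.a≡a%ℕn+[a/ℕn]*n (β i) 4)))

Surjective : Vec (Fin 4) 4 → Set
Surjective π = ∀ r → ∃[ i ] lookup π i ≡ r

perms : List (Vec (Fin 4) 4)
perms = List.deduplicate (Vec.≡-dec Fin._≟_) (List.map perm finiteWeyl)

perms-surjective : All Surjective perms
perms-surjective = from-yes (All.all? (λ π → Fin.all? λ r → Fin.any? λ i → lookup π i Fin.≟ r) perms)

perms-complete : ∀ π → Surjective π → π ∈ perms
perms-complete π@(i₀ ∷ i₁ ∷ i₂ ∷ i₃ ∷ []) surj =
  ∈.∈-deduplicate⁺ (Vec.≡-dec Fin._≟_) (∈.∈-map⁺ perm (permutation-∈finiteWeyl i₀ i₁ i₂ i₃ surj))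

perms-card : HasCard Surjective 24
perms-card = perms , deduplicate-! (Vec.≡-dec Fin._≟_) (List.map perm finiteWeyl) ,
  (λ π → All.lookup perms-surjective , perms-complete π) , refl

card-family : ∀ {I A : Set} {Q : I → Set} {P : I → A → Set} {m n} → (∀ {i j} x → P i x → P j x → i ≡ j) →
              HasCard Q m → (∀ i → Q i → HasCard (P i) n) → HasCard (λ x → ∃[ i ] (Q i × P i x)) (m ℕ.* n)
card-family {Q = Q} {P} {n = n} disjoint (L , u , mem , refl) cards =
  card-⇔ (λ x → (λ (i , i∈ , p) → i , proj₁ (mem i) i∈ , p) , (λ (i , q , p) → i , proj₂ (mem i) q , p))
         (go L u (λ i i∈ → cards i (proj₁ (mem i) i∈)))
  where
  go : ∀ L → Unique L → (∀ i → i ∈ L → HasCard (P i) n) → HasCard (λ x → ∃[ i ] (i ∈ L × P i x)) (length L ℕ.* n)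
  go []      _          _ = card-empty (λ { _ (_ , () , _) })
  go (i ∷ L) (i∉L ∷ u) c = card-⇔
    (λ x → (λ { (inj₁ p) → i , here refl , p ; (inj₂ (j , j∈ , p)) → j , there j∈ , p }) ,
           (λ { (_ , here refl , p) → inj₁ p ; (j , there j∈ , p) → inj₂ (j , j∈ , p) }))
    (card-⊎ (λ { x p (j , j∈ , p′) → All.lookup i∉L j∈ (disjoint x p p′) }) (c i (here refl)) (go L u (λ j j∈ → c j (there j∈))))

chartValue : ℤ → Vec ℤ 4 → Fin 4 → ℤ
chartValue κ p r = + 4 * lookup p r + (+ toℕ r + κ)

chartValue-injective : ∀ κ p q r s → chartValue κ p r ≡ chartValue κ q s → r ≡ s × lookup p r ≡ lookup q s
chartValue-injective κ p q r s e = euclid-unique r s (lookup p r) (lookup q s)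
  (trans (isolate (lookup p r) (+ toℕ r) κ) (trans (cong (_- κ) e) (sym (isolate (lookup q s) (+ toℕ s) κ))))
  where
  isolate : ∀ p r κ → r + + 4 * p ≡ + 4 * p + (r + κ) - κ
  isolate = solve-∀

assemble : ℤ → Vec (Fin 4) 4 → Vec ℤ 4 → Aff
assemble κ π p = fromB (λ i → chartValue κ p (lookup π i))

b-assemble : ∀ κ π p i → b (assemble κ π p) i ≡ chartValue κ p (lookup π i)
b-assemble κ π p = b-fromB (λ i → chartValue κ p (lookup π i))

assemble-injective : ∀ κ π π′ p p′ → assemble κ π p ≡ assemble κ π′ p′ → ∀ i → lookup π i ≡ lookup π′ i × lookup p (lookup π i) ≡ lookup p′ (lookup π′ i)
assemble-injective κ π π′ p p′ e i = chartValue-injective κ p p′ (lookup π i) (lookup π′ i)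
  (trans (sym (b-assemble κ π p i)) (trans (cong (λ w → b w i) e) (b-assemble κ π′ p′ i)))

-- The point p fixes the four values of an element; what remains free is their distribution over the
-- four positions, one element for each of the 24 permutations.
chart-card : ∀ κ {P : Vec ℤ 4 → Set} {n} → HasCard P n → HasCard (λ w → ∃[ p ] (P p × Chart κ p w)) (24 ℕ.* n)
chart-card κ {P} C = card-⇔ (λ w → into w , outof w)
  (card-family {P = λ π w → ∃[ p ] (P p × w ≡ assemble κ π p)}
    (λ { {π} {π′} _ (p , _ , refl) (p′ , _ , e) → lookup-injective (λ i → proj₁ (assemble-injective κ π π′ p p′ e i)) })
    perms-card
    (λ π surj → card-image (assemble κ π) (λ {p} {p′} e → lookup-injective λ r →
      let i , πi≡r = surj r in subst (λ r → lookup p r ≡ lookup p′ r) πi≡r (proj₂ (assemble-injective κ π π p p′ e i))) C))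
  where
  into : ∀ w → ∃[ π ] (Surjective π × ∃[ p ] (P p × w ≡ assemble κ π p)) → ∃[ p ] (P p × Chart κ p w)
  into w (π , surj , p , Pp , refl) = p , Pp , λ r → let i , πi≡r = surj r in i , trans (b-assemble κ π p i) (cong (chartValue κ p) πi≡r)
  outof : ∀ w → ∃[ p ] (P p × Chart κ p w) → ∃[ π ] (Surjective π × ∃[ p ] (P p × w ≡ assemble κ π p))
  outof w (p , Pp , ch) = π , surj , p , Pp ,
    b-injective (λ i → trans (proj₂ (resid-at i)) (trans (cong (chartValue κ p) (sym (lookup-π i))) (sym (b-assemble κ π p i))))
    where
    resid-at : ∀ i → ∃[ r ] b w i ≡ chartValue κ p r
    resid-at = chart-surjective κ p w ch
    π = tabulate (λ i → proj₁ (resid-at i))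
    lookup-π : ∀ i → lookup π i ≡ proj₁ (resid-at i)
    lookup-π = Vec.lookup∘tabulate (λ i → proj₁ (resid-at i))
    surj : Surjective π
    surj r = let i , e = ch r in i , trans (lookup-π i) (proj₁ (chartValue-injective κ p p (proj₁ (resid-at i)) r (trans (sym (proj₂ (resid-at i))) e)))

-- The amount η by which the last coordinate can fall below 0: from the second shape on, the point
-- set contains `e₀₃`.
carry : Fin 6 → ℕ
carry zero    = 0
carry (suc _) = 1

shape-sliceable : ∀ a → Sliceable (carry a) (formOf (points (shape a)))
shape-sliceable zero                               = from-yes (sliceable? 0 (formOf (points shape₁)))
shape-sliceable (suc zero)                         = from-yes (sliceable? 1 (formOf (points shape₂)))
shape-sliceable (suc (suc zero))                   = from-yes (sliceable? 1 (formOf (points shape₃)))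
shape-sliceable (suc (suc (suc zero)))             = from-yes (sliceable? 1 (formOf (points shape₄)))
shape-sliceable (suc (suc (suc (suc zero))))       = from-yes (sliceable? 1 (formOf (points shape₅)))
shape-sliceable (suc (suc (suc (suc (suc zero))))) = from-yes (sliceable? 1 (formOf (points shape₆)))

polynomial-≡ : ∀ {n} (p q : Polynomial n) → normalForm p ≈N normalForm q → ∀ ρ → ⟦ p ⟧ ρ ≡ ⟦ q ⟧ ρ
polynomial-≡ p q e ρ = trans (sym (normalForm-correct p ρ)) (trans (⟦_⟧N-cong {p₁ = normalForm p} {normalForm q} e ρ) (normalForm-correct q ρ))

-- `totalCount` is 12 times the number of lattice points and every point carries 24 elements, so its
-- double is the number of elements itself.
twiceTotal : Fin 6 → Polynomial 3
twiceTotal a = con (+ 2) :* totalCountP (carry a) (formOf (points (shape a)))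

abstract
  total-normal : ∀ a → normalForm (twiceTotal a) ≈N normalForm (exprP (countOf a))
  total-normal zero                                = from-just (normalForm (twiceTotal (# 0)) ≟N normalForm (exprP (countOf (# 0))))
  total-normal (suc zero)                          = from-just (normalForm (twiceTotal (# 1)) ≟N normalForm (exprP (countOf (# 1))))
  total-normal (suc (suc zero))                    = from-just (normalForm (twiceTotal (# 2)) ≟N normalForm (exprP (countOf (# 2))))
  total-normal (suc (suc (suc zero)))              = from-just (normalForm (twiceTotal (# 3)) ≟N normalForm (exprP (countOf (# 3))))
  total-normal (suc (suc (suc (suc zero))))        = from-just (normalForm (twiceTotal (# 4)) ≟N normalForm (exprP (countOf (# 4))))
  total-normal (suc (suc (suc (suc (suc zero)))))  = from-just (normalForm (twiceTotal (# 5)) ≟N normalForm (exprP (countOf (# 5))))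

shape-card : ∀ a x y z → let v = x ∷ y ∷ z ∷ [] in
  HasCard (λ w → ∃[ p ] (Polytope (formOf (points (shape a))) v p × Chart (κ v) p w)) (evalℕ (countOf a) v)
shape-card a x y z = let h , C , eq = polytope-card (shape-sliceable a) x y z in
  subst (HasCard _) (ℤ.+-injective (24h h eq)) (chart-card (κ v) C)
  where
  v = x ∷ y ∷ z ∷ []
  F = formOf (points (shape a))
  24h : ∀ h → + 12 * + h ≡ totalCount (carry a) F v → + (24 ℕ.* h) ≡ + evalℕ (countOf a) v
  24h h eq = let open ≡-Reasoning in begin
    + (24 ℕ.* h)                                         ≡⟨ ℤ.pos-* 24 h ⟩
    + 24 * + h                                           ≡⟨ ℤ.*-assoc (+ 2) (+ 12) (+ h) ⟩
    + 2 * (+ 12 * + h)                                   ≡⟨ cong (+ 2 *_) eq ⟩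
    + 2 * totalCount (carry a) F v                       ≡⟨ cong (+ 2 *_) (totalCountP-correct (carry a) F x y z) ⟨
    + 2 * ⟦ totalCountP (carry a) F ⟧ (+ x ∷ + y ∷ + z ∷ [])  ≡⟨ polynomial-≡ (twiceTotal a) (exprP (countOf a)) (total-normal a) (+ x ∷ + y ∷ + z ∷ []) ⟩
    ⟦ exprP (countOf a) ⟧ (+ x ∷ + y ∷ + z ∷ [])         ≡⟨ exprP-correct (countOf a) v ⟩
    + evalℕ (countOf a) v                                ∎

-- Alcoves

ι : ℤ → ℚ
ι n = n ℚ./ 1

-- The integer as an explicit reduced fraction, from which sums and order can be read off.
mkℤ : ℤ → ℚ
mkℤ n = mkℚ n 0 (Coprime.sym (Coprime.1-coprimeTo ∣ n ∣))

ι≡mkℤ : ∀ n → ι n ≡ mkℤ n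
ι≡mkℤ n = ℚ.↥p/↧p≡p (mkℤ n)

ι-+ : ∀ m n → ι (m + n) ≡ ι m ℚ.+ ι n
ι-+ m n = sym (trans (cong₂ ℚ._+_ (ι≡mkℤ m) (ι≡mkℤ n)) (cong ι (cong₂ _+_ (ℤ.*-identityʳ m) (ℤ.*-identityʳ n))))

ι-neg : ∀ n → ι (- n) ≡ ℚ.- ι n
ι-neg (+ zero)  = refl
ι-neg (+ suc n) = refl
ι-neg -[1+ n ]  = solve 1 (λ a → a ⟨=⟩ ⟨-⟩ (⟨-⟩ a)) refl (ι (+ suc n))

ι-minus : ∀ m n → ι (m - n) ≡ ι m ℚ.- ι n
ι-minus m n = trans (ι-+ m (- n)) (cong (ι m ℚ.+_) (ι-neg n))

ι-< : ∀ {m n} → m < n → ι m ℚ.< ι n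
ι-< {m} {n} m<n = subst₂ ℚ._<_ (sym (ι≡mkℤ m)) (sym (ι≡mkℤ n))
  (ℚ.*<* (subst₂ _<_ (sym (ℤ.*-identityʳ m)) (sym (ℤ.*-identityʳ n)) m<n))

ι-≤ : ∀ {m n} → m ≤ n → ι m ℚ.≤ ι n
ι-≤ {m} {n} m≤n = subst₂ ℚ._≤_ (sym (ι≡mkℤ m)) (sym (ι≡mkℤ n))
  (ℚ.*≤* (subst₂ _≤_ (sym (ℤ.*-identityʳ m)) (sym (ℤ.*-identityʳ n)) m≤n))

lookup-apply : ∀ f x i → lookup (apply f x) i ≡ lookup x (lookup (perm f) i) ℚ.+ ι (lookup (shift f) i)
lookup-apply f x i = Vec.lookup∘tabulate (λ i → lookup x (lookup (perm f) i) ℚ.+ ι (lookup (shift f) i)) i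

apply-∘ : ∀ f g x → apply (f ∘A g) x ≡ apply f (apply g x)
apply-∘ f g x = lookup-injective λ i → let open ≡-Reasoning in begin
  lookup (apply (f ∘A g) x) i
    ≡⟨ lookup-apply (f ∘A g) x i ⟩
  lookup x (lookup (perm (f ∘A g)) i) ℚ.+ ι (lookup (shift (f ∘A g)) i)
    ≡⟨ cong₂ (λ r t → lookup x r ℚ.+ ι t) (perm-∘ f g i) (shift-∘ f g i) ⟩
  lookup x (lookup (perm g) (lookup (perm f) i)) ℚ.+ ι (lookup (shift g) (lookup (perm f) i) + lookup (shift f) i)
    ≡⟨ cong (lookup x (lookup (perm g) (lookup (perm f) i)) ℚ.+_) (ι-+ (lookup (shift g) (lookup (perm f) i)) (lookup (shift f) i)) ⟩
  lookup x (lookup (perm g) (lookup (perm f) i)) ℚ.+ (ι (lookup (shift g) (lookup (perm f) i)) ℚ.+ ι (lookup (shift f) i))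
    ≡⟨ ℚ.+-assoc (lookup x (lookup (perm g) (lookup (perm f) i))) (ι (lookup (shift g) (lookup (perm f) i))) (ι (lookup (shift f) i)) ⟨
  (lookup x (lookup (perm g) (lookup (perm f) i)) ℚ.+ ι (lookup (shift g) (lookup (perm f) i))) ℚ.+ ι (lookup (shift f) i)
    ≡⟨ cong (ℚ._+ ι (lookup (shift f) i)) (lookup-apply g x (lookup (perm f) i)) ⟨
  lookup (apply g x) (lookup (perm f) i) ℚ.+ ι (lookup (shift f) i)
    ≡⟨ lookup-apply f (apply g x) i ⟨
  lookup (apply f (apply g x)) i ∎

apply-id : ∀ x → apply idA x ≡ x
apply-id x = lookup-injective λ i → trans (lookup-apply idA x i)
  (trans (cong₂ (λ r t → lookup x r ℚ.+ ι t) (Vec.lookup-allFin i) (Vec.lookup-replicate i 0ℤ)) (ℚ.+-identityʳ (lookup x i)))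

InE-gen : ∀ s x → InE x → InE (apply (gen s) x)
InE-gen s (a ∷ b ∷ c ∷ d ∷ []) e = trans (same s) e
  where
  same : ∀ s → let y = apply (gen s) (a ∷ b ∷ c ∷ d ∷ []) in
    lookup y (# 0) ℚ.+ lookup y (# 1) ℚ.+ lookup y (# 2) ℚ.+ lookup y (# 3) ≡ a ℚ.+ b ℚ.+ c ℚ.+ d
  same zero                   = solve 4 (λ a b c d → (d ⟨+⟩ conℚ (ι -1ℤ)) ⟨+⟩ (b ⟨+⟩ conℚ 0ℚ) ⟨+⟩ (c ⟨+⟩ conℚ 0ℚ) ⟨+⟩ (a ⟨+⟩ conℚ 1ℚ) ⟨=⟩ a ⟨+⟩ b ⟨+⟩ c ⟨+⟩ d) refl a b c d
  same (suc zero)             = solve 4 (λ a b c d → (b ⟨+⟩ conℚ 0ℚ) ⟨+⟩ (a ⟨+⟩ conℚ 0ℚ) ⟨+⟩ (c ⟨+⟩ conℚ 0ℚ) ⟨+⟩ (d ⟨+⟩ conℚ 0ℚ) ⟨=⟩ a ⟨+⟩ b ⟨+⟩ c ⟨+⟩ d) refl a b c d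
  same (suc (suc zero))       = solve 4 (λ a b c d → (a ⟨+⟩ conℚ 0ℚ) ⟨+⟩ (c ⟨+⟩ conℚ 0ℚ) ⟨+⟩ (b ⟨+⟩ conℚ 0ℚ) ⟨+⟩ (d ⟨+⟩ conℚ 0ℚ) ⟨=⟩ a ⟨+⟩ b ⟨+⟩ c ⟨+⟩ d) refl a b c d
  same (suc (suc (suc zero))) = solve 4 (λ a b c d → (a ⟨+⟩ conℚ 0ℚ) ⟨+⟩ (b ⟨+⟩ conℚ 0ℚ) ⟨+⟩ (d ⟨+⟩ conℚ 0ℚ) ⟨+⟩ (c ⟨+⟩ conℚ 0ℚ) ⟨=⟩ a ⟨+⟩ b ⟨+⟩ c ⟨+⟩ d) refl a b c d

InE-eval : ∀ w x → InE x → InE (apply (eval w) x)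
InE-eval []      x e = subst InE (sym (apply-id x)) e
InE-eval (s ∷ w) x e = subst InE (sym (apply-∘ (gen s) (eval w) x)) (InE-gen s (apply (eval w) x) (InE-eval w x e))

apply-inverse : ∀ w x → apply (eval w) (apply (eval (reverse w)) x) ≡ x
apply-inverse w x = trans (sym (apply-∘ (eval w) (eval (reverse w)) x)) (trans (cong (λ f → apply f x) (eval-inverseʳ w)) (apply-id x))

apply-inverse′ : ∀ w x → apply (eval (reverse w)) (apply (eval w) x) ≡ x
apply-inverse′ w x = trans (sym (apply-∘ (eval (reverse w)) (eval w) x)) (trans (cong (λ f → apply f x) (eval-inverseˡ w)) (apply-id x))

pair-neg : ∀ x i j → pair x i j ≡ ℚ.- pair x j i
pair-neg x i j = solve 2 (λ a b → a ⟨-⟩ b ⟨=⟩ ⟨-⟩ (b ⟨-⟩ a)) refl (lookup x i) (lookup x j)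

pair-apply : ∀ f x i j → pair (apply f x) i j ≡ pair x (lookup (perm f) i) (lookup (perm f) j) ℚ.+ ι (lookup (shift f) i - lookup (shift f) j)
pair-apply f x i j = trans (cong₂ ℚ._-_ (lookup-apply f x i) (lookup-apply f x j))
  (trans (solve 4 (λ a s b t → (a ⟨+⟩ s) ⟨-⟩ (b ⟨+⟩ t) ⟨=⟩ (a ⟨-⟩ b) ⟨+⟩ (s ⟨-⟩ t)) refl
            (lookup x (lookup (perm f) i)) (ι (lookup (shift f) i)) (lookup x (lookup (perm f) j)) (ι (lookup (shift f) j)))
         (cong (pair x (lookup (perm f) i) (lookup (perm f) j) ℚ.+_) (sym (ι-minus (lookup (shift f) i) (lookup (shift f) j)))))

-- x lies on the same side as the alcove of f of every hyperplane ⟨x , ε_i - ε_j⟩ = q.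
SameSides : Aff → Pt → Set
SameSides f x = ∀ i j q → + 4 * q < b f i - b f j → ι q ℚ.< pair x i j

aid-descending : ∀ p → InAid p → ∀ k l → l Fin.< k → 0ℚ ℚ.< pair p k l
aid-descending p (_ , bounds) k l l<k = subst (0ℚ ℚ.<_) (sym (pair-neg p k l)) (ℚ.neg-antimono-< (proj₂ (bounds l k l<k)))

aid-above : ∀ p → InAid p → ∀ k l → ι -1ℤ ℚ.< pair p k l
aid-above p P k l with Fin.<-cmp k l
... | tri< k<l _ _  = proj₁ (proj₂ P k l k<l)
... | tri≈ _ refl _ = subst (ι -1ℤ ℚ.<_) (sym (ℚ.+-inverseʳ (lookup p k))) (ι-< {m = -1ℤ} {0ℤ} Data.Integer.-<+)
... | tri> _ _ l<k  = ℚ.<-trans (ι-< {m = -1ℤ} {0ℤ} Data.Integer.-<+) (aid-descending p P k l l<k)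

-- With t = q - (s_i - s_j) the hypothesis says that 4t is less than the difference of two residues,
-- so t ≤ 0. If t is negative, differences of coordinates above -1 in the fundamental alcove
-- suffice; if t = 0, the residue at i is the larger one and its coordinate is larger too.
alcove⇒sides : ∀ f x → InAlc f x → SameSides f x
alcove⇒sides f x (p , P , refl) i j q lt = subst₂ ℚ._<_ (trans (sym (ι-+ t (si - sj))) (cong ι (restore q (si - sj)))) (sym (pair-apply f p i j))
  (ℚ.+-monoˡ-< (ι (si - sj)) (go (t ℤ.<? 0ℤ)))
  where
  si = lookup (shift f) i
  sj = lookup (shift f) j
  πi = lookup (perm f) i
  πj = lookup (perm f) j
  t = q - (si - sj)
  restore : ∀ q s → (q - s) + s ≡ q
  restore = solve-∀
  go : Dec (t < 0ℤ) → ι t ℚ.< pair p πi πj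
  go (yes t<0) = ℚ.≤-<-trans (ι-≤ (below t<0)) (aid-above p P πi πj)
    where
    below : t < 0ℤ → t ≤ -1ℤ
    below t<0 = ≤-by (<⇒0≤ t<0 ∷ []) (identity t)
      where
      identity : ∀ t → (0ℤ - (1ℤ + t)) + 0ℤ ≡ -1ℤ - t
      identity = solve-∀
  go (no t≮0) = ℚ.≤-<-trans (ι-≤ t≤0) (aid-descending p P πi πj πj<πi)
    where
    t≥0 = ℤ.≮⇒≥ t≮0
    identity₁ : ∀ q s u a c → (((a + + 4 * s) - (c + + 4 * u)) - (1ℤ + + 4 * q)) + ((q - (s - u) - 0ℤ) + ((q - (s - u) - 0ℤ) + ((q - (s - u) - 0ℤ) + ((q - (s - u) - 0ℤ) + 0ℤ)))) ≡ a - (1ℤ + c)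
    identity₁ = solve-∀
    πj<πi : πj Fin.< πi
    πj<πi = ℤ.drop‿+<+ (<-by (<⇒0≤ lt ∷ ≤⇒0≤ t≥0 ∷ ≤⇒0≤ t≥0 ∷ ≤⇒0≤ t≥0 ∷ ≤⇒0≤ t≥0 ∷ []) (identity₁ q si sj (+ toℕ πi) (+ toℕ πj)))
    t≤0 : t ≤ 0ℤ
    t≤0 = ℤ.≮⇒≥ λ 0<t → ⊥-by (<⇒0≤ lt ∷ <⇒0≤ 0<t ∷ <⇒0≤ 0<t ∷ <⇒0≤ 0<t ∷ <⇒0≤ 0<t ∷ ≤⇒0≤ (+≤+ (Fin.toℕ≤pred[n] πi)) ∷ +≤+ (ℕ.z≤n {toℕ πj}) ∷ +≤+ (ℕ.z≤n {1}) ∷ [])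
      (identity₂ q si sj (+ toℕ πi) (+ toℕ πj))
      where
      identity₂ : ∀ q s u a c → (((a + + 4 * s) - (c + + 4 * u)) - (1ℤ + + 4 * q)) + ((q - (s - u) - (1ℤ + 0ℤ)) + ((q - (s - u) - (1ℤ + 0ℤ)) + ((q - (s - u) - (1ℤ + 0ℤ)) + ((q - (s - u) - (1ℤ + 0ℤ)) + ((+ 3 - a) + (c + (1ℤ + 0ℤ))))))) ≡ -1ℤ
      identity₂ = solve-∀

-- The inequalities of the fundamental alcove for the residues k and l at f⁻¹ x are side conditions
-- on x at the positions where f carries k and l.
sides⇒alcove : ∀ f x → InW f → InE x → SameSides f x → InAlc f x
sides⇒alcove f x (w , refl) E sides = p , (InE-eval (reverse w) x E , bounds′) , fp≡x
  where
  p = apply (eval (reverse w)) x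
  fp≡x : apply f p ≡ x
  fp≡x = apply-inverse w x
  G = eval-good w
  bounds′ : ∀ k l → k Fin.< l → (ℚ.- 1ℚ ℚ.< pair p k l) × (pair p k l ℚ.< 0ℚ)
  bounds′ k l k<l = lower , upper
    where
    i = position G k
    j = position G l
    si = lookup (shift f) i
    sj = lookup (shift f) j
    diff : pair x i j ≡ pair p k l ℚ.+ ι (si - sj)
    diff = trans (cong (λ x → pair x i j) (sym fp≡x)) (trans (pair-apply f p i j)
      (cong₂ (λ k l → pair p k l ℚ.+ ι (si - sj)) (perm-position G k) (perm-position G l)))
    b-i : b f i ≡ + toℕ k + + 4 * si
    b-i = cong (λ r → + toℕ r + + 4 * si) (perm-position G k)
    b-j : b f j ≡ + toℕ l + + 4 * sj
    b-j = cong (λ r → + toℕ r + + 4 * sj) (perm-position G l)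
    shifted : ∀ q u → ι q ℚ.< u ℚ.+ ι (si - sj) → ι (q - (si - sj)) ℚ.< u
    shifted q u lt = subst₂ ℚ._<_ (sym (ι-minus q (si - sj))) (solve 2 (λ u s → u ⟨+⟩ s ⟨-⟩ s ⟨=⟩ u) refl u (ι (si - sj))) (ℚ.+-monoˡ-< (ℚ.- ι (si - sj)) lt)
    lower : ℚ.- 1ℚ ℚ.< pair p k l
    lower = subst (λ q → ι q ℚ.< pair p k l) (cancel (si - sj))
      (shifted ((si - sj) - 1ℤ) (pair p k l) (subst (ι ((si - sj) - 1ℤ) ℚ.<_) diff (sides i j ((si - sj) - 1ℤ) lt)))
      where
      cancel : ∀ s → (s - 1ℤ) - s ≡ -1ℤ
      cancel = solve-∀
      identity : ∀ k l s u → k + ((+ 3 - l) + 0ℤ) ≡ ((k + + 4 * s) - (l + + 4 * u)) - (1ℤ + + 4 * ((s - u) - 1ℤ))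
      identity = solve-∀
      lt : + 4 * ((si - sj) - 1ℤ) < b f i - b f j
      lt = subst (+ 4 * ((si - sj) - 1ℤ) <_) (sym (cong₂ _-_ b-i b-j))
        (<-by (+≤+ (ℕ.z≤n {toℕ k}) ∷ ≤⇒0≤ (+≤+ (Fin.toℕ≤pred[n] l)) ∷ []) (identity (+ toℕ k) (+ toℕ l) si sj))
    upper : pair p k l ℚ.< 0ℚ
    upper = subst (ℚ._< 0ℚ) (sym (pair-neg p k l)) (ℚ.neg-antimono-< {0ℚ} {pair p l k} (subst₂ ℚ._<_ zero-shift back (ℚ.+-monoˡ-< (ι (si - sj)) (sides j i (sj - si) lt))))
      where
      identity : ∀ k l s u → (l - (1ℤ + k)) + 0ℤ ≡ ((l + + 4 * u) - (k + + 4 * s)) - (1ℤ + + 4 * (u - s))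
      identity = solve-∀
      lt : + 4 * (sj - si) < b f j - b f i
      lt = subst (+ 4 * (sj - si) <_) (sym (cong₂ _-_ b-j b-i)) (<-by (<⇒0≤ (+<+ k<l) ∷ []) (identity (+ toℕ k) (+ toℕ l) si sj))
      cancel : ∀ s u → (u - s) + (s - u) ≡ 0ℤ
      cancel = solve-∀
      zero-shift : ι (sj - si) ℚ.+ ι (si - sj) ≡ 0ℚ
      zero-shift = trans (sym (ι-+ (sj - si) (si - sj))) (cong ι (cancel si sj))
      back : pair x j i ℚ.+ ι (si - sj) ≡ pair p l k
      back = trans (cong (ℚ._+ ι (si - sj)) (trans (pair-neg x j i) (cong ℚ.-_ diff)))
        (solve 3 (λ u w s → ⟨-⟩ (u ⟨-⟩ w ⟨+⟩ s) ⟨+⟩ s ⟨=⟩ w ⟨-⟩ u) refl (lookup p k) (lookup p l) (ι (si - sj)))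

-- An element is determined by its alcove

InW-∘ : ∀ {f g} → InW f → InW g → InW (f ∘A g)
InW-∘ (v , refl) (w , refl) = v ++ w , eval-++ v w

perm-sum : ∀ i₀ i₁ i₂ i₃ → Surjective (i₀ ∷ i₁ ∷ i₂ ∷ i₃ ∷ []) → + toℕ i₀ + + toℕ i₁ + + toℕ i₂ + + toℕ i₃ ≡ + 6
perm-sum = from-yes (Fin.all? {4} λ i₀ → Fin.all? {4} λ i₁ → Fin.all? {4} λ i₂ → Fin.all? {4} λ i₃ →
  (Fin.all? λ r → Fin.any? λ i → lookup (i₀ ∷ i₁ ∷ i₂ ∷ i₃ ∷ []) i Fin.≟ r) →-dec
  (+ toℕ i₀ + + toℕ i₁ + + toℕ i₂ + + toℕ i₃ ℤ.≟ + 6))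

b-sum : ∀ f → Good f → sumF (b f) ≡ + 6
b-sum f@(aff (i₀ ∷ i₁ ∷ i₂ ∷ i₃ ∷ []) (t₀ ∷ t₁ ∷ t₂ ∷ t₃ ∷ [])) G =
  trans (regroup (+ toℕ i₀) (+ toℕ i₁) (+ toℕ i₂) (+ toℕ i₃) t₀ t₁ t₂ t₃)
        (cong₂ (λ u t → u + + 4 * t) (perm-sum i₀ i₁ i₂ i₃ (λ r → position G r , perm-position G r)) (shift-sum G))
  where
  regroup : ∀ a b c d t u v w → (a + + 4 * t) + (b + + 4 * u) + (c + + 4 * v) + (d + + 4 * w) ≡ (a + b + c + d) + + 4 * (t + u + v + w)
  regroup = solve-∀

b-distinct : ∀ f → Good f → ∀ i j q → b f i ≡ b f j + + 4 * q → i ≡ j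
b-distinct f G i j q e = perm-injective G (proj₁ (euclid-unique (lookup (perm f) i) (lookup (perm f) j) (lookup (shift f) i) (lookup (shift f) j + q)
  (trans e (identity (+ toℕ (lookup (perm f) j)) (lookup (shift f) j) q))))
  where
  identity : ∀ r t q → (r + + 4 * t) + + 4 * q ≡ r + + 4 * (t + q)
  identity = solve-∀

sides-< : ∀ f → Good f → ∀ {x} → SameSides f x → ∀ i j → i ≢ j → ∀ q → ¬ (ι q ℚ.< pair x i j) → b f i < b f j + + 4 * q
sides-< f G {x} sides i j i≢j q not-above with ℤ.<-cmp (b f i) (b f j + + 4 * q)
... | tri< lt _ _ = lt
... | tri≈ _ e _  = contradiction (b-distinct f G i j q e) i≢j
... | tri> _ _ gt = contradiction (sides i j q (<-by (<⇒0≤ gt ∷ []) (identity (b f i) (b f j) q))) not-above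
  where
  identity : ∀ u v q → (u - (1ℤ + (v + + 4 * q))) + 0ℤ ≡ (u - v) - (1ℤ + + 4 * q)
  identity = solve-∀

b-idA : ∀ i → b idA i ≡ + toℕ i
b-idA i = trans (cong₂ (λ r s → + toℕ r + + 4 * s) (Vec.lookup-allFin i) (Vec.lookup-replicate i 0ℤ)) (ℤ.+-identityʳ (+ toℕ i))

window : ∀ {a b c d} → a < b → b < c → c < d → d < a + + 4 → a + b + c + d ≡ + 6 → a ≡ 0ℤ × b ≡ + 1 × c ≡ + 2 × d ≡ + 3
window {a} {b} {c} {d} ab bc cd da sum = a≡0 ,
  ℤ.≤-antisym (≤-by (<⇒0≤ bc ∷ <⇒0≤ cd ∷ <⇒0≤ da ∷ ≡⇒0≤ a≡0 ∷ []) (hi₁ a b c d)) (≤-by (<⇒0≤ ab ∷ ≡⇒0≤ (sym a≡0) ∷ []) (lo₁ a b)) ,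
  ℤ.≤-antisym (≤-by (<⇒0≤ cd ∷ <⇒0≤ da ∷ ≡⇒0≤ a≡0 ∷ []) (hi₂ a c d)) (≤-by (<⇒0≤ ab ∷ <⇒0≤ bc ∷ ≡⇒0≤ (sym a≡0) ∷ []) (lo₂ a b c)) ,
  ℤ.≤-antisym (≤-by (<⇒0≤ da ∷ ≡⇒0≤ a≡0 ∷ []) (hi₃ a d)) (≤-by (<⇒0≤ ab ∷ <⇒0≤ bc ∷ <⇒0≤ cd ∷ ≡⇒0≤ (sym a≡0) ∷ []) (lo₃ a b c d))
  where
  too-high : ∀ a b c d → (b - (1ℤ + a)) + ((b - (1ℤ + a)) + ((b - (1ℤ + a)) + ((c - (1ℤ + b)) + ((c - (1ℤ + b)) + ((d - (1ℤ + c)) +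
    ((a - (1ℤ + 0ℤ)) + ((a - (1ℤ + 0ℤ)) + ((a - (1ℤ + 0ℤ)) + ((a - (1ℤ + 0ℤ)) + ((+ 6 - (a + b + c + d)) + (+ 3 + 0ℤ))))))))))) ≡ -1ℤ
  too-high = solve-∀
  too-low : ∀ a b c d → (a + + 4 - (1ℤ + d)) + ((a + + 4 - (1ℤ + d)) + ((a + + 4 - (1ℤ + d)) + ((d - (1ℤ + c)) + ((d - (1ℤ + c)) + ((c - (1ℤ + b)) +
    ((0ℤ - (1ℤ + a)) + ((0ℤ - (1ℤ + a)) + ((0ℤ - (1ℤ + a)) + ((0ℤ - (1ℤ + a)) + (((a + b + c + d) - + 6) + (+ 3 + 0ℤ))))))))))) ≡ -1ℤ
  too-low = solve-∀
  -- If a is positive the sum is at least 10, if a is negative it is at most 2. Either way 6 is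
  -- missed by 4: one unit is the contradiction, and these three are the slack.
  three : 0ℤ ≤ + 3
  three = +≤+ ℕ.z≤n
  a≡0 : a ≡ 0ℤ
  a≡0 with ℤ.<-cmp a 0ℤ
  ... | tri≈ _ e _ = e
  ... | tri> _ _ p = ⊥-elim (⊥-by (<⇒0≤ ab ∷ <⇒0≤ ab ∷ <⇒0≤ ab ∷ <⇒0≤ bc ∷ <⇒0≤ bc ∷ <⇒0≤ cd ∷ <⇒0≤ p ∷ <⇒0≤ p ∷ <⇒0≤ p ∷ <⇒0≤ p ∷ ≡⇒0≤ sum ∷ three ∷ []) (too-high a b c d))
  ... | tri< n _ _ = ⊥-elim (⊥-by (<⇒0≤ da ∷ <⇒0≤ da ∷ <⇒0≤ da ∷ <⇒0≤ cd ∷ <⇒0≤ cd ∷ <⇒0≤ bc ∷ <⇒0≤ n ∷ <⇒0≤ n ∷ <⇒0≤ n ∷ <⇒0≤ n ∷ ≡⇒0≤ (sym sum) ∷ three ∷ []) (too-low a b c d))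
  hi₁ : ∀ a b c d → (c - (1ℤ + b)) + ((d - (1ℤ + c)) + ((a + + 4 - (1ℤ + d)) + ((0ℤ - a) + 0ℤ))) ≡ + 1 - b
  hi₁ = solve-∀
  lo₁ : ∀ a b → (b - (1ℤ + a)) + ((a - 0ℤ) + 0ℤ) ≡ b - + 1
  lo₁ = solve-∀
  hi₂ : ∀ a c d → (d - (1ℤ + c)) + ((a + + 4 - (1ℤ + d)) + ((0ℤ - a) + 0ℤ)) ≡ + 2 - c
  hi₂ = solve-∀
  lo₂ : ∀ a b c → (b - (1ℤ + a)) + ((c - (1ℤ + b)) + ((a - 0ℤ) + 0ℤ)) ≡ c - + 2
  lo₂ = solve-∀
  hi₃ : ∀ a d → (a + + 4 - (1ℤ + d)) + ((0ℤ - a) + 0ℤ) ≡ + 3 - d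
  hi₃ = solve-∀
  lo₃ : ∀ a b c d → (b - (1ℤ + a)) + ((c - (1ℤ + b)) + ((d - (1ℤ + c)) + ((a - 0ℤ) + 0ℤ))) ≡ d - + 3
  lo₃ = solve-∀

-- Barycentre of the fundamental alcove; its image under f has the coordinates (2 b f i - 3) / 8.
centre : Pt
centre = -[1+ 2 ] ℚ./ 8 ∷ -[1+ 0 ] ℚ./ 8 ∷ + 1 ℚ./ 8 ∷ + 3 ℚ./ 8 ∷ []

centre-InAid : InAid centre
centre-InAid = refl , from-yes (Fin.all? λ i → Fin.all? λ j → (i Fin.<? j) →-dec ((ℚ.- 1ℚ ℚ.<? pair centre i j) ×-dec (pair centre i j ℚ.<? 0ℚ)))

-- The values of w increase and stay within a window of length 4, because its alcove meets the
-- fundamental one; with sum 6 they can only be 0, 1, 2, 3.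
stabiliser : ∀ w → InW w → InAid (apply w centre) → w ≡ idA
stabiliser w Ww P = b-injective λ i → trans (values i) (sym (b-idA i))
  where
  G = InW⇒Good Ww
  p = apply w centre
  sides = alcove⇒sides w p (centre , centre-InAid , refl)
  ascending : ∀ k l → k Fin.< l → b w k < b w l
  ascending k l k<l = subst (b w k <_) (ℤ.+-identityʳ (b w l))
    (sides-< w G {p} sides k l (Fin.<⇒≢ k<l) 0ℤ (λ pos → ℚ.<-asym pos (proj₂ (proj₂ P k l k<l))))
  wrap : b w (# 3) < b w (# 0) + + 4
  wrap = sides-< w G {p} sides (# 3) (# 0) (λ ()) 1ℤ (λ gt → ℚ.<-asym gt
    (subst (ℚ._< 1ℚ) (sym (pair-neg p (# 3) (# 0))) (ℚ.neg-antimono-< (proj₁ (proj₂ P (# 0) (# 3) (ℕ.s≤s ℕ.z≤n))))))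
  solved = window (ascending (# 0) (# 1) (ℕ.s≤s ℕ.z≤n)) (ascending (# 1) (# 2) (ℕ.s≤s (ℕ.s≤s ℕ.z≤n))) (ascending (# 2) (# 3) (ℕ.s≤s (ℕ.s≤s (ℕ.s≤s ℕ.z≤n)))) wrap (b-sum w G)
  values : ∀ i → b w i ≡ + toℕ i
  values zero                   = proj₁ solved
  values (suc zero)             = proj₁ (proj₂ solved)
  values (suc (suc zero))       = proj₁ (proj₂ (proj₂ solved))
  values (suc (suc (suc zero))) = proj₂ (proj₂ (proj₂ solved))

alcove-injective : ∀ f g → InW f → InW g → (∀ x → InAlc f x → InAlc g x) → f ≡ g
alcove-injective f g (v , refl) (w , refl) sub with sub (apply f centre) (centre , centre-InAid , refl)
... | p , P , e = let open ≡-Reasoning in begin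
  f                                     ≡⟨ ∘A-identityˡ f ⟨
  idA ∘A f                              ≡⟨ cong (_∘A f) (eval-inverseʳ w) ⟨
  (g ∘A eval (reverse w)) ∘A f          ≡⟨ ∘A-assoc g (eval (reverse w)) f ⟩
  g ∘A (eval (reverse w) ∘A f)          ≡⟨ cong (g ∘A_) (stabiliser (eval (reverse w) ∘A f) (reverse w ++ v , eval-++ (reverse w) v) (subst InAid (sym moved) P)) ⟩
  g ∘A idA                              ≡⟨ ∘A-identityʳ g ⟩
  g                                     ∎
  where
  moved : apply (eval (reverse w) ∘A f) centre ≡ p
  moved = trans (apply-∘ (eval (reverse w)) f centre) (trans (cong (apply (eval (reverse w))) (sym e)) (apply-inverse′ w p))

theta-unique : ∀ a λ′ θ θ′ → IsTheta a λ′ θ → IsTheta a λ′ θ′ → θ ≡ θ′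
theta-unique a λ′ θ θ′ (Wθ , alc) (Wθ′ , alc′) = alcove-injective θ θ′ Wθ Wθ′ (λ x → proj₂ (alc′ x) ∘ proj₁ (alc x))

-- Existence of the translated alcove

heightForm : Fin 4 → Form 3
heightForm i = Vec.tail (coord shape₁ i)

height : Fin 4 → Vec ℕ 3 → ℤ
height i v = heightForm i at v

-- Splits the coordinates of a shape into a constant part, which belongs to w₀ a, and heights common
-- to all six shapes, which belong to λ.
shape-alcove : ∀ a i → coord (shape a) i ≡ Vec.head (coord (shape a) i) ∷ heightForm i ×
                       b (w₀ ∘A aElt a) i ≡ + 4 * Vec.head (coord (shape a) i) + + toℕ (resid (shape a) i)
shape-alcove = from-yes (Fin.all? λ a → Fin.all? λ i →
  (coord (shape a) i ≟F (Vec.head (coord (shape a) i) ∷ heightForm i)) ×-dec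
  (b (w₀ ∘A aElt a) i ℤ.≟ + 4 * Vec.head (coord (shape a) i) + + toℕ (resid (shape a) i)))

module _ (a : Fin 6) (x y z : ℕ) where

  private
    v : Vec ℕ 3
    v = x ∷ y ∷ z ∷ []

    I : shape a atWeight v
    I = interval a x y z

  b-theta : ∀ i → b (θ I) i ≡ b (w₀ ∘A aElt a) i + (+ 4 * height i v + κ v)
  b-theta i = trans (b-θ I i)
    (trans (cong (λ F → + 4 * F at (1 ∷ v) + (+ toℕ (resid (shape a) i) + κ v)) (proj₁ (shape-alcove a i)))
    (trans (identity c (height i v) (+ toℕ (resid (shape a) i)) (κ v))
           (cong (λ u → u + (+ 4 * height i v + κ v)) (sym (proj₂ (shape-alcove a i))))))
    where
    c = Vec.head (coord (shape a) i)
    identity : ∀ c h r k → + 4 * (c * 1ℤ + h) + (r + k) ≡ (+ 4 * c + r) + (+ 4 * h + k)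
    identity = solve-∀

  b-theta-minus : ∀ i j → b (θ I) i - b (θ I) j ≡ (b (w₀ ∘A aElt a) i - b (w₀ ∘A aElt a) j) + + 4 * (height i v - height j v)
  b-theta-minus i j = trans (cong₂ _-_ (b-theta i) (b-theta j))
    (identity (b (w₀ ∘A aElt a) i) (b (w₀ ∘A aElt a) j) (height i v) (height j v) (κ v))
    where
    identity : ∀ s t h l k → (s + (+ 4 * h + k)) - (t + (+ 4 * l + k)) ≡ (s - t) + + 4 * (h - l)
    identity = solve-∀

-- The weight differs from the integral vector (x + y + z, y + z, z, 0) by a multiple of (1, 1, 1,
-- 1), which `pair` does not see.
weight-height : ∀ x y z i → lookup (weight x y z) i ≡ ι (height i (x ∷ y ∷ z ∷ [])) ℚ.+ lookup (weight x y z) (# 3)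
weight-height x y z i = trans (raw i) (cong (ℚ._+ lookup (weight x y z) (# 3)) (sym (height-ι i)))
  where
  X′ = ι (+ x)
  Y′ = ι (+ y)
  Z′ = ι (+ z)
  heightℚ : Fin 4 → ℚ
  heightℚ zero                   = X′ ℚ.+ (Y′ ℚ.+ Z′)
  heightℚ (suc zero)             = Y′ ℚ.+ Z′
  heightℚ (suc (suc zero))       = Z′
  heightℚ (suc (suc (suc zero))) = 0ℚ
  simplify₀ : ∀ x y z → 1ℤ * x + (1ℤ * y + (1ℤ * z + 0ℤ)) ≡ x + (y + z)
  simplify₀ = solve-∀
  simplify₁ : ∀ x y z → 0ℤ * x + (1ℤ * y + (1ℤ * z + 0ℤ)) ≡ y + z
  simplify₁ = solve-∀
  simplify₂ : ∀ x y z → 0ℤ * x + (0ℤ * y + (1ℤ * z + 0ℤ)) ≡ z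
  simplify₂ = solve-∀
  simplify₃ : ∀ x y z → 0ℤ * x + (0ℤ * y + (0ℤ * z + 0ℤ)) ≡ 0ℤ
  simplify₃ = solve-∀
  height-ι : ∀ i → ι (height i (x ∷ y ∷ z ∷ [])) ≡ heightℚ i
  height-ι zero                   = trans (cong ι (simplify₀ (+ x) (+ y) (+ z))) (trans (ι-+ (+ x) (+ y + + z)) (cong (X′ ℚ.+_) (ι-+ (+ y) (+ z))))
  height-ι (suc zero)             = trans (cong ι (simplify₁ (+ x) (+ y) (+ z))) (ι-+ (+ y) (+ z))
  height-ι (suc (suc zero))       = cong ι (simplify₂ (+ x) (+ y) (+ z))
  height-ι (suc (suc (suc zero))) = cong ι (simplify₃ (+ x) (+ y) (+ z))
  raw : ∀ i → lookup (weight x y z) i ≡ heightℚ i ℚ.+ lookup (weight x y z) (# 3)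
  raw zero = solve 3 (λ x y z → conℚ (+ 3 ℚ./ 4) ⟨*⟩ x ⟨+⟩ conℚ (+ 1 ℚ./ 2) ⟨*⟩ y ⟨+⟩ conℚ (+ 1 ℚ./ 4) ⟨*⟩ z ⟨=⟩
    x ⟨+⟩ (y ⟨+⟩ z) ⟨+⟩ (conℚ (-[1+ 0 ] ℚ./ 4) ⟨*⟩ x ⟨+⟩ conℚ (-[1+ 0 ] ℚ./ 2) ⟨*⟩ y ⟨+⟩ conℚ (-[1+ 2 ] ℚ./ 4) ⟨*⟩ z)) refl X′ Y′ Z′
  raw (suc zero) = solve 3 (λ x y z → conℚ (-[1+ 0 ] ℚ./ 4) ⟨*⟩ x ⟨+⟩ conℚ (+ 1 ℚ./ 2) ⟨*⟩ y ⟨+⟩ conℚ (+ 1 ℚ./ 4) ⟨*⟩ z ⟨=⟩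
    y ⟨+⟩ z ⟨+⟩ (conℚ (-[1+ 0 ] ℚ./ 4) ⟨*⟩ x ⟨+⟩ conℚ (-[1+ 0 ] ℚ./ 2) ⟨*⟩ y ⟨+⟩ conℚ (-[1+ 2 ] ℚ./ 4) ⟨*⟩ z)) refl X′ Y′ Z′
  raw (suc (suc zero)) = solve 3 (λ x y z → conℚ (-[1+ 0 ] ℚ./ 4) ⟨*⟩ x ⟨+⟩ conℚ (-[1+ 0 ] ℚ./ 2) ⟨*⟩ y ⟨+⟩ conℚ (+ 1 ℚ./ 4) ⟨*⟩ z ⟨=⟩
    z ⟨+⟩ (conℚ (-[1+ 0 ] ℚ./ 4) ⟨*⟩ x ⟨+⟩ conℚ (-[1+ 0 ] ℚ./ 2) ⟨*⟩ y ⟨+⟩ conℚ (-[1+ 2 ] ℚ./ 4) ⟨*⟩ z)) refl X′ Y′ Z′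
  raw (suc (suc (suc zero))) = sym (ℚ.+-identityˡ (lookup (weight x y z) (# 3)))

weight-sum : ∀ x y z → InE (weight x y z)
weight-sum x y z = solve 3 (λ x y z →
  (conℚ (+ 3 ℚ./ 4) ⟨*⟩ x ⟨+⟩ conℚ (+ 1 ℚ./ 2) ⟨*⟩ y ⟨+⟩ conℚ (+ 1 ℚ./ 4) ⟨*⟩ z) ⟨+⟩
  (conℚ (-[1+ 0 ] ℚ./ 4) ⟨*⟩ x ⟨+⟩ conℚ (+ 1 ℚ./ 2) ⟨*⟩ y ⟨+⟩ conℚ (+ 1 ℚ./ 4) ⟨*⟩ z) ⟨+⟩
  (conℚ (-[1+ 0 ] ℚ./ 4) ⟨*⟩ x ⟨+⟩ conℚ (-[1+ 0 ] ℚ./ 2) ⟨*⟩ y ⟨+⟩ conℚ (+ 1 ℚ./ 4) ⟨*⟩ z) ⟨+⟩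
  (conℚ (-[1+ 0 ] ℚ./ 4) ⟨*⟩ x ⟨+⟩ conℚ (-[1+ 0 ] ℚ./ 2) ⟨*⟩ y ⟨+⟩ conℚ (-[1+ 2 ] ℚ./ 4) ⟨*⟩ z) ⟨=⟩ conℚ 0ℚ) refl (ι (+ x)) (ι (+ y)) (ι (+ z))

sum-minus : ∀ (p l : Pt) → InE l → let s = lookup p (# 0) ℚ.+ lookup p (# 1) ℚ.+ lookup p (# 2) ℚ.+ lookup p (# 3)
                                       d = p -ᵥ l in
            lookup d (# 0) ℚ.+ lookup d (# 1) ℚ.+ lookup d (# 2) ℚ.+ lookup d (# 3) ≡ s
sum-minus (a ∷ b ∷ c ∷ d ∷ []) (a′ ∷ b′ ∷ c′ ∷ d′ ∷ []) e =
  trans (solve 8 (λ a b c d a′ b′ c′ d′ → (a ⟨-⟩ a′) ⟨+⟩ (b ⟨-⟩ b′) ⟨+⟩ (c ⟨-⟩ c′) ⟨+⟩ (d ⟨-⟩ d′) ⟨=⟩ (a ⟨+⟩ b ⟨+⟩ c ⟨+⟩ d) ⟨-⟩ (a′ ⟨+⟩ b′ ⟨+⟩ c′ ⟨+⟩ d′)) refl a b c d a′ b′ c′ d′)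
  (trans (cong (λ u → (a ℚ.+ b ℚ.+ c ℚ.+ d) ℚ.- u) e) (ℚ.+-identityʳ (a ℚ.+ b ℚ.+ c ℚ.+ d)))

pair-minus-weight : ∀ x y z p i j → let v = x ∷ y ∷ z ∷ [] in pair p i j ≡ pair (p -ᵥ weight x y z) i j ℚ.+ ι (height i v - height j v)
pair-minus-weight x y z p i j = sym (trans
  (cong₂ (λ u w → u ℚ.- w ℚ.+ ι (height i v - height j v)) (expand i) (expand j))
  (trans (cong (λ d → (lookup p i ℚ.- (ι (height i v) ℚ.+ t)) ℚ.- (lookup p j ℚ.- (ι (height j v) ℚ.+ t)) ℚ.+ d) (ι-minus (height i v) (height j v)))
         (solve 5 (λ p q h k t → (p ⟨-⟩ (h ⟨+⟩ t)) ⟨-⟩ (q ⟨-⟩ (k ⟨+⟩ t)) ⟨+⟩ (h ⟨-⟩ k) ⟨=⟩ p ⟨-⟩ q) refl (lookup p i) (lookup p j) (ι (height i v)) (ι (height j v)) t)))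
  where
  v = x ∷ y ∷ z ∷ []
  t = lookup (weight x y z) (# 3)
  expand : ∀ i → lookup (p -ᵥ weight x y z) i ≡ lookup p i ℚ.- (ι (height i v) ℚ.+ t)
  expand i = trans (Vec.lookup-zipWith ℚ._-_ i p (weight x y z)) (cong (λ u → lookup p i ℚ.- u) (weight-height x y z i))

alcove-InE : ∀ f x → InW f → InAlc f x → InE x
alcove-InE f x (w , refl) (p , P , refl) = InE-eval w p (proj₁ P)

-- As translation by λ need not be in W_aff, the two alcoves are compared through the hyperplanes:
-- translation by λ shifts the level of a hyperplane by a difference of heights, and the values of θ
-- differ from those of w₀ a accordingly.
theta-exists : ∀ a x y z → IsTheta (aElt a) (weight x y z) (θ (interval a x y z))
theta-exists a x y z = θ-InW I , λ p → into p , outof p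
  where
  v = x ∷ y ∷ z ∷ []
  I = interval a x y z
  w′ = w₀ ∘A aElt a
  W′ : InW w′
  W′ = InW-∘ (proj₁ w₀-lists) (aWord a , refl)
  into : ∀ p → InAlc (θ I) p → InAlc w′ (p -ᵥ weight x y z)
  into p A = sides⇒alcove w′ (p -ᵥ weight x y z) W′ (trans (sum-minus p (weight x y z) (weight-sum x y z)) (alcove-InE (θ I) p (θ-InW I) A)) sides
    where
    sides : SameSides w′ (p -ᵥ weight x y z)
    sides i j q lt = subst₂ ℚ._<_ (solve 2 (λ q d → q ⟨+⟩ d ⟨-⟩ d ⟨=⟩ q) refl (ι q) (ι d)) (solve 2 (λ q d → q ⟨+⟩ d ⟨-⟩ d ⟨=⟩ q) refl (pair (p -ᵥ weight x y z) i j) (ι d))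
      (ℚ.+-monoˡ-< (ℚ.- ι d) (subst₂ ℚ._<_ (ι-+ q d) (pair-minus-weight x y z p i j) (alcove⇒sides (θ I) p A i j (q + d)
        (subst (+ 4 * (q + d) <_) (sym (b-theta-minus a x y z i j)) (<-by (<⇒0≤ lt ∷ []) (identity (b w′ i - b w′ j) q d))))))
      where
      d = height i v - height j v
      identity : ∀ s q d → (s - (1ℤ + + 4 * q)) + 0ℤ ≡ (s + + 4 * d) - (1ℤ + + 4 * (q + d))
      identity = solve-∀
  outof : ∀ p → InAlc w′ (p -ᵥ weight x y z) → InAlc (θ I) p
  outof p A = sides⇒alcove (θ I) p (θ-InW I) (trans (sym (sum-minus p (weight x y z) (weight-sum x y z))) (alcove-InE w′ (p -ᵥ weight x y z) W′ A)) sides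
    where
    sides : SameSides (θ I) p
    sides i j q lt = subst₂ ℚ._<_ (trans (sym (ι-+ (q - d) d)) (cong ι (restore q d))) (sym (pair-minus-weight x y z p i j))
      (ℚ.+-monoˡ-< (ι d) (alcove⇒sides w′ (p -ᵥ weight x y z) A i j (q - d)
        (<-by (<⇒0≤ (subst (+ 4 * q <_) (b-theta-minus a x y z i j) lt) ∷ []) (identity (b w′ i - b w′ j) q d))))
      where
      d = height i v - height j v
      restore : ∀ q d → (q - d) + d ≡ q
      restore = solve-∀
      identity : ∀ s q d → ((s + + 4 * d) - (1ℤ + + 4 * q)) + 0ℤ ≡ s - (1ℤ + + 4 * (q - d))
      identity = solve-∀

-- The box and the elements of `aList`

w₀-pair : ∀ x i j → pair (apply w₀ x) i j ≡ pair x (Fin.opposite i) (Fin.opposite j)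
w₀-pair x i j = trans (pair-apply w₀ x i j)
  (trans (cong₂ (λ k l → pair x k l ℚ.+ ι (lookup (shift w₀) i - lookup (shift w₀) j)) (reversal i) (reversal j))
  (trans (cong (λ s → pair x (Fin.opposite i) (Fin.opposite j) ℚ.+ ι s) (unshifted i j)) (ℚ.+-identityʳ (pair x (Fin.opposite i) (Fin.opposite j)))))
  where
  reversal : ∀ i → lookup (perm w₀) i ≡ Fin.opposite i
  reversal = from-yes (Fin.all? λ i → lookup (perm w₀) i Fin.≟ Fin.opposite i)
  unshifted : ∀ i j → lookup (shift w₀) i - lookup (shift w₀) j ≡ 0ℤ
  unshifted = from-yes (Fin.all? λ i → Fin.all? λ j → lookup (shift w₀) i - lookup (shift w₀) j ℤ.≟ 0ℤ)

opposite-inject : ∀ (i : Fin 3) → Fin.opposite (inject₁ i) ≡ suc (Fin.opposite i)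
opposite-inject = from-yes (Fin.all? {3} λ i → Fin.opposite (inject₁ i) Fin.≟ suc (Fin.opposite i))

opposite-suc : ∀ (i : Fin 3) → Fin.opposite (suc i) ≡ inject₁ (Fin.opposite i)
opposite-suc = from-yes (Fin.all? {3} λ i → Fin.opposite (suc i) Fin.≟ inject₁ (Fin.opposite i))

w₀-pair-up : ∀ x (i : Fin 3) → pair (apply w₀ x) (inject₁ i) (suc i) ≡ pair x (suc (Fin.opposite i)) (inject₁ (Fin.opposite i))
w₀-pair-up x i = trans (w₀-pair x (inject₁ i) (suc i)) (cong₂ (pair x) (opposite-inject i) (opposite-suc i))

w₀-pair-down : ∀ x (i : Fin 3) → pair (apply w₀ x) (suc i) (inject₁ i) ≡ pair x (inject₁ (Fin.opposite i)) (suc (Fin.opposite i))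
w₀-pair-down x i = trans (w₀-pair x (suc i) (inject₁ i)) (cong₂ (pair x) (opposite-suc i) (opposite-inject i))

piMinus⇒bounds : ∀ x → InPiMinus x → ∀ (i : Fin 3) → 0ℚ ℚ.≤ pair x (suc i) (inject₁ i) × pair x (suc i) (inject₁ i) ℚ.≤ 1ℚ
piMinus⇒bounds x (y , (_ , bounds) , refl) i =
  subst (λ u → 0ℚ ℚ.≤ u × u ℚ.≤ 1ℚ) (sym (w₀-pair-down y i)) (bounds (Fin.opposite i))

bounds⇒piMinus : ∀ x → InE x → (∀ (i : Fin 3) → 0ℚ ℚ.≤ pair x (suc i) (inject₁ i) × pair x (suc i) (inject₁ i) ℚ.≤ 1ℚ) → InPiMinus x
bounds⇒piMinus x E bounds = apply w₀ x ,
  (InE-eval (# 1 ∷ # 2 ∷ # 1 ∷ # 3 ∷ # 2 ∷ # 1 ∷ []) x E ,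
   λ i → subst (λ u → 0ℚ ℚ.≤ u × u ℚ.≤ 1ℚ) (sym (w₀-pair-up x i)) (bounds (Fin.opposite i))) ,
  trans (sym (apply-∘ w₀ w₀ x)) (apply-id x)

-- The box conditions read at the centre of the alcove. They decide for the whole alcove, since the
-- faces of the box lie on hyperplanes of the arrangement.
InBox : Aff → Set
InBox f = ∀ (i : Fin 3) → b f (inject₁ i) < b f (suc i) × b f (suc i) < b f (inject₁ i) + + 4

inF⇒inBox : ∀ f → InF f → InBox f
inF⇒inBox f (Wf , sub) i =
  subst (b f (inject₁ i) <_) (ℤ.+-identityʳ (b f (suc i)))
    (sides-< f G {x} sides (inject₁ i) (suc i) (i≢ ∘ sym) 0ℤ
      (λ pos → ℚ.<-irrefl refl (ℚ.<-≤-trans pos (subst (ℚ._≤ 0ℚ) (sym (pair-neg x (inject₁ i) (suc i))) (ℚ.neg-antimono-≤ (proj₁ range)))))) ,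
  sides-< f G {x} sides (suc i) (inject₁ i) i≢ 1ℤ (λ gt → ℚ.<-irrefl refl (ℚ.<-≤-trans gt (proj₂ range)))
  where
  G = InW⇒Good Wf
  x = apply f centre
  A : InAlc f x
  A = centre , centre-InAid , refl
  sides = alcove⇒sides f x A
  range = piMinus⇒bounds x (sub x A) i
  i≢ : suc i ≢ inject₁ i
  i≢ e = ℕ.1+n≢n (trans (cong toℕ e) (Fin.toℕ-inject₁ i))

inBox⇒inF : ∀ f → InW f → InBox f → InF f
inBox⇒inF f Wf box = Wf , λ x A → bounds⇒piMinus x (alcove-InE f x Wf A) λ i →
  ℚ.<⇒≤ (alcove⇒sides f x A (suc i) (inject₁ i) 0ℤ (<-by (<⇒0≤ (proj₁ (box i)) ∷ []) (identity₀ (b f (inject₁ i)) (b f (suc i))))) ,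
  subst₂ ℚ._≤_ (sym (pair-neg x (suc i) (inject₁ i))) refl
    (ℚ.<⇒≤ (ℚ.neg-antimono-< (alcove⇒sides f x A (inject₁ i) (suc i) -1ℤ (<-by (<⇒0≤ (proj₂ (box i)) ∷ []) (identity₁ (b f (inject₁ i)) (b f (suc i)))))))
  where
  identity₀ : ∀ u v → (v - (1ℤ + u)) + 0ℤ ≡ (v - u) - (1ℤ + + 4 * 0ℤ)
  identity₀ = solve-∀
  identity₁ : ∀ u v → (u + + 4 - (1ℤ + v)) + 0ℤ ≡ (u - v) - (1ℤ + + 4 * -1ℤ)
  identity₁ = solve-∀

aElt-inBox : ∀ a → InBox (aElt a)
aElt-inBox = from-yes (Fin.all? {6} λ a → Fin.all? {3} λ i →
  (b (aElt a) (inject₁ i) ℤ.<? b (aElt a) (suc i)) ×-dec (b (aElt a) (suc i) ℤ.<? b (aElt a) (inject₁ i) + + 4))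

-- All candidates for the values of an element of the box: the first is -k with k ≤ 3 because of the
-- sum 6, and consecutive ones differ by 1, 2 or 3. This leaves 108 cases to inspect.
staircase : Fin 4 → Fin 3 → Fin 3 → Fin 3 → Fin 4 → ℤ
staircase k d₁ d₂ d₃ = lookup (β₀ ∷ β₁ ∷ β₂ ∷ β₂ + + suc (toℕ d₃) ∷ [])
  where
  β₀ = - + toℕ k
  β₁ = β₀ + + suc (toℕ d₁)
  β₂ = β₁ + + suc (toℕ d₂)

staircase-∈aList : ∀ k d₁ d₂ d₃ → let f = fromB (staircase k d₁ d₂ d₃) in
  sumF (staircase k d₁ d₂ d₃) ≡ + 6 → (∀ i j → lookup (perm f) i ≡ lookup (perm f) j → i ≡ j) → f ∈ aList
staircase-∈aList = from-yes (Fin.all? λ k → Fin.all? λ d₁ → Fin.all? λ d₂ → Fin.all? λ d₃ →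
  let f = fromB (staircase k d₁ d₂ d₃) in
  (sumF (staircase k d₁ d₂ d₃) ℤ.≟ + 6) →-dec
  ((Fin.all? λ i → Fin.all? λ j → (lookup (perm f) i Fin.≟ lookup (perm f) j) →-dec (i Fin.≟ j)) →-dec (f ∈? aList)))

toFin : ∀ {n u} → 0ℤ ≤ u → u < + n → ∃[ k ] + toℕ {n} k ≡ u
toFin {n} {u} u≥0 u<n = Fin.fromℕ< k<n , trans (cong +_ (Fin.toℕ-fromℕ< k<n)) (proj₂ (toNat u≥0))
  where
  k<n : proj₁ (toNat u≥0) ℕ.< n
  k<n = ℤ.drop‿+<+ (subst (_< + n) (sym (proj₂ (toNat u≥0))) u<n)

inF⇒∈aList : ∀ f → InF f → f ∈ aList
inF⇒∈aList f F = subst (_∈ aList) (sym f≡) (staircase-∈aList (proj₁ start) (proj₁ (D 0F)) (proj₁ (D 1F)) (proj₁ (D 2F))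
  (trans (cong₄ (β-eq 0F′) (β-eq 1F′) (β-eq 2F′) (β-eq 3F′)) sum)
  (λ i j e → perm-injective G (subst (λ g → lookup (perm g) i ≡ lookup (perm g) j) (sym f≡) e)))
  where
  G = InW⇒Good (proj₁ F)
  box = inF⇒inBox f F
  0F 1F 2F : Fin 3
  0F = # 0
  1F = # 1
  2F = # 2
  0F′ 1F′ 2F′ 3F′ : Fin 4
  0F′ = # 0
  1F′ = # 1
  2F′ = # 2
  3F′ = # 3
  b₀ = b f 0F′
  b₁ = b f 1F′
  b₂ = b f 2F′
  b₃ = b f 3F′
  sum : b₀ + b₁ + b₂ + b₃ ≡ + 6
  sum = b-sum f G
  three : 0ℤ ≤ + 3
  three = +≤+ ℕ.z≤n
  cong₄ : ∀ {a b c d a′ b′ c′ d′ : ℤ} → a ≡ a′ → b ≡ b′ → c ≡ c′ → d ≡ d′ → a + b + c + d ≡ a′ + b′ + c′ + d′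
  cong₄ refl refl refl refl = refl

  D : ∀ (i : Fin 3) → ∃[ d ] + toℕ {3} d ≡ b f (suc i) - (1ℤ + b f (inject₁ i))
  D i = toFin (<⇒0≤ (proj₁ (box i))) (<-by (<⇒0≤ (proj₂ (box i)) ∷ []) (identity (b f (inject₁ i)) (b f (suc i))))
    where
    identity : ∀ u v → (u + + 4 - (1ℤ + v)) + 0ℤ ≡ + 3 - (1ℤ + (v - (1ℤ + u)))
    identity = solve-∀

  start : ∃[ k ] + toℕ {4} k ≡ - b₀
  start = toFin (ℤ.neg-mono-≤ (ℤ.≮⇒≥ too-high)) (ℤ.≰⇒> too-low)
    where
    identity-high : ∀ a b c d → (b - (1ℤ + a)) + ((b - (1ℤ + a)) + ((b - (1ℤ + a)) + ((c - (1ℤ + b)) + ((c - (1ℤ + b)) + ((d - (1ℤ + c)) +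
      ((a - (1ℤ + 0ℤ)) + ((a - (1ℤ + 0ℤ)) + ((a - (1ℤ + 0ℤ)) + ((a - (1ℤ + 0ℤ)) + ((+ 6 - (a + b + c + d)) + (+ 3 + 0ℤ))))))))))) ≡ -1ℤ
    identity-high = solve-∀
    identity-low : ∀ a b c d → (a + + 4 - (1ℤ + b)) + ((a + + 4 - (1ℤ + b)) + ((a + + 4 - (1ℤ + b)) + ((b + + 4 - (1ℤ + c)) + ((b + + 4 - (1ℤ + c)) + ((c + + 4 - (1ℤ + d)) +
      ((- a - + 4) + ((- a - + 4) + ((- a - + 4) + ((- a - + 4) + (((a + b + c + d) - + 6) + (+ 3 + 0ℤ))))))))))) ≡ -1ℤ
    identity-low = solve-∀
    up₀ = <⇒0≤ (proj₁ (box 0F))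
    up₁ = <⇒0≤ (proj₁ (box 1F))
    up₂ = <⇒0≤ (proj₁ (box 2F))
    dn₀ = <⇒0≤ (proj₂ (box 0F))
    dn₁ = <⇒0≤ (proj₂ (box 1F))
    dn₂ = <⇒0≤ (proj₂ (box 2F))
    too-high : ¬ (0ℤ < b₀)
    too-high p = ⊥-by (up₀ ∷ up₀ ∷ up₀ ∷ up₁ ∷ up₁ ∷ up₂ ∷ <⇒0≤ p ∷ <⇒0≤ p ∷ <⇒0≤ p ∷ <⇒0≤ p ∷ ≡⇒0≤ sum ∷ three ∷ []) (identity-high b₀ b₁ b₂ b₃)
    too-low : ¬ (+ 4 ≤ - b₀)
    too-low p = ⊥-by (dn₀ ∷ dn₀ ∷ dn₀ ∷ dn₁ ∷ dn₁ ∷ dn₂ ∷ ≤⇒0≤ p ∷ ≤⇒0≤ p ∷ ≤⇒0≤ p ∷ ≤⇒0≤ p ∷ ≡⇒0≤ (sym sum) ∷ three ∷ []) (identity-low b₀ b₁ b₂ b₃)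

  climb-by : ∀ u v → u + (1ℤ + (v - (1ℤ + u))) ≡ v
  climb-by = solve-∀
  β = staircase (proj₁ start) (proj₁ (D 0F)) (proj₁ (D 1F)) (proj₁ (D 2F))
  e₀ : β 0F′ ≡ b₀
  e₀ = trans (cong -_ (proj₂ start)) (ℤ.neg-involutive b₀)
  e₁ : β 1F′ ≡ b₁
  e₁ = trans (cong₂ (λ u d → u + (1ℤ + d)) e₀ (proj₂ (D 0F))) (climb-by b₀ b₁)
  e₂ : β 2F′ ≡ b₂
  e₂ = trans (cong₂ (λ u d → u + (1ℤ + d)) e₁ (proj₂ (D 1F))) (climb-by b₁ b₂)
  e₃ : β 3F′ ≡ b₃
  e₃ = trans (cong₂ (λ u d → u + (1ℤ + d)) e₂ (proj₂ (D 2F))) (climb-by b₂ b₃)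
  β-eq : ∀ i → β i ≡ b f i
  β-eq zero                   = e₀
  β-eq (suc zero)             = e₁
  β-eq (suc (suc zero))       = e₂
  β-eq (suc (suc (suc zero))) = e₃
  f≡ : f ≡ fromB β
  f≡ = b-injective λ i → trans (sym (β-eq i)) (sym (b-fromB β i))

∈aList⇒inF : ∀ f → f ∈ aList → InF f
∈aList⇒inF f mem = let a , _ , e = ∈.∈-map⁻ aElt {xs = List.allFin 6} mem in
  subst InF (sym e) (inBox⇒inF (aElt a) (aWord a , refl) (aElt-inBox a))

-- The number of elements of a lower interval

enumerate : ∀ a x y z {n} → let v = x ∷ y ∷ z ∷ [] in
  HasCard (λ w → ∃[ p ] (Polytope (formOf (points (shape a))) v p × Chart (κ v) p w)) n →
  ∃[ L ] (IsI (aElt a) x y z L × length L ≡ n)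
enumerate a x y z (L , u , mem , len) =
  L , (θ I , theta-exists a x y z , u , λ w → proj₂ (below-θ I w) ∘ proj₁ (mem w) , proj₂ (mem w) ∘ proj₁ (below-θ I w)) , len
  where
  I : shape a atWeight (x ∷ y ∷ z ∷ [])
  I = interval a x y z

abstract
  interval-enumeration : ∀ a x y z → ∃[ L ] (IsI (aElt a) x y z L × length L ≡ evalℕ (countOf a) (x ∷ y ∷ z ∷ []))
  interval-enumeration a x y z = enumerate a x y z (shape-card a x y z)

same-length : ∀ a x y z L L′ → IsI a x y z L → IsI a x y z L′ → length L ≡ length L′
same-length a x y z L L′ (θ₁ , isθ₁ , u₁ , mem₁) (θ₂ , isθ₂ , u₂ , mem₂) with theta-unique a (weight x y z) θ₁ θ₂ isθ₁ isθ₂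
... | refl = Unique-length u₁ u₂ mem₁ mem₂

interval-length : ∀ a x y z L → IsI (aElt a) x y z L → length L ≡ evalℕ (countOf a) (x ∷ y ∷ z ∷ [])
interval-length a x y z L isI = let L₀ , isI₀ , len = interval-enumeration a x y z in
  trans (same-length (aElt a) x y z L L₀ isI isI₀) len

-- Comparison with the volume polynomials

module RealAlgebra (F : RealsLike) where

  open RealsLike F renaming (_+_ to _+R_; _*_ to _*R_; -_ to -R_; refl to refl≈; sym to sym≈; trans to trans≈)
  open import Algebra.Solver.Ring.NaturalCoefficients.Default commutativeSemiring using () renaming (Polynomial to PolyR; var to varR; prove to proveR; con to kon; _:+_ to _⟦+⟧_; _:*_ to _⟦*⟧_; _:=_ to _⟦=⟧_; solve to solveR)
  open import Algebra.Properties.Group +-group using (∙-cancelʳ)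

  n̂ : ℕ → Carrier
  n̂ = litR R

  n̂-+ : ∀ m n → n̂ (m ℕ.+ n) ≈ n̂ m +R n̂ n
  n̂-+ zero    n = sym≈ (+-identityˡ (n̂ n))
  n̂-+ (suc m) n = trans≈ (+-congˡ (n̂-+ m n)) (sym≈ (+-assoc 1# (n̂ m) (n̂ n)))

  n̂-* : ∀ m n → n̂ (m ℕ.* n) ≈ n̂ m *R n̂ n
  n̂-* zero    n = sym≈ (zeroˡ (n̂ n))
  n̂-* (suc m) n = trans≈ (n̂-+ n (m ℕ.* n)) (trans≈ (+-congˡ (n̂-* m n))
    (solveR 2 (λ m n → n ⟦+⟧ m ⟦*⟧ n ⟦=⟧ (kon 1 ⟦+⟧ m) ⟦*⟧ n) refl≈ (n̂ m) (n̂ n)))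

  evalR : Expr → Vec ℕ 3 → Carrier
  evalR (X i)   v = n̂ (lookup v i)
  evalR (K n)   v = n̂ n
  evalR (e ⊕ f) v = evalR e v +R evalR f v
  evalR (e ⊗ f) v = evalR e v *R evalR f v

  evalR-correct : ∀ e v → n̂ (evalℕ e v) ≈ evalR e v
  evalR-correct (X i)   v = refl≈
  evalR-correct (K n)   v = refl≈
  evalR-correct (e ⊕ f) v = trans≈ (n̂-+ (evalℕ e v) (evalℕ f v)) (+-cong (evalR-correct e v) (evalR-correct f v))
  evalR-correct (e ⊗ f) v = trans≈ (n̂-* (evalℕ e v) (evalℕ f v)) (*-cong (evalR-correct e v) (evalR-correct f v))

  -- The integers 4, 6, 9, 12, 36 are arguments, so that the identities below can treat them as
  -- indeterminates.
  cubic : (k u₁ u₂ u₃ v₁₂ v₁₃ v₂₃ w n₄ n₆ n₉ n₁₂ n₃₆ x y z : Carrier) → Carrier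
  cubic k u₁ u₂ u₃ v₁₂ v₁₃ v₂₃ w n₄ n₆ n₉ n₁₂ n₃₆ x y z =
    k +R (u₁ *R x +R u₂ *R y +R u₃ *R z) +R v₁₂ *R (x *R x +R n₄ *R x *R y +R y *R y) +R v₁₃ *R x *R z +R v₂₃ *R (y *R y +R n₄ *R y *R z +R z *R z)
    +R w *R (x *R x *R x +R n₆ *R x *R x *R y +R n₁₂ *R x *R y *R y +R n₄ *R y *R y *R y +R n₉ *R x *R x *R z
             +R n₃₆ *R x *R y *R z +R n₁₂ *R y *R y *R z +R n₉ *R x *R z *R z +R n₆ *R y *R z *R z +R z *R z *R z)

  cubicP : ∀ {n} (k u₁ u₂ u₃ v₁₂ v₁₃ v₂₃ w n₄ n₆ n₉ n₁₂ n₃₆ x y z : PolyR n) → PolyR n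
  cubicP k u₁ u₂ u₃ v₁₂ v₁₃ v₂₃ w n₄ n₆ n₉ n₁₂ n₃₆ x y z =
    k ⟦+⟧ (u₁ ⟦*⟧ x ⟦+⟧ u₂ ⟦*⟧ y ⟦+⟧ u₃ ⟦*⟧ z) ⟦+⟧ v₁₂ ⟦*⟧ (x ⟦*⟧ x ⟦+⟧ n₄ ⟦*⟧ x ⟦*⟧ y ⟦+⟧ y ⟦*⟧ y) ⟦+⟧ v₁₃ ⟦*⟧ x ⟦*⟧ z ⟦+⟧ v₂₃ ⟦*⟧ (y ⟦*⟧ y ⟦+⟧ n₄ ⟦*⟧ y ⟦*⟧ z ⟦+⟧ z ⟦*⟧ z)
    ⟦+⟧ w ⟦*⟧ (x ⟦*⟧ x ⟦*⟧ x ⟦+⟧ n₆ ⟦*⟧ x ⟦*⟧ x ⟦*⟧ y ⟦+⟧ n₁₂ ⟦*⟧ x ⟦*⟧ y ⟦*⟧ y ⟦+⟧ n₄ ⟦*⟧ y ⟦*⟧ y ⟦*⟧ y ⟦+⟧ n₉ ⟦*⟧ x ⟦*⟧ x ⟦*⟧ z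
             ⟦+⟧ n₃₆ ⟦*⟧ x ⟦*⟧ y ⟦*⟧ z ⟦+⟧ n₁₂ ⟦*⟧ y ⟦*⟧ y ⟦*⟧ z ⟦+⟧ n₉ ⟦*⟧ x ⟦*⟧ z ⟦*⟧ z ⟦+⟧ n₆ ⟦*⟧ y ⟦*⟧ z ⟦*⟧ z ⟦+⟧ z ⟦*⟧ z ⟦*⟧ z)

  J∅ J₁ J₂ J₃ J₁₂ J₁₃ J₂₃ J₁₂₃ : Subset 3
  J∅   = false ∷ false ∷ false ∷ []
  J₁   = true ∷ false ∷ false ∷ []
  J₂   = false ∷ true ∷ false ∷ []
  J₃   = false ∷ false ∷ true ∷ []
  J₁₂  = true ∷ true ∷ false ∷ []
  J₁₃  = true ∷ false ∷ true ∷ []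
  J₂₃  = false ∷ true ∷ true ∷ []
  J₁₂₃ = true ∷ true ∷ true ∷ []

  -- Each volume polynomial is a unit times a polynomial with integer coefficients; the units √2,
  -- √3/2, 2 and 1/3 are absorbed into the coefficients here.
  module Normalised (ν : Subset 3 → Carrier) where

    k u₁ u₂ u₃ v₁₂ v₁₃ v₂₃ w : Carrier
    k   = ν J∅
    u₁  = ν J₁ *R √2
    u₂  = ν J₂ *R √2
    u₃  = ν J₃ *R √2
    v₁₂ = ν J₁₂ *R √3 *R half
    v₁₃ = ν J₁₃ *R n̂ 2
    v₂₃ = ν J₂₃ *R √3 *R half
    w   = ν J₁₂₃ *R third

    at : ℕ → ℕ → ℕ → Carrier
    at x y z = cubic k u₁ u₂ u₃ v₁₂ v₁₃ v₂₃ w (n̂ 4) (n̂ 6) (n̂ 9) (n̂ 12) (n̂ 36) (n̂ x) (n̂ y) (n̂ z)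

  -- Used to pull the common factor 1/2 or 1/3 out of a volume polynomial, as in 2 = (1/3) 6.
  divide : ∀ m n {c} → n̂ n *R c ≈ 1# → n̂ m ≈ c *R n̂ (n ℕ.* m)
  divide m n {c} inv = sym≈ (trans≈ (*-congˡ (n̂-* n m))
    (trans≈ (solveR 3 (λ c n m → c ⟦*⟧ (n ⟦*⟧ m) ⟦=⟧ (n ⟦*⟧ c) ⟦*⟧ m) refl≈ c (n̂ n) (n̂ m)) (trans≈ (*-congʳ inv) (*-identityˡ (n̂ m)))))

  face₂ : ∀ ν x y → ν *R ((√3 *R half *R x *R x) +R (n̂ 2 *R √3 *R x *R y) +R (√3 *R half *R y *R y)) ≈
                    (ν *R √3 *R half) *R (x *R x +R n̂ 4 *R x *R y +R y *R y)
  face₂ ν x y = trans≈ (*-congˡ (+-congʳ (+-congˡ (*-congʳ (*-congʳ (*-congʳ (divide 2 2 half-inv)))))))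
    (solveR 6 (λ ν s h f x y → ν ⟦*⟧ ((s ⟦*⟧ h ⟦*⟧ x ⟦*⟧ x) ⟦+⟧ (h ⟦*⟧ f ⟦*⟧ s ⟦*⟧ x ⟦*⟧ y) ⟦+⟧ (s ⟦*⟧ h ⟦*⟧ y ⟦*⟧ y)) ⟦=⟧
       (ν ⟦*⟧ s ⟦*⟧ h) ⟦*⟧ (x ⟦*⟧ x ⟦+⟧ f ⟦*⟧ x ⟦*⟧ y ⟦+⟧ y ⟦*⟧ y)) refl≈ ν √3 half (n̂ 4) x y)

  face₃ : ∀ ν x y z → ν *R ((third *R x *R x *R x) +R (n̂ 2 *R x *R x *R y) +R (n̂ 4 *R x *R y *R y)
    +R (n̂ 4 *R third *R y *R y *R y) +R (n̂ 3 *R x *R x *R z) +R (n̂ 12 *R x *R y *R z) +R (n̂ 4 *R y *R y *R z) +R (n̂ 3 *R x *R z *R z)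
    +R (n̂ 2 *R y *R z *R z) +R (third *R z *R z *R z)) ≈
    (ν *R third) *R (x *R x *R x +R n̂ 6 *R x *R x *R y +R n̂ 12 *R x *R y *R y +R n̂ 4 *R y *R y *R y +R n̂ 9 *R x *R x *R z
             +R n̂ 36 *R x *R y *R z +R n̂ 12 *R y *R y *R z +R n̂ 9 *R x *R z *R z +R n̂ 6 *R y *R z *R z +R z *R z *R z)
  face₃ ν x y z = trans≈ (*-congˡ (+-congʳ
      (+-cong (+-cong (+-cong (+-cong (+-cong (+-congʳ (+-cong (+-congˡ (mul (divide 2 3 third-inv))) (mul (divide 4 3 third-inv))))
        (mul (divide 3 3 third-inv))) (mul (divide 12 3 third-inv))) (mul (divide 4 3 third-inv))) (mul (divide 3 3 third-inv))) (mul (divide 2 3 third-inv)))))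
    (solveR 10 (λ ν t n₄ n₆ n₉ n₁₂ n₃₆ x y z →
       ν ⟦*⟧ ((t ⟦*⟧ x ⟦*⟧ x ⟦*⟧ x) ⟦+⟧ (t ⟦*⟧ n₆ ⟦*⟧ x ⟦*⟧ x ⟦*⟧ y) ⟦+⟧ (t ⟦*⟧ n₁₂ ⟦*⟧ x ⟦*⟧ y ⟦*⟧ y)
         ⟦+⟧ (n₄ ⟦*⟧ t ⟦*⟧ y ⟦*⟧ y ⟦*⟧ y) ⟦+⟧ (t ⟦*⟧ n₉ ⟦*⟧ x ⟦*⟧ x ⟦*⟧ z) ⟦+⟧ (t ⟦*⟧ n₃₆ ⟦*⟧ x ⟦*⟧ y ⟦*⟧ z) ⟦+⟧ (t ⟦*⟧ n₁₂ ⟦*⟧ y ⟦*⟧ y ⟦*⟧ z) ⟦+⟧ (t ⟦*⟧ n₉ ⟦*⟧ x ⟦*⟧ z ⟦*⟧ z)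
         ⟦+⟧ (t ⟦*⟧ n₆ ⟦*⟧ y ⟦*⟧ z ⟦*⟧ z) ⟦+⟧ (t ⟦*⟧ z ⟦*⟧ z ⟦*⟧ z)) ⟦=⟧
       (ν ⟦*⟧ t) ⟦*⟧ (x ⟦*⟧ x ⟦*⟧ x ⟦+⟧ n₆ ⟦*⟧ x ⟦*⟧ x ⟦*⟧ y ⟦+⟧ n₁₂ ⟦*⟧ x ⟦*⟧ y ⟦*⟧ y ⟦+⟧ n₄ ⟦*⟧ y ⟦*⟧ y ⟦*⟧ y ⟦+⟧ n₉ ⟦*⟧ x ⟦*⟧ x ⟦*⟧ z
             ⟦+⟧ n₃₆ ⟦*⟧ x ⟦*⟧ y ⟦*⟧ z ⟦+⟧ n₁₂ ⟦*⟧ y ⟦*⟧ y ⟦*⟧ z ⟦+⟧ n₉ ⟦*⟧ x ⟦*⟧ z ⟦*⟧ z ⟦+⟧ n₆ ⟦*⟧ y ⟦*⟧ z ⟦*⟧ z ⟦+⟧ z ⟦*⟧ z ⟦*⟧ z)) refl≈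
       ν third (n̂ 4) (n̂ 6) (n̂ 9) (n̂ 12) (n̂ 36) x y z)
    where
    mul : ∀ {a a′ b c d} → a ≈ a′ → a *R b *R c *R d ≈ a′ *R b *R c *R d
    mul e = *-congʳ (*-congʳ (*-congʳ e))

  normalise : ∀ ν x y z → ΣμV F ν x y z ≈ Normalised.at ν x y z
  normalise ν x y z = trans≈
    (+-congˡ (+-congˡ (+-congˡ (+-congˡ (+-cong (face₂ (ν J₁₂) (n̂ x) (n̂ y)) (+-congˡ (+-cong (face₂ (ν J₂₃) (n̂ y) (n̂ z)) (+-congʳ (face₃ (ν J₁₂₃) (n̂ x) (n̂ y) (n̂ z))))))))))
    (solveR 13 (λ k ν₁ ν₂ ν₃ ν₁₃ s two x y z T₁₂ T₂₃ T₁₂₃ →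
       k ⟦*⟧ kon 1 ⟦+⟧ (ν₁ ⟦*⟧ (s ⟦*⟧ x) ⟦+⟧ (ν₂ ⟦*⟧ (s ⟦*⟧ y) ⟦+⟧ (ν₃ ⟦*⟧ (s ⟦*⟧ z) ⟦+⟧ (T₁₂ ⟦+⟧ (ν₁₃ ⟦*⟧ (two ⟦*⟧ x ⟦*⟧ z) ⟦+⟧ (T₂₃ ⟦+⟧ (T₁₂₃ ⟦+⟧ kon 0))))))) ⟦=⟧
       k ⟦+⟧ (ν₁ ⟦*⟧ s ⟦*⟧ x ⟦+⟧ ν₂ ⟦*⟧ s ⟦*⟧ y ⟦+⟧ ν₃ ⟦*⟧ s ⟦*⟧ z) ⟦+⟧ T₁₂ ⟦+⟧ ν₁₃ ⟦*⟧ two ⟦*⟧ x ⟦*⟧ z ⟦+⟧ T₂₃ ⟦+⟧ T₁₂₃) refl≈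
       (ν J∅) (ν J₁) (ν J₂) (ν J₃) (ν J₁₃) √2 (n̂ 2) (n̂ x) (n̂ y) (n̂ z)
       ((ν J₁₂ *R √3 *R half) *R (n̂ x *R n̂ x +R n̂ 4 *R n̂ x *R n̂ y +R n̂ y *R n̂ y))
       ((ν J₂₃ *R √3 *R half) *R (n̂ y *R n̂ y +R n̂ 4 *R n̂ y *R n̂ z +R n̂ z *R n̂ z))
       ((ν J₁₂₃ *R third) *R (n̂ x *R n̂ x *R n̂ x +R n̂ 6 *R n̂ x *R n̂ x *R n̂ y +R n̂ 12 *R n̂ x *R n̂ y *R n̂ y +R n̂ 4 *R n̂ y *R n̂ y *R n̂ y +R n̂ 9 *R n̂ x *R n̂ x *R n̂ z
             +R n̂ 36 *R n̂ x *R n̂ y *R n̂ z +R n̂ 12 *R n̂ y *R n̂ y *R n̂ z +R n̂ 9 *R n̂ x *R n̂ z *R n̂ z +R n̂ 6 *R n̂ y *R n̂ z *R n̂ z +R n̂ z *R n̂ z *R n̂ z)))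

  table-√2 : ∀ c → n̂ c *R √2 *R √2 ≈ n̂ 2 *R n̂ c
  table-√2 c = trans≈ (*-assoc (n̂ c) √2 √2) (trans≈ (*-congˡ √2²) (*-comm (n̂ c) (n̂ 2)))

  table-√3 : ∀ d → n̂ (2 ℕ.* d) *R √3 *R √3 *R half ≈ n̂ 3 *R n̂ d
  table-√3 d = trans≈ (*-congʳ (*-congʳ (*-congʳ (n̂-* 2 d))))
    (trans≈ (solveR 4 (λ t d s h → t ⟦*⟧ d ⟦*⟧ s ⟦*⟧ s ⟦*⟧ h ⟦=⟧ (t ⟦*⟧ h) ⟦*⟧ ((s ⟦*⟧ s) ⟦*⟧ d)) refl≈ (n̂ 2) (n̂ d) √3 half)
    (trans≈ (*-cong half-inv (*-congʳ √3²)) (*-identityˡ (n̂ 3 *R n̂ d))))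

  table-third : n̂ 12 *R third ≈ n̂ 4
  table-third = trans≈ (*-comm (n̂ 12) third) (sym≈ (divide 4 3 third-inv))

  table-count : ∀ c₀ c₁ c₂ c₃ d₄ c₅ d₆ x y z →
    evalR (countExpr c₀ c₁ c₂ c₃ d₄ c₅ d₆) (x ∷ y ∷ z ∷ []) ≈ ΣμV F (table F c₀ c₁ c₂ c₃ (2 ℕ.* d₄) c₅ (2 ℕ.* d₆) 12) x y z
  table-count c₀ c₁ c₂ c₃ d₄ c₅ d₆ x y z = trans≈ rearranged (trans≈ (sym≈ coefficients) (sym≈ (normalise (table F c₀ c₁ c₂ c₃ (2 ℕ.* d₄) c₅ (2 ℕ.* d₆) 12) x y z)))
    where
    rearranged : evalR (countExpr c₀ c₁ c₂ c₃ d₄ c₅ d₆) (x ∷ y ∷ z ∷ []) ≈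
      cubic (n̂ c₀) (n̂ 2 *R n̂ c₁) (n̂ 2 *R n̂ c₂) (n̂ 2 *R n̂ c₃) (n̂ 3 *R n̂ d₄) (n̂ c₅ *R n̂ 2) (n̂ 3 *R n̂ d₆) (n̂ 4) (n̂ 4) (n̂ 6) (n̂ 9) (n̂ 12) (n̂ 36) (n̂ x) (n̂ y) (n̂ z)
    rearranged = +-cong (+-cong (+-cong (+-cong (+-congˡ
      (solveR 7 (λ t a b c x y z → t ⟦*⟧ (a ⟦*⟧ x ⟦+⟧ b ⟦*⟧ y ⟦+⟧ c ⟦*⟧ z) ⟦=⟧ t ⟦*⟧ a ⟦*⟧ x ⟦+⟧ t ⟦*⟧ b ⟦*⟧ y ⟦+⟧ t ⟦*⟧ c ⟦*⟧ z) refl≈ (n̂ 2) (n̂ c₁) (n̂ c₂) (n̂ c₃) (n̂ x) (n̂ y) (n̂ z)))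
      refl≈) (*-congʳ (*-congʳ (*-comm (n̂ 2) (n̂ c₅))))) refl≈) refl≈
    coefficients : Normalised.at (table F c₀ c₁ c₂ c₃ (2 ℕ.* d₄) c₅ (2 ℕ.* d₆) 12) x y z ≈
      cubic (n̂ c₀) (n̂ 2 *R n̂ c₁) (n̂ 2 *R n̂ c₂) (n̂ 2 *R n̂ c₃) (n̂ 3 *R n̂ d₄) (n̂ c₅ *R n̂ 2) (n̂ 3 *R n̂ d₆) (n̂ 4) (n̂ 4) (n̂ 6) (n̂ 9) (n̂ 12) (n̂ 36) (n̂ x) (n̂ y) (n̂ z)
    coefficients = +-cong (+-cong (+-congʳ (+-cong
      (+-congˡ (+-cong (+-cong (*-congʳ (table-√2 c₁)) (*-congʳ (table-√2 c₂))) (*-congʳ (table-√2 c₃))))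
      (*-congʳ (table-√3 d₄)))) (*-congʳ (table-√3 d₆))) (*-congʳ table-third)

  count-formula : ∀ a x y z → n̂ (evalℕ (countOf a) (x ∷ y ∷ z ∷ [])) ≈ ΣμV F (μ F a) x y z
  count-formula a x y z = trans≈ (evalR-correct (countOf a) (x ∷ y ∷ z ∷ [])) (go a)
    where
    go : ∀ a → evalR (countOf a) (x ∷ y ∷ z ∷ []) ≈ ΣμV F (μ F a) x y z
    go zero                               = table-count 24  22  28  22  8  36  8  x y z
    go (suc zero)                         = table-count 48  40  52  40  12 60  12 x y z
    go (suc (suc zero))                   = table-count 72  52  70  58  12 72  16 x y z
    go (suc (suc (suc zero)))             = table-count 72  58  70  52  16 72  12 x y z
    go (suc (suc (suc (suc zero))))       = table-count 120 82  100 82  16 96  16 x y z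
    go (suc (suc (suc (suc (suc zero))))) = table-count 192 112 148 112 20 108 20 x y z

  -- Uniqueness of the coefficients

  cancel : ∀ c d a → c *R d ≈ 1# → a *R c ≈ 0# → a ≈ 0#
  cancel c d a inv ac≈0 = trans≈ (sym≈ (*-identityʳ a)) (trans≈ (*-congˡ (sym≈ inv)) (trans≈ (sym≈ (*-assoc a c d)) (trans≈ (*-congʳ ac≈0) (zeroˡ d))))

  cancel-2 : ∀ a → a +R a ≈ 0# → a ≈ 0#
  cancel-2 a e = cancel (n̂ 2) half a half-inv (trans≈ (solveR 1 (λ a → a ⟦*⟧ (kon 1 ⟦+⟧ (kon 1 ⟦+⟧ kon 0)) ⟦=⟧ a ⟦+⟧ a) refl≈ a) e)

  cancel-3 : ∀ a → a +R a +R a ≈ 0# → a ≈ 0#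
  cancel-3 a e = cancel (n̂ 3) third a third-inv (trans≈ (solveR 1 (λ a → a ⟦*⟧ (kon 1 ⟦+⟧ (kon 1 ⟦+⟧ (kon 1 ⟦+⟧ kon 0))) ⟦=⟧ a ⟦+⟧ a ⟦+⟧ a) refl≈ a) e)

  cancel-√2 : ∀ a → a *R √2 ≈ 0# → a ≈ 0#
  cancel-√2 a = cancel √2 (√2 *R half) a (trans≈ (sym≈ (*-assoc √2 √2 half)) (trans≈ (*-congʳ √2²) half-inv))

  cancel-√3 : ∀ a → a *R √3 ≈ 0# → a ≈ 0#
  cancel-√3 a = cancel √3 (√3 *R third) a (trans≈ (sym≈ (*-assoc √3 √3 third)) (trans≈ (*-congʳ √3²) third-inv))

  cancel-half : ∀ a → a *R half ≈ 0# → a ≈ 0#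
  cancel-half a = cancel half (n̂ 2) a (trans≈ (*-comm half (n̂ 2)) half-inv)

  cancel-third : ∀ a → a *R third ≈ 0# → a ≈ 0#
  cancel-third a = cancel third (n̂ 3) a (trans≈ (*-comm third (n̂ 3)) third-inv)

  infixl 6 _∔_

  _∔_ : ∀ {a b} → a ≈ 0# → b ≈ 0# → a +R b ≈ 0#
  p ∔ q = trans≈ (+-cong p q) (+-identityˡ 0#)

  -- Takes the place of subtraction: the identities below are semiring identities, with every term
  -- on the side where its sign is positive.
  drop : ∀ {a b} → b ≈ 0# → a +R b ≈ 0# → a ≈ 0#
  drop {a} {b} b≈0 e = trans≈ (sym≈ (trans≈ (+-congˡ b≈0) (+-identityʳ a))) e

  -- Differences of the vanishing cubic at small points isolate its coefficients.
  module Vanishing (δ : Subset 3 → Carrier) (vanishes : ∀ x y z → Normalised.at δ x y z ≈ 0#) where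
    open Normalised δ

    private
      n₄ = n̂ 4
      n₉ = n̂ 9

      ρ : Vec Carrier 13
      ρ = k ∷ u₁ ∷ u₂ ∷ u₃ ∷ v₁₂ ∷ v₁₃ ∷ v₂₃ ∷ w ∷ n₄ ∷ n̂ 6 ∷ n₉ ∷ n̂ 12 ∷ n̂ 36 ∷ []

      k̂ û₁ û₂ û₃ v̂₁₂ v̂₁₃ v̂₂₃ ŵ n̂₄ n̂₆ n̂₉ n̂₁₂ n̂₃₆ : PolyR 13
      k̂   = varR (# 0)
      û₁   = varR (# 1)
      û₂   = varR (# 2)
      û₃   = varR (# 3)
      v̂₁₂ = varR (# 4)
      v̂₁₃ = varR (# 5)
      v̂₂₃ = varR (# 6)
      ŵ    = varR (# 7)
      n̂₄  = varR (# 8)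
      n̂₆  = varR (# 9)
      n̂₉  = varR (# 10)
      n̂₁₂ = varR (# 11)
      n̂₃₆ = varR (# 12)

      litP : ℕ → PolyR 13
      litP zero    = kon 0
      litP (suc n) = kon 1 ⟦+⟧ litP n

      atP : ℕ → ℕ → ℕ → PolyR 13
      atP x y z = cubicP k̂ û₁ û₂ û₃ v̂₁₂ v̂₁₃ v̂₂₃ ŵ n̂₄ n̂₆ n̂₉ n̂₁₂ n̂₃₆ (litP x) (litP y) (litP z)

    k≈0 : k ≈ 0#
    k≈0 = trans≈ (proveR ρ k̂ (atP 0 0 0) refl≈) (vanishes 0 0 0)

    w≈0 : w ≈ 0#
    -- On the x-axis the third difference f(3) - 3 f(2) + 3 f(1) - f(0) equals 6 w.
    w≈0 = cancel-2 w (cancel-3 (w +R w) (drop (vanishes 2 0 0 ∔ vanishes 2 0 0 ∔ vanishes 2 0 0 ∔ k≈0)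
      (trans≈ (sym≈ (proveR ρ (atP 3 0 0 ⟦+⟧ atP 1 0 0 ⟦+⟧ atP 1 0 0 ⟦+⟧ atP 1 0 0) (((ŵ ⟦+⟧ ŵ) ⟦+⟧ (ŵ ⟦+⟧ ŵ) ⟦+⟧ (ŵ ⟦+⟧ ŵ)) ⟦+⟧ (atP 2 0 0 ⟦+⟧ atP 2 0 0 ⟦+⟧ atP 2 0 0 ⟦+⟧ k̂)) refl≈))
              (vanishes 3 0 0 ∔ vanishes 1 0 0 ∔ vanishes 1 0 0 ∔ vanishes 1 0 0))))

    v₁₂≈0 : v₁₂ ≈ 0#
    -- The second difference f(2) - 2 f(1) + f(0) on the x-axis equals 2 v₁₂ + 6 w.
    v₁₂≈0 = cancel-2 v₁₂ (drop (vanishes 1 0 0 ∔ vanishes 1 0 0 ∔ (w≈0 ∔ w≈0 ∔ w≈0 ∔ w≈0 ∔ w≈0 ∔ w≈0))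
      (trans≈ (sym≈ (proveR ρ (atP 2 0 0 ⟦+⟧ k̂) ((v̂₁₂ ⟦+⟧ v̂₁₂) ⟦+⟧ (atP 1 0 0 ⟦+⟧ atP 1 0 0 ⟦+⟧ (ŵ ⟦+⟧ ŵ ⟦+⟧ ŵ ⟦+⟧ ŵ ⟦+⟧ ŵ ⟦+⟧ ŵ))) refl≈))
              (vanishes 2 0 0 ∔ k≈0)))

    u₁≈0 : u₁ ≈ 0#
    u₁≈0 = drop (k≈0 ∔ v₁₂≈0 ∔ w≈0) (trans≈ (proveR ρ (û₁ ⟦+⟧ (k̂ ⟦+⟧ v̂₁₂ ⟦+⟧ ŵ)) (atP 1 0 0) refl≈) (vanishes 1 0 0))

    nw≈0 : ∀ n → n *R w ≈ 0#
    nw≈0 n = trans≈ (*-congˡ w≈0) (zeroʳ n)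

    v₂₃≈0 : v₂₃ ≈ 0#
    -- The same difference on the y-axis, where the quadratic coefficient is v₁₂ + v₂₃ and the cubic
    -- one is 4 w.
    v₂₃≈0 = cancel-2 v₂₃ (drop (vanishes 0 1 0 ∔ vanishes 0 1 0 ∔ (v₁₂≈0 ∔ v₁₂≈0) ∔ (nw≈0 n₄ ∔ nw≈0 n₄ ∔ nw≈0 n₄ ∔ nw≈0 n₄ ∔ nw≈0 n₄ ∔ nw≈0 n₄))
      (trans≈ (sym≈ (proveR ρ (atP 0 2 0 ⟦+⟧ k̂) ((v̂₂₃ ⟦+⟧ v̂₂₃) ⟦+⟧ (atP 0 1 0 ⟦+⟧ atP 0 1 0 ⟦+⟧ (v̂₁₂ ⟦+⟧ v̂₁₂) ⟦+⟧ (n̂₄ ⟦*⟧ ŵ ⟦+⟧ n̂₄ ⟦*⟧ ŵ ⟦+⟧ n̂₄ ⟦*⟧ ŵ ⟦+⟧ n̂₄ ⟦*⟧ ŵ ⟦+⟧ n̂₄ ⟦*⟧ ŵ ⟦+⟧ n̂₄ ⟦*⟧ ŵ))) refl≈))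
              (vanishes 0 2 0 ∔ k≈0)))

    u₂≈0 : u₂ ≈ 0#
    u₂≈0 = drop (k≈0 ∔ v₁₂≈0 ∔ v₂₃≈0 ∔ nw≈0 n₄) (trans≈ (proveR ρ (û₂ ⟦+⟧ (k̂ ⟦+⟧ v̂₁₂ ⟦+⟧ v̂₂₃ ⟦+⟧ n̂₄ ⟦*⟧ ŵ)) (atP 0 1 0) refl≈) (vanishes 0 1 0))

    u₃≈0 : u₃ ≈ 0#
    u₃≈0 = drop (k≈0 ∔ v₂₃≈0 ∔ w≈0) (trans≈ (proveR ρ (û₃ ⟦+⟧ (k̂ ⟦+⟧ v̂₂₃ ⟦+⟧ ŵ)) (atP 0 0 1) refl≈) (vanishes 0 0 1))

    v₁₃≈0 : v₁₃ ≈ 0#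
    -- Among the terms at (1,0,1), the mixed ones are v₁₃ and two multiples of w; all the others are
    -- already known to vanish.
    v₁₃≈0 = drop (vanishes 1 0 0 ∔ u₃≈0 ∔ v₂₃≈0 ∔ w≈0 ∔ nw≈0 n₉ ∔ nw≈0 n₉)
      (trans≈ (proveR ρ (v̂₁₃ ⟦+⟧ (atP 1 0 0 ⟦+⟧ û₃ ⟦+⟧ v̂₂₃ ⟦+⟧ ŵ ⟦+⟧ n̂₉ ⟦*⟧ ŵ ⟦+⟧ n̂₉ ⟦*⟧ ŵ)) (atP 1 0 1) refl≈) (vanishes 1 0 1))

    δ≈0 : ∀ J → δ J ≈ 0#
    δ≈0 (false ∷ false ∷ false ∷ []) = k≈0
    δ≈0 (true ∷ false ∷ false ∷ [])  = cancel-√2 (δ J₁) u₁≈0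
    δ≈0 (false ∷ true ∷ false ∷ [])  = cancel-√2 (δ J₂) u₂≈0
    δ≈0 (false ∷ false ∷ true ∷ [])  = cancel-√2 (δ J₃) u₃≈0
    δ≈0 (true ∷ true ∷ false ∷ [])   = cancel-√3 (δ J₁₂) (cancel-half (δ J₁₂ *R √3) v₁₂≈0)
    δ≈0 (true ∷ false ∷ true ∷ [])   = cancel (n̂ 2) half (δ J₁₃) half-inv v₁₃≈0
    δ≈0 (false ∷ true ∷ true ∷ [])   = cancel-√3 (δ J₂₃) (cancel-half (δ J₂₃ *R √3) v₂₃≈0)
    δ≈0 (true ∷ true ∷ true ∷ [])    = cancel-third (δ J₁₂₃) w≈0

  coefficients-unique : ∀ (ν ν′ : Subset 3 → Carrier) → (∀ x y z → ΣμV F ν x y z ≈ ΣμV F ν′ x y z) → ∀ J → ν J ≈ ν′ J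
  coefficients-unique ν ν′ same J = trans≈ (restored J) (trans≈ (+-congʳ (Vanishing.δ≈0 δ vanishes J)) (+-identityˡ (ν′ J)))
    where
    δ : Subset 3 → Carrier
    δ J = ν J +R -R ν′ J
    restored : ∀ J → ν J ≈ δ J +R ν′ J
    restored J = sym≈ (trans≈ (+-assoc (ν J) (-R ν′ J) (ν′ J)) (trans≈ (+-congˡ (-‿inverseˡ (ν′ J))) (+-identityʳ (ν J))))
    sumOver : (Subset 3 → Carrier) → ℕ → ℕ → ℕ → List (Subset 3) → Carrier
    sumOver ν x y z = List.foldr (λ J acc → (ν J *R V F J x y z) +R acc) 0#
    additive : ∀ x y z Js → sumOver ν x y z Js ≈ sumOver δ x y z Js +R sumOver ν′ x y z Js
    additive x y z []       = sym≈ (+-identityˡ 0#)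
    additive x y z (J ∷ Js) = trans≈ (+-cong (*-congʳ (restored J)) (additive x y z Js))
      (solveR 5 (λ a b v s t → (a ⟦+⟧ b) ⟦*⟧ v ⟦+⟧ (s ⟦+⟧ t) ⟦=⟧ (a ⟦*⟧ v ⟦+⟧ s) ⟦+⟧ (b ⟦*⟧ v ⟦+⟧ t)) refl≈
        (δ J) (ν′ J) (V F J x y z) (sumOver δ x y z Js) (sumOver ν′ x y z Js))
    vanishes : ∀ x y z → Normalised.at δ x y z ≈ 0#
    vanishes x y z = trans≈ (sym≈ (normalise δ x y z)) (∙-cancelʳ (ΣμV F ν′ x y z) (ΣμV F δ x y z) 0#
      (trans≈ (sym≈ (additive x y z allJ)) (trans≈ (same x y z) (sym≈ (+-identityˡ (ΣμV F ν′ x y z))))))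

theorem4p8 : (∀ (a : Aff) → InF a ⟺ (a ∈ aList))
    ×
    ((F : RealsLike) → (i : Fin 6) →
    (∀ x y z → ∃[ L ] IsI (aElt i) x y z L)
    × CountFormula F (aElt i) (μ F i)
    × (∀ (ν : Subset 3 → RealsLike.Carrier F) → CountFormula F (aElt i) ν →
    ∀ J → RealsLike._≈_ F (ν J) (μ F i J)))
theorem4p8 = (λ a → inF⇒∈aList a , ∈aList⇒inF a) , λ F i →
  let open RealsLike F using (_≈_; reflexive) renaming (sym to sym≈; trans to trans≈)
      open RealAlgebra F
      counted : CountFormula F (aElt i) (μ F i)
      counted = λ x y z L isI → trans≈ (reflexive (cong n̂ (interval-length i x y z L isI))) (count-formula i x y z)
      enumerated : ∀ x y z → ∃[ L ] IsI (aElt i) x y z L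
      enumerated = λ x y z → let L , isI , _ = interval-enumeration i x y z in L , isI
  -- A count formula speaks only about given enumerations; their existence at every (x, y, z) turns
  -- the hypothesis on ν into an identity of functions.
  in enumerated , counted , λ ν formula → coefficients-unique ν (μ F i) λ x y z →
       let L , isI = enumerated x y z in trans≈ (sym≈ (formula x y z L isI)) (counted x y z L isI)
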